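{- For every $n\in\mathbb{N}$, every $\ell=n^{\Omega(1)}$, and every $\varepsilon\geq 1/\mathrm{poly}(n)$, there is a pseudorandom generator $G\colon\{0,1\}^r\to\{0,1\}^n$ with seed length $r=\ell^{2/3+o(1)}$ that $\varepsilon$-fools comparator circuits with $\ell$ wires over $n$ variables. Moreover, for every seed $z\in\{0,1\}^r$ there is a Boolean circuit $D_z$ of size $\ell^{2/3+o(1)}$ that, given as input $j\in[n]$, computes the $j$-th bit of $G(z)$.
   Context: A comparator circuit on $n$ variables consists of a set of wires, each labelled by an input literal ($x_i$ or $\neg x_i$), a sequence of gates, each an ordered pair of distinct wires $(w_i,w_j)$, and a designated output wire; on input $a$, wires are initialised with the values of their literals, each gate in order replaces the current values $(u,v)$ of its two wires by $(u\wedge v,u\vee v)$, and the output is the final value of the output wire. A generator $G\colon\{0,1\}^r\to\{0,1\}^n$ $\varepsilon$-fools a class of circuits if for every $C\colon\{0,1\}^n\to\{0,1\}$ in the class, $\left|\Pr_{z\in\{0,1\}^r}[C(G(z))=1]-\Pr_{x\in\{0,1\}^n}[C(x)=1]\right|\leq\varepsilon$. -}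

module Defs where

open import Data.Bool using (Bool; true; false; _∧_; _∨_; not)
open import Data.Nat using (ℕ; zero; suc; _+_; _*_; _^_; _∸_; _≤_)
open import Data.Nat.Properties using (m^n≢0)
open import Data.Fin using (Fin; zero; suc)
open import Data.Vec using (Vec; []; _∷_; lookup; _[_]≔_; _∷ʳ_)
open import Data.List using (List; []; _∷_; map; concatMap; foldl)
open import Data.Integer using (+_)
open import Data.Rational using (ℚ; _/_; _-_; ∣_∣)
open import Relation.Binary.PropositionalEquality using (_≡_; _≢_)
open import Data.Product using (_×_)

record Literal (n : ℕ) : Set where
  constructor lit
  field
    var      : Fin n
    positive : Bool

evalLit : ∀ {n} → Literal n → Vec Bool n → Bool
evalLit (lit i true)  a = lookup a i
evalLit (lit i false) a = not (lookup a i)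

record CompGate (ℓ : ℕ) : Set where
  constructor gate
  field
    w₁       : Fin ℓ
    w₂       : Fin ℓ
    distinct : w₁ ≢ w₂

record CompCircuit (n ℓ : ℕ) : Set where
  field
    labels : Fin ℓ → Literal n
    gates  : List (CompGate ℓ)
    output : Fin ℓ

applyGate : ∀ {ℓ} → Vec Bool ℓ → CompGate ℓ → Vec Bool ℓ
applyGate v (gate i j _) =
  let u = lookup v i ; w = lookup v j
  in (v [ i ]≔ (u ∧ w)) [ j ]≔ (u ∨ w)

initWires : ∀ {n ℓ} → (Fin ℓ → Literal n) → Vec Bool n → Vec Bool ℓ
initWires {ℓ = zero}  f a = []
initWires {ℓ = suc ℓ} f a = evalLit (f zero) a ∷ initWires (λ i → f (suc i)) a

evalComp : ∀ {n ℓ} → CompCircuit n ℓ → Vec Bool n → Bool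
evalComp C a =
  lookup (foldl applyGate (initWires (CompCircuit.labels C) a) (CompCircuit.gates C))
         (CompCircuit.output C)

allVecs : (m : ℕ) → List (Vec Bool m)
allVecs zero    = [] ∷ []
allVecs (suc m) = concatMap (λ v → (false ∷ v) ∷ (true ∷ v) ∷ []) (allVecs m)

countTrue : ∀ {m} → (Vec Bool m → Bool) → List (Vec Bool m) → ℕ
countTrue f []       = 0
countTrue f (x ∷ xs) with f x
... | true  = suc (countTrue f xs)
... | false = countTrue f xs

Pr : (m : ℕ) → (Vec Bool m → Bool) → ℚ
Pr m f = (+ countTrue f (allVecs m) / (2 ^ m)) {{m^n≢0 2 m}}

FoolsComparator : ∀ {r n} → (Vec Bool r → Vec Bool n) → (ℓ : ℕ) → ℚ → Set
FoolsComparator {r} {n} G ℓ ε =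
  (C : CompCircuit n ℓ) →
  Data.Rational._≤_ ∣ Pr r (λ z → evalComp C (G z)) - Pr n (evalComp C) ∣ ε

-- Boolean circuits (fan-in ≤ 2, basis AND, OR, NOT) as straight-line
-- programs.  A BoolCirc m k has m inputs and k ∸ m gates; node indices
-- Fin k refer to inputs (first m) or earlier gates.

data BGate (k : ℕ) : Set where
  AND : Fin k → Fin k → BGate k
  OR  : Fin k → Fin k → BGate k
  NOT : Fin k → BGate k

data BoolCirc (m : ℕ) : ℕ → Set where
  inputs : BoolCirc m m
  _▷_    : ∀ {k} → BoolCirc m k → BGate k → BoolCirc m (suc k)

evalBGate : ∀ {k} → BGate k → Vec Bool k → Bool
evalBGate (AND i j) v = lookup v i ∧ lookup v j
evalBGate (OR i j)  v = lookup v i ∨ lookup v j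
evalBGate (NOT i)   v = not (lookup v i)

evalNodes : ∀ {m k} → BoolCirc m k → Vec Bool m → Vec Bool k
evalNodes inputs  x = x
evalNodes (c ▷ g) x = let v = evalNodes c x in v ∷ʳ evalBGate g v

size : ∀ {m k} → BoolCirc m k → ℕ
size inputs  = 0
size (c ▷ _) = suc (size c)

record Circuit (m : ℕ) : Set where
  constructor circuit
  field
    {nodes} : ℕ
    body    : BoolCirc m nodes
    out     : Fin nodes

evalCircuit : ∀ {m} → Circuit m → Vec Bool m → Bool
evalCircuit (circuit b o) x = lookup (evalNodes b x) o

circuitSize : ∀ {m} → Circuit m → ℕ
circuitSize (circuit b o) = size b

-- Little-endian binary encoding of a natural number with m bits
-- (truncated mod 2^m; used only for j < n ≤ 2^⌈log₂ n⌉).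
toBits : (m : ℕ) → ℕ → Vec Bool m
toBits zero    j = []
toBits (suc m) j = (Data.Nat._%_ j 2 Data.Nat.≡ᵇ 1) ∷ toBits m (Data.Nat._/_ j 2)

{-# OPTIONS --safe #-}

-- Eliminating the constants and the gates between wires already known to be comparable, a comparator circuit of which
-- only m wires carry unfixed variables computes one of 2^(m² polylog) functions.
--
-- Call s : I → {0,1}ⁿ a gadget for m if s(y), y uniform, fools these functions.  From a gadget for m one obtains a
-- generator for M wires: hash the variables in several independent ways into about M/m buckets, draw an independent
-- index y for each bucket, and let every variable be the XOR over the hash functions of its bits in the assignments
-- s(y) of its buckets.  A variable labelling at most m/2 wires shares, under some hash function, its bucket with few
-- other wires; given all else, the circuit is then a function of m wires on this bucket, and the bits in it can be
-- replaced by uniform ones.  The remaining heavy variables are isolated from each other under some hash function, and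
-- one extra bit per bucket suffices for them.
--
-- The seed of the new generator is long, but it can be sampled: if T₁, …, T_q are lists of m² polylog well-chosen
-- seeds, then the seeds T₁[i₁] ⊕ … ⊕ T_q[i_q] fool all the functions above with error 2^-q, since each list halves the
-- bias of every translate of every test.  The lists are hard-wired, so that a gadget for m wires costs m² times the
-- seed length, which is m^(2+o(1)) when m grows by a small power in each step.  Starting from a gadget for
-- ℓ^(1/3) wires, the last generator has seed length and circuit size ℓ^(2/3+o(1)).
module Submission where

open import Defs
open import Data.Bool using (Bool; true; false; _∧_; _∨_; not; _xor_; if_then_else_)
import Data.Bool.Properties as 𝔹ₚ
open import Data.Nat using (ℕ; zero; suc; _+_; _*_; _^_; _∸_; _≤_; _<_; z≤n; s≤s; _≤?_; NonZero; ⌊_/2⌋; ⌈_/2⌉)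
import Data.Nat.Properties as ℕₚ
open import Data.Nat.Tactic.RingSolver using (solve-∀)
open import Algebra.Properties.CommutativeSemigroup ℕₚ.+-commutativeSemigroup using (interchange)
open import Data.Nat.Induction using (<-rec)
open import Data.Nat.Logarithm using (⌈log₂_⌉; ⌈log₂⌉-mono-≤; ⌈log₂2^n⌉≡n; ⌈log₂⌈n/2⌉⌉≡⌈log₂n⌉∸1)
open import Data.Fin using (Fin; zero; suc; toℕ)
open import Data.Vec using (Vec; []; _∷_; lookup; _[_]≔_; _∷ʳ_)
import Data.Vec.Properties as Vecₚ
open import Data.List using (List; []; _∷_; length; _++_; foldl)
import Data.List.Properties as Listₚ
open import Data.List.Membership.Propositional using (_∈_)
open import Data.List.Membership.Propositional.Properties using (∈-++⁺ˡ; ∈-++⁺ʳ; ∈-map⁺)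
open import Data.List.Relation.Unary.Any using (here; there)
open import Data.Fin.Permutation.Components using (transpose; transpose-inverse)
import Data.Fin.Properties as Finₚ
open import Data.Nat.DivMod using (_%_; _mod_; m<n⇒m%n≡m; m%n<n; m≡m%n+[m/n]*n; m<n*o⇒m/o<n; m/n*n≤m; m*n/n≡m; /-monoˡ-≤)
open import Data.Integer using (+_)
import Data.Integer as ℤ
import Data.Integer.Tactic.RingSolver as ℤ-Solver
open import Data.Rational using (ℚ; 0ℚ; 1ℚ; ½; _/_; nonNegative; toℚᵘ)
  renaming (_+_ to _+ℚ_; _*_ to _*ℚ_; _-_ to _-ℚ_; -_ to -ℚ_; _≤_ to _≤ℚ_; _<_ to _<ℚ_; ∣_∣ to ∣_∣ℚ)
import Data.Rational.Properties as ℚₚ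
open import Data.Rational.Unnormalised using (mkℚᵘ; *≡*)
import Data.Rational.Unnormalised as ℚᵘ
import Data.Rational.Unnormalised.Properties as ℚᵘₚ
open import Data.Rational.Solver using (module +-*-Solver)
open +-*-Solver using (solve; _:+_; _:*_; _:-_; :-_; _:=_; con)
open import Data.Product using (Σ; ∃-syntax; _×_; _,_; proj₁; proj₂)
open import Data.Sum using (_⊎_; inj₁; inj₂)
open import Data.Empty using (⊥; ⊥-elim)
open import Function using (_∘_; id)
open import Relation.Nullary using (¬_; yes; no)
open import Relation.Nullary.Decidable using (⌊_⌋; True; toWitness)
open import Relation.Binary.PropositionalEquality
  using (_≡_; _≢_; refl; sym; trans; cong; cong₂; subst; subst₂; module ≡-Reasoning)

-- Uniform expectation over structured bit strings

-- Why XOR: with everything but the index of one bucket fixed, the other hash functions contribute a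
-- fixed translation, and the tests are closed under translations because literals carry signs. So
-- buckets can be made uniform one after another, at the price of one gadget error per variable
-- name. Names have `l` bits, so a stage multiplies the error by 2^l, and the gadget before it needs
-- l + 2 more bits of accuracy.
--
-- Why small powers: going from m to m′ = m · 2^e wires takes about 2^e buckets, so the sampled
-- seeds have length about 2^e and the lists, m′² long, cost m′² · 2^e. A single step from 1 to
-- ℓ^(1/3) would cost ℓ; with `L` steps 2^e is only m′^(1/L).
--
-- Why ℓ^(1/3): the last generator has ℓ/m buckets and a gadget of cost m², which balance at m =
-- ℓ^(1/3). The two costs add instead of multiplying, because each layer first looks up the index of
-- its bucket and then evaluates the gadget once.

infixr 4 _⊗_

-- Shapes of probability spaces. Expectation, XOR and circuits are defined by recursion on the
-- shape; flat seeds appear only in the final generator.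
data U : Set where
  bit : U
  _⊗_ : U → U → U
  vec : U → ℕ → U

-- The leaf type is a parameter because the same shapes later hold node indices of a circuit in
-- place of bits.
Str : Set → U → Set
Str A bit       = A
Str A (u ⊗ v)   = Str A u × Str A v
Str A (vec u n) = Vec (Str A u) n

El : U → Set
El = Str Bool

bits : U → ℕ
bits bit       = 1
bits (u ⊗ v)   = bits u + bits v
bits (vec u n) = n * bits u

𝔼 : ∀ u → (El u → ℚ) → ℚ
𝔼 bit               f = ½ *ℚ (f false +ℚ f true)
𝔼 (u ⊗ v)           f = 𝔼 u λ x → 𝔼 v λ y → f (x , y)
𝔼 (vec u zero)      f = f []
𝔼 (vec u (suc n))   f = 𝔼 u λ x → 𝔼 (vec u n) λ xs → f (x ∷ xs)

𝔼-cong : ∀ u {f g : El u → ℚ} → (∀ x → f x ≡ g x) → 𝔼 u f ≡ 𝔼 u g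
𝔼-cong bit             h = cong₂ (λ a b → ½ *ℚ (a +ℚ b)) (h false) (h true)
𝔼-cong (u ⊗ v)         h = 𝔼-cong u λ x → 𝔼-cong v λ y → h (x , y)
𝔼-cong (vec u zero)    h = h []
𝔼-cong (vec u (suc n)) h = 𝔼-cong u λ x → 𝔼-cong (vec u n) λ xs → h (x ∷ xs)

𝔼-mono : ∀ u {f g : El u → ℚ} → (∀ x → f x ≤ℚ g x) → 𝔼 u f ≤ℚ 𝔼 u g
𝔼-mono bit             h = ℚₚ.*-monoˡ-≤-nonNeg ½ (ℚₚ.+-mono-≤ (h false) (h true))
𝔼-mono (u ⊗ v)         h = 𝔼-mono u λ x → 𝔼-mono v λ y → h (x , y)
𝔼-mono (vec u zero)    h = h []
𝔼-mono (vec u (suc n)) h = 𝔼-mono u λ x → 𝔼-mono (vec u n) λ xs → h (x ∷ xs)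

𝔼-+ : ∀ u (f g : El u → ℚ) → 𝔼 u (λ x → f x +ℚ g x) ≡ 𝔼 u f +ℚ 𝔼 u g
𝔼-+ bit f g =
  solve 4 (λ a b c d → con ½ :* ((a :+ b) :+ (c :+ d)) := con ½ :* (a :+ c) :+ con ½ :* (b :+ d)) refl
    (f false) (g false) (f true) (g true)
𝔼-+ (u ⊗ v) f g = trans (𝔼-cong u λ x → 𝔼-+ v _ _) (𝔼-+ u _ _)
𝔼-+ (vec u zero) f g = refl
𝔼-+ (vec u (suc n)) f g = trans (𝔼-cong u λ x → 𝔼-+ (vec u n) _ _) (𝔼-+ u _ _)

𝔼-* : ∀ u c (f : El u → ℚ) → 𝔼 u (λ x → c *ℚ f x) ≡ c *ℚ 𝔼 u f
𝔼-* bit c f =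
  solve 3 (λ c a b → con ½ :* ((c :* a) :+ (c :* b)) := c :* (con ½ :* (a :+ b))) refl c (f false) (f true)
𝔼-* (u ⊗ v) c f = trans (𝔼-cong u λ x → 𝔼-* v c _) (𝔼-* u c _)
𝔼-* (vec u zero) c f = refl
𝔼-* (vec u (suc n)) c f = trans (𝔼-cong u λ x → 𝔼-* (vec u n) c _) (𝔼-* u c _)

𝔼-const : ∀ u c → 𝔼 u (λ _ → c) ≡ c
𝔼-const bit c = solve 1 (λ c → con ½ :* (c :+ c) := c) refl c
𝔼-const (u ⊗ v) c = trans (𝔼-cong u λ x → 𝔼-const v c) (𝔼-const u c)
𝔼-const (vec u zero) c = refl
𝔼-const (vec u (suc n)) c = trans (𝔼-cong u λ x → 𝔼-const (vec u n) c) (𝔼-const u c)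

𝔼-swap : ∀ u v (f : El u → El v → ℚ) →
         (𝔼 u λ x → 𝔼 v λ y → f x y) ≡ (𝔼 v λ y → 𝔼 u λ x → f x y)
𝔼-swap bit v f =
  trans (cong (½ *ℚ_) (sym (𝔼-+ v (f false) (f true))))
        (sym (𝔼-* v ½ (λ y → f false y +ℚ f true y)))
𝔼-swap (u ⊗ w) v f = trans (𝔼-cong u λ x → 𝔼-swap w v _) (𝔼-swap u v _)
𝔼-swap (vec u zero) v f = refl
𝔼-swap (vec u (suc n)) v f = trans (𝔼-cong u λ x → 𝔼-swap (vec u n) v _) (𝔼-swap u v _)

𝔼-neg : ∀ u (f : El u → ℚ) → 𝔼 u (λ x → -ℚ f x) ≡ -ℚ 𝔼 u f
𝔼-neg u f = trans (𝔼-cong u λ x → neg≡ (f x)) (trans (𝔼-* u (-ℚ 1ℚ) f) (sym (neg≡ (𝔼 u f))))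
  where
  neg≡ : ∀ a → -ℚ a ≡ (-ℚ 1ℚ) *ℚ a
  neg≡ = solve 1 (λ a → :- a := (:- con 1ℚ) :* a) refl

𝔼-bounded : ∀ u {c} {f : El u → ℚ} → (∀ x → f x ≤ℚ c) → 𝔼 u f ≤ℚ c
𝔼-bounded u {c} h = ℚₚ.≤-trans (𝔼-mono u h) (ℚₚ.≤-reflexive (𝔼-const u c))

𝔼-bounded-below : ∀ u {c} {f : El u → ℚ} → (∀ x → c ≤ℚ f x) → c ≤ℚ 𝔼 u f
𝔼-bounded-below u {c} h = ℚₚ.≤-trans (ℚₚ.≤-reflexive (sym (𝔼-const u c))) (𝔼-mono u h)

𝔼-product : ∀ u v (f : El u → ℚ) (g : El v → ℚ) →
            (𝔼 u λ x → 𝔼 v λ y → f x *ℚ g y) ≡ 𝔼 u f *ℚ 𝔼 v g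
𝔼-product u v f g = begin
  (𝔼 u λ x → 𝔼 v λ y → f x *ℚ g y) ≡⟨ 𝔼-cong u (λ x → trans (𝔼-* v (f x) g) (ℚₚ.*-comm (f x) (𝔼 v g))) ⟩
  (𝔼 u λ x → 𝔼 v g *ℚ f x)         ≡⟨ 𝔼-* u (𝔼 v g) f ⟩
  𝔼 v g *ℚ 𝔼 u f                   ≡⟨ ℚₚ.*-comm (𝔼 v g) (𝔼 u f) ⟩
  𝔼 u f *ℚ 𝔼 v g                   ∎
  where open ≡-Reasoning

a≡½[a+a] : ∀ a → a ≡ ½ *ℚ (a +ℚ a)
a≡½[a+a] = solve 1 (λ a → a := con ½ :* (a :+ a)) refl

-- Method of conditional expectations: at each bit keep the half with the smaller mean. The
-- hard-wired lists are found in this way.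
𝔼-attained : ∀ u (f : El u → ℚ) → Σ (El u) λ x → f x ≤ℚ 𝔼 u f
𝔼-attained bit f with ℚₚ.≤-total (f false) (f true)
... | inj₁ f≤t = false , ℚₚ.≤-trans (ℚₚ.≤-reflexive (a≡½[a+a] (f false)))
                          (ℚₚ.*-monoˡ-≤-nonNeg ½ (ℚₚ.+-monoʳ-≤ (f false) f≤t))
... | inj₂ t≤f = true , ℚₚ.≤-trans (ℚₚ.≤-reflexive (a≡½[a+a] (f true)))
                          (ℚₚ.*-monoˡ-≤-nonNeg ½ (ℚₚ.+-monoˡ-≤ (f true) t≤f))
𝔼-attained (u ⊗ v) f =
  let (x , fx) = 𝔼-attained u (λ x → 𝔼 v λ y → f (x , y))
      (y , fy) = 𝔼-attained v (λ y → f (x , y))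
  in (x , y) , ℚₚ.≤-trans fy fx
𝔼-attained (vec u zero) f = [] , ℚₚ.≤-refl
𝔼-attained (vec u (suc n)) f =
  let (x , fx) = 𝔼-attained u (λ x → 𝔼 (vec u n) λ xs → f (x ∷ xs))
      (xs , fxs) = 𝔼-attained (vec u n) (λ xs → f (x ∷ xs))
  in (x ∷ xs) , ℚₚ.≤-trans fxs fx

p2 : ℕ → ℚ
p2 zero    = 1ℚ
p2 (suc n) = p2 n +ℚ p2 n

½^ : ℕ → ℚ
½^ zero    = 1ℚ
½^ (suc n) = ½ *ℚ ½^ n

p2-+ : ∀ m n → p2 (m + n) ≡ p2 m *ℚ p2 n
p2-+ zero    n = sym (ℚₚ.*-identityˡ (p2 n))
p2-+ (suc m) n = trans (cong₂ _+ℚ_ (p2-+ m n) (p2-+ m n)) (sym (ℚₚ.*-distribʳ-+ (p2 n) (p2 m) (p2 m)))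

1≤p2 : ∀ n → 1ℚ ≤ℚ p2 n
0≤p2 : ∀ n → 0ℚ ≤ℚ p2 n
1≤p2 zero    = ℚₚ.≤-refl
1≤p2 (suc n) = ℚₚ.+-mono-≤ {1ℚ} {p2 n} {0ℚ} {p2 n} (1≤p2 n) (0≤p2 n)
0≤p2 n = ℚₚ.≤-trans (ℚₚ.nonNegative⁻¹ 1ℚ) (1≤p2 n)

p2-½^ : ∀ n → p2 n *ℚ ½^ n ≡ 1ℚ
p2-½^ zero    = refl
p2-½^ (suc n) = trans
  (solve 2 (λ a b → (a :+ a) :* (con ½ :* b) := a :* b) refl (p2 n) (½^ n)) (p2-½^ n)

½^-+ : ∀ m n → ½^ (m + n) ≡ ½^ m *ℚ ½^ n
½^-+ zero    n = sym (ℚₚ.*-identityˡ (½^ n))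
½^-+ (suc m) n = trans (cong (½ *ℚ_) (½^-+ m n)) (sym (ℚₚ.*-assoc ½ (½^ m) (½^ n)))

0≤½^ : ∀ n → 0ℚ ≤ℚ ½^ n
0≤½^ zero    = ℚₚ.nonNegative⁻¹ 1ℚ
0≤½^ (suc n) = ℚₚ.≤-trans (ℚₚ.≤-reflexive (sym (ℚₚ.*-zeroʳ ½))) (ℚₚ.*-monoˡ-≤-nonNeg ½ (0≤½^ n))

½^≤1 : ∀ n → ½^ n ≤ℚ 1ℚ
½^≤1 zero    = ℚₚ.≤-refl
½^≤1 (suc n) = ℚₚ.≤-trans (ℚₚ.*-monoˡ-≤-nonNeg ½ (½^≤1 n)) (toWitness {a? = (½ *ℚ 1ℚ) ℚₚ.≤? 1ℚ} _)

*-mono-≤ℚ : ∀ {a b c d} → 0ℚ ≤ℚ a → 0ℚ ≤ℚ d → a ≤ℚ b → c ≤ℚ d → a *ℚ c ≤ℚ b *ℚ d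
*-mono-≤ℚ {a} {b} {c} {d} 0≤a 0≤d a≤b c≤d =
  ℚₚ.≤-trans (ℚₚ.*-monoˡ-≤-nonNeg a {{nonNegative 0≤a}} c≤d) (ℚₚ.*-monoʳ-≤-nonNeg d {{nonNegative 0≤d}} a≤b)

0≤* : ∀ {a b} → 0ℚ ≤ℚ a → 0ℚ ≤ℚ b → 0ℚ ≤ℚ a *ℚ b
0≤* {a} {b} 0≤a 0≤b =
  ℚₚ.≤-trans (ℚₚ.≤-reflexive (sym (ℚₚ.*-zeroʳ a))) (ℚₚ.*-monoˡ-≤-nonNeg a {{nonNegative 0≤a}} 0≤b)

-- A point has mass 2^-bits.
point≤𝔼 : ∀ u (f : El u → ℚ) → (∀ x → 0ℚ ≤ℚ f x) → ∀ x → f x ≤ℚ p2 (bits u) *ℚ 𝔼 u f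
point≤𝔼-pair : ∀ u v (f : El u → El v → ℚ) → (∀ x y → 0ℚ ≤ℚ f x y) →
               ∀ x y → f x y ≤ℚ p2 (bits u + bits v) *ℚ 𝔼 u λ x → 𝔼 v λ y → f x y
point≤𝔼-pair u v f f≥0 x y = begin
  f x y ≤⟨ point≤𝔼 v (f x) (f≥0 x) y ⟩
  p2 (bits v) *ℚ 𝔼 v (f x)
    ≤⟨ ℚₚ.*-monoˡ-≤-nonNeg (p2 (bits v)) {{nonNegative (0≤p2 (bits v))}}
         (point≤𝔼 u (λ x → 𝔼 v (f x)) (λ x → 𝔼-bounded-below v (f≥0 x)) x) ⟩
  p2 (bits v) *ℚ (p2 (bits u) *ℚ e)
    ≡⟨ solve 3 (λ a b c → a :* (b :* c) := (b :* a) :* c) refl (p2 (bits v)) (p2 (bits u)) e ⟩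
  (p2 (bits u) *ℚ p2 (bits v)) *ℚ e
    ≡⟨ cong (_*ℚ e) (sym (p2-+ (bits u) (bits v))) ⟩
  p2 (bits u + bits v) *ℚ e ∎
  where
  open ℚₚ.≤-Reasoning
  e = 𝔼 u λ x → 𝔼 v λ y → f x y
point≤𝔼 bit f f≥0 false = begin
  f false            ≤⟨ ℚₚ.≤-trans (ℚₚ.≤-reflexive (sym (ℚₚ.+-identityʳ (f false)))) (ℚₚ.+-monoʳ-≤ (f false) (f≥0 true)) ⟩
  f false +ℚ f true  ≡⟨ solve 2 (λ a b → a :+ b := con (p2 1) :* (con ½ :* (a :+ b))) refl (f false) (f true) ⟩
  p2 1 *ℚ 𝔼 bit f    ∎
  where open ℚₚ.≤-Reasoning
point≤𝔼 bit f f≥0 true = begin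
  f true             ≤⟨ ℚₚ.≤-trans (ℚₚ.≤-reflexive (sym (ℚₚ.+-identityˡ (f true)))) (ℚₚ.+-monoˡ-≤ (f true) (f≥0 false)) ⟩
  f false +ℚ f true  ≡⟨ solve 2 (λ a b → a :+ b := con (p2 1) :* (con ½ :* (a :+ b))) refl (f false) (f true) ⟩
  p2 1 *ℚ 𝔼 bit f    ∎
  where open ℚₚ.≤-Reasoning
point≤𝔼 (u ⊗ v) f f≥0 (x , y) = point≤𝔼-pair u v (λ x y → f (x , y)) (λ x y → f≥0 (x , y)) x y
point≤𝔼 (vec u zero) f f≥0 [] = ℚₚ.≤-reflexive (sym (ℚₚ.*-identityˡ (f [])))
point≤𝔼 (vec u (suc n)) f f≥0 (x ∷ xs) =
  point≤𝔼-pair u (vec u n) (λ x y → f (x ∷ y)) (λ x y → f≥0 (x ∷ y)) x xs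

-- Flat seeds and translations

split : ∀ {A : Set} m {n} → Vec A (m + n) → Vec A m × Vec A n
split zero    xs       = [] , xs
split (suc m) (x ∷ xs) = x ∷ proj₁ (split m xs) , proj₂ (split m xs)

𝔼-split : ∀ m n (f : Vec Bool m → Vec Bool n → ℚ) →
          𝔼 (vec bit (m + n)) (λ z → f (proj₁ (split m z)) (proj₂ (split m z))) ≡
          𝔼 (vec bit m) λ x → 𝔼 (vec bit n) λ y → f x y
𝔼-split zero    n f = refl
𝔼-split (suc m) n f = 𝔼-cong bit λ b → 𝔼-split m n (λ x → f (b ∷ x))

decode : ∀ u → Vec Bool (bits u) → El u
decode bit             (b ∷ [])  = b
decode (u ⊗ v)         z         = decode u (proj₁ (split (bits u) z)) , decode v (proj₂ (split (bits u) z))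
decode (vec u zero)    z         = []
decode (vec u (suc n)) z         = decode u (proj₁ (split (bits u) z)) ∷ decode (vec u n) (proj₂ (split (bits u) z))

𝔼-decode : ∀ u (f : El u → ℚ) → 𝔼 (vec bit (bits u)) (f ∘ decode u) ≡ 𝔼 u f
𝔼-decode bit f = refl
𝔼-decode (u ⊗ v) f =
  trans (𝔼-split (bits u) (bits v) (λ x y → f (decode u x , decode v y)))
  (trans (𝔼-cong (vec bit (bits u)) λ x → 𝔼-decode v (λ y → f (decode u x , y)))
         (𝔼-decode u (λ x → 𝔼 v λ y → f (x , y))))
𝔼-decode (vec u zero) f = refl
𝔼-decode (vec u (suc n)) f =
  trans (𝔼-split (bits u) (n * bits u) (λ x y → f (decode u x ∷ decode (vec u n) y)))
  (trans (𝔼-cong (vec bit (bits u)) λ x → 𝔼-decode (vec u n) (λ y → f (decode u x ∷ y)))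
         (𝔼-decode u (λ x → 𝔼 (vec u n) λ y → f (x ∷ y))))

infixl 6 _⊞_
_⊞_ : ∀ {u} → El u → El u → El u
_⊞_ {bit}           x y                 = x xor y
_⊞_ {u ⊗ v}         (x , x′) (y , y′)   = _⊞_ {u} x y , _⊞_ {v} x′ y′
_⊞_ {vec u n}       []       []         = []
_⊞_ {vec u (suc n)} (x ∷ xs) (y ∷ ys)   = _⊞_ {u} x y ∷ _⊞_ {vec u n} xs ys

𝔼-shift : ∀ u a (f : El u → ℚ) → 𝔼 u (λ x → f (_⊞_ {u} x a)) ≡ 𝔼 u f
𝔼-shift bit false f = refl
𝔼-shift bit true f = cong (½ *ℚ_) (ℚₚ.+-comm (f true) (f false))
𝔼-shift (u ⊗ v) (a , b) f =
  trans (𝔼-cong u λ x → 𝔼-shift v b (λ y → f (_⊞_ {u} x a , y))) (𝔼-shift u a (λ x → 𝔼 v λ y → f (x , y)))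
𝔼-shift (vec u zero) [] f = refl
𝔼-shift (vec u (suc n)) (a ∷ as) f =
  trans (𝔼-cong u λ x → 𝔼-shift (vec u n) as (λ y → f (_⊞_ {u} x a ∷ y)))
        (𝔼-shift u a (λ x → 𝔼 (vec u n) λ y → f (x ∷ y)))

⊞-0 : ∀ u → El u
⊞-0 bit             = false
⊞-0 (u ⊗ v)         = ⊞-0 u , ⊞-0 v
⊞-0 (vec u zero)    = []
⊞-0 (vec u (suc n)) = ⊞-0 u ∷ ⊞-0 (vec u n)

⊞-identityˡ : ∀ u x → _⊞_ {u} (⊞-0 u) x ≡ x
⊞-identityˡ bit             x        = refl
⊞-identityˡ (u ⊗ v)         (x , y)  = cong₂ _,_ (⊞-identityˡ u x) (⊞-identityˡ v y)
⊞-identityˡ (vec u zero)    []       = refl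
⊞-identityˡ (vec u (suc n)) (x ∷ xs) = cong₂ _∷_ (⊞-identityˡ u x) (⊞-identityˡ (vec u n) xs)

⊞-assoc : ∀ u x y z → _⊞_ {u} (_⊞_ {u} x y) z ≡ _⊞_ {u} x (_⊞_ {u} y z)
⊞-assoc bit x y z = 𝔹ₚ.xor-assoc x y z
⊞-assoc (u ⊗ v) (x , x′) (y , y′) (z , z′) = cong₂ _,_ (⊞-assoc u x y z) (⊞-assoc v x′ y′ z′)
⊞-assoc (vec u zero) [] [] [] = refl
⊞-assoc (vec u (suc n)) (x ∷ xs) (y ∷ ys) (z ∷ zs) = cong₂ _∷_ (⊞-assoc u x y z) (⊞-assoc (vec u n) xs ys zs)

-- An array of 2^b entries as a binary tree, so that access, and the circuit for it, recurse on the
-- bits of the index.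
table : U → ℕ → U
table u zero    = u
table u (suc b) = table u b ⊗ table u b

get : ∀ u {b} → El (table u b) → Vec Bool b → El u
get u t       []          = t
get u (l , r) (false ∷ i) = get u l i
get u (l , r) (true  ∷ i) = get u r i

set : ∀ u {b} → El (table u b) → Vec Bool b → El u → El (table u b)
set u t       []          y = y
set u (l , r) (false ∷ i) y = set u l i y , r
set u (l , r) (true  ∷ i) y = l , set u r i y

get-set : ∀ u {b} (t : El (table u b)) (i : Vec Bool b) y → get u (set u t i y) i ≡ y
get-set u t       []          y = refl
get-set u (l , r) (false ∷ i) y = get-set u l i y
get-set u (l , r) (true  ∷ i) y = get-set u r i y

get-set-≢ : ∀ u {b} (t : El (table u b)) {i j : Vec Bool b} y → i ≢ j → get u (set u t i y) j ≡ get u t j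
get-set-≢ u t       {[]}        {[]}        y i≢j = ⊥-elim (i≢j refl)
get-set-≢ u (l , r) {false ∷ i} {false ∷ j} y i≢j = get-set-≢ u l y (i≢j ∘ cong (false ∷_))
get-set-≢ u (l , r) {true  ∷ i} {true  ∷ j} y i≢j = get-set-≢ u r y (i≢j ∘ cong (true ∷_))
get-set-≢ u (l , r) {false ∷ i} {true  ∷ j} y i≢j = refl
get-set-≢ u (l , r) {true  ∷ i} {false ∷ j} y i≢j = refl

-- Splits off one entry as an independent variable while the rest of the table stays fixed; the
-- hybrid argument replaces one bucket at a time by this.
𝔼-resample : ∀ u {b} (i : Vec Bool b) (f : El (table u b) → ℚ) →
             𝔼 (table u b) f ≡ 𝔼 (table u b) λ t → 𝔼 u λ y → f (set u t i y)
𝔼-resample u []          f = sym (𝔼-const u (𝔼 u f))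
𝔼-resample u {suc b} (false ∷ i) f =
  trans (𝔼-resample u i (λ l → 𝔼 (table u b) λ r → f (l , r)))
        (𝔼-cong (table u b) λ l → 𝔼-swap u (table u b) (λ y r → f (set u l i y , r)))
𝔼-resample u {suc b} (true ∷ i) f =
  𝔼-cong (table u b) λ l → 𝔼-resample u i (λ r → f (l , r))

𝔼-resample-vec : ∀ u {n} (k : Fin n) (f : Vec (El u) n → ℚ) →
                 𝔼 (vec u n) f ≡ 𝔼 (vec u n) λ t → 𝔼 u λ y → f (t [ k ]≔ y)
𝔼-resample-vec u {suc n} zero f = sym (trans
  (𝔼-cong u λ x → 𝔼-swap (vec u n) u (λ xs y → f (y ∷ xs)))
  (𝔼-const u (𝔼 u λ y → 𝔼 (vec u n) λ xs → f (y ∷ xs))))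
𝔼-resample-vec u (suc k) f = 𝔼-cong u λ x → 𝔼-resample-vec u k (λ xs → f (x ∷ xs))

-- Two one-sided inequalities instead of an absolute value, as each passes through expectations by
-- monotonicity.
Close : ℚ → ℚ → ℚ → Set
Close ε a b = a ≤ℚ b +ℚ ε × b ≤ℚ a +ℚ ε

Close-refl : ∀ {ε a} → 0ℚ ≤ℚ ε → Close ε a a
Close-refl {ε} {a} ε≥0 = h , h
  where
  h : a ≤ℚ a +ℚ ε
  h = ℚₚ.≤-trans (ℚₚ.≤-reflexive (sym (ℚₚ.+-identityʳ a))) (ℚₚ.+-monoʳ-≤ a ε≥0)

Close-trans : ∀ {ε δ a b c} → Close ε a b → Close δ b c → Close (ε +ℚ δ) a c
Close-trans {ε} {δ} {a} {b} {c} (p , q) (r , s) =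
  ℚₚ.≤-trans p (ℚₚ.≤-trans (ℚₚ.+-monoˡ-≤ ε r) (ℚₚ.≤-reflexive
    (solve 3 (λ c δ ε → (c :+ δ) :+ ε := c :+ (ε :+ δ)) refl c δ ε))) ,
  ℚₚ.≤-trans s (ℚₚ.≤-trans (ℚₚ.+-monoˡ-≤ δ q) (ℚₚ.≤-reflexive (ℚₚ.+-assoc a ε δ)))

Close-mono : ∀ {ε δ a b} → ε ≤ℚ δ → Close ε a b → Close δ a b
Close-mono {a = a} {b} ε≤δ (p , q) =
  ℚₚ.≤-trans p (ℚₚ.+-monoʳ-≤ b ε≤δ) , ℚₚ.≤-trans q (ℚₚ.+-monoʳ-≤ a ε≤δ)

-- The error may vary with the sample point: the choice of hash functions brings an error that is
-- small only on average.
Close-𝔼 : ∀ u {δ f g : El u → ℚ} → (∀ x → Close (δ x) (f x) (g x)) → Close (𝔼 u δ) (𝔼 u f) (𝔼 u g)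
Close-𝔼 u {δ} {f} {g} h =
  ℚₚ.≤-trans (𝔼-mono u (proj₁ ∘ h)) (ℚₚ.≤-reflexive (𝔼-+ u g δ)) ,
  ℚₚ.≤-trans (𝔼-mono u (proj₂ ∘ h)) (ℚₚ.≤-reflexive (𝔼-+ u f δ))

Close-𝔼-const : ∀ u {ε} {f g : El u → ℚ} → (∀ x → Close ε (f x) (g x)) → Close ε (𝔼 u f) (𝔼 u g)
Close-𝔼-const u {ε} {f} {g} h = subst (λ δ → Close δ (𝔼 u f) (𝔼 u g)) (𝔼-const u ε) (Close-𝔼 u h)

Close-resp : ∀ {ε a a′ b b′} → a ≡ a′ → b ≡ b′ → Close ε a b → Close ε a′ b′
Close-resp refl refl c = c

ind : Bool → ℚ
ind true  = 1ℚ
ind false = 0ℚ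

0≤ind : ∀ b → 0ℚ ≤ℚ ind b
0≤ind true  = ℚₚ.nonNegative⁻¹ 1ℚ
0≤ind false = ℚₚ.≤-refl

ind≤1 : ∀ b → ind b ≤ℚ 1ℚ
ind≤1 true  = ℚₚ.≤-refl
ind≤1 false = ℚₚ.nonNegative⁻¹ 1ℚ

-- Sampling

0≤x*x : ∀ x → 0ℚ ≤ℚ x *ℚ x
0≤x*x x with ℚₚ.≤-total 0ℚ x
... | inj₁ 0≤x = 0≤* 0≤x 0≤x
... | inj₂ x≤0 = subst (0ℚ ≤ℚ_) (solve 1 (λ x → :- x :* :- x := x :* x) refl x) (0≤* 0≤-x 0≤-x)
  where
  0≤-x : 0ℚ ≤ℚ -ℚ x
  0≤-x = ℚₚ.neg-antimono-≤ x≤0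

0≤b-a⇒a≤b : ∀ {a b} → 0ℚ ≤ℚ b -ℚ a → a ≤ℚ b
0≤b-a⇒a≤b {a} {b} h = begin
  a               ≡⟨ ℚₚ.+-identityʳ a ⟨
  a +ℚ 0ℚ         ≤⟨ ℚₚ.+-monoʳ-≤ a h ⟩
  a +ℚ (b -ℚ a)   ≡⟨ solve 2 (λ a b → a :+ (b :- a) := b) refl a b ⟩
  b               ∎
  where open ℚₚ.≤-Reasoning

a≤b⇒0≤b-a : ∀ {a b} → a ≤ℚ b → 0ℚ ≤ℚ b -ℚ a
a≤b⇒0≤b-a {a} {b} h = subst (_≤ℚ b -ℚ a) (ℚₚ.+-inverseʳ a) (ℚₚ.+-monoˡ-≤ (-ℚ a) h)

-- The power x^(2^b), in the form that fits a table of depth b.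
squarings : ℕ → ℚ → ℚ
squarings zero    x = x
squarings (suc b) x = squarings b (x *ℚ x)

squarings-* : ∀ b x y → squarings b (x *ℚ y) ≡ squarings b x *ℚ squarings b y
squarings-* zero    x y = refl
squarings-* (suc b) x y = trans
  (cong (squarings b) (solve 2 (λ x y → (x :* y) :* (x :* y) := (x :* x) :* (y :* y)) refl x y))
  (squarings-* b (x *ℚ x) (y *ℚ y))

squarings-mono : ∀ b {x y} → 0ℚ ≤ℚ x → x ≤ℚ y → squarings b x ≤ℚ squarings b y
squarings-mono zero    0≤x x≤y = x≤y
squarings-mono (suc b) 0≤x x≤y =
  squarings-mono b (0≤* 0≤x 0≤x) (*-mono-≤ℚ 0≤x (ℚₚ.≤-trans 0≤x x≤y) x≤y x≤y)

squarings-½ : ∀ b k → squarings b (½^ k) ≡ ½^ (2 ^ b * k)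
squarings-½ zero    k = cong ½^ (sym (ℕₚ.*-identityˡ k))
squarings-½ (suc b) k = trans (cong (squarings b) (sym (½^-+ k k))) (trans (squarings-½ b (k + k)) (cong ½^ eq))
  where
  open ≡-Reasoning
  eq : 2 ^ b * (k + k) ≡ 2 ^ suc b * k
  eq = begin
    2 ^ b * (k + k)   ≡⟨ cong (λ j → 2 ^ b * (k + j)) (sym (ℕₚ.+-identityʳ k)) ⟩
    2 ^ b * (2 * k)   ≡⟨ sym (ℕₚ.*-assoc (2 ^ b) 2 k) ⟩
    (2 ^ b * 2) * k   ≡⟨ cong (_* k) (ℕₚ.*-comm (2 ^ b) 2) ⟩
    2 ^ suc b * k     ∎

leafProduct : ∀ u b → (El u → ℚ) → El (table u b) → ℚ
leafProduct u zero    g t       = g t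
leafProduct u (suc b) g (l , r) = leafProduct u b g l *ℚ leafProduct u b g r

leafProduct-nonneg : ∀ u b {g} → (∀ z → 0ℚ ≤ℚ g z) → ∀ t → 0ℚ ≤ℚ leafProduct u b g t
leafProduct-nonneg u zero    g≥0 t       = g≥0 t
leafProduct-nonneg u (suc b) g≥0 (l , r) = 0≤* (leafProduct-nonneg u b g≥0 l) (leafProduct-nonneg u b g≥0 r)

𝔼-leafProduct : ∀ u b {g} → 𝔼 u g ≡ 1ℚ → 𝔼 (table u b) (leafProduct u b g) ≡ 1ℚ
𝔼-leafProduct u zero    eq = eq
𝔼-leafProduct u (suc b) {g} eq =
  trans (𝔼-product (table u b) (table u b) (leafProduct u b g) (leafProduct u b g))
        (cong₂ _*ℚ_ (𝔼-leafProduct u b eq) (𝔼-leafProduct u b eq))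

leafProduct-inverse : ∀ u b {g h} → (∀ z → 0ℚ ≤ℚ g z) → (∀ z → 0ℚ ≤ℚ h z) → (∀ z → 1ℚ ≤ℚ g z *ℚ h z) →
                      ∀ t → 1ℚ ≤ℚ leafProduct u b g t *ℚ leafProduct u b h t
leafProduct-inverse u zero    g≥0 h≥0 gh t = gh t
leafProduct-inverse u (suc b) {g} {h} g≥0 h≥0 gh (l , r) = begin
  1ℚ *ℚ 1ℚ ≤⟨ *-mono-≤ℚ (ℚₚ.nonNegative⁻¹ 1ℚ) (0≤* (leafProduct-nonneg u b g≥0 r) (leafProduct-nonneg u b h≥0 r))
                (leafProduct-inverse u b g≥0 h≥0 gh l) (leafProduct-inverse u b g≥0 h≥0 gh r) ⟩
  (leafProduct u b g l *ℚ leafProduct u b h l) *ℚ (leafProduct u b g r *ℚ leafProduct u b h r)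
    ≡⟨ solve 4 (λ a b c d → (a :* b) :* (c :* d) := (a :* c) :* (b :* d)) refl
         (leafProduct u b g l) (leafProduct u b h l) (leafProduct u b g r) (leafProduct u b h r) ⟩
  leafProduct u (suc b) g (l , r) *ℚ leafProduct u (suc b) h (l , r) ∎
  where open ℚₚ.≤-Reasoning

-- AM-GM for 2^b factors by Cauchy's doubling: the halves have means m and m′, and m · m′ is at most
-- the square of their average, the gap being the square of (m - m′)/2.
am-gm : ∀ u b {g} → (∀ z → 0ℚ ≤ℚ g z) → ∀ t →
        leafProduct u b g t ≤ℚ squarings b (𝔼 (vec bit b) λ i → g (get u t i))
am-gm u zero    g≥0 t = ℚₚ.≤-refl
am-gm u (suc b) {g} g≥0 (l , r) = begin
  leafProduct u b g l *ℚ leafProduct u b g r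
    ≤⟨ *-mono-≤ℚ (leafProduct-nonneg u b g≥0 l)
         (ℚₚ.≤-trans (leafProduct-nonneg u b g≥0 r) (am-gm u b g≥0 r)) (am-gm u b g≥0 l) (am-gm u b g≥0 r) ⟩
  squarings b m *ℚ squarings b m′
    ≡⟨ squarings-* b m m′ ⟨
  squarings b (m *ℚ m′)
    ≤⟨ squarings-mono b (0≤* (mean≥0 l) (mean≥0 r)) (0≤b-a⇒a≤b (subst (0ℚ ≤ℚ_) square-gap (0≤x*x (½ *ℚ (m -ℚ m′))))) ⟩
  squarings b ((½ *ℚ (m +ℚ m′)) *ℚ (½ *ℚ (m +ℚ m′))) ∎
  where
  open ℚₚ.≤-Reasoning
  mean : El (table u b) → ℚ
  mean t = 𝔼 (vec bit b) λ i → g (get u t i)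
  m  = mean l
  m′ = mean r
  mean≥0 : ∀ t → 0ℚ ≤ℚ mean t
  mean≥0 t = 𝔼-bounded-below (vec bit b) λ i → g≥0 (get u t i)
  square-gap : (½ *ℚ (m -ℚ m′)) *ℚ (½ *ℚ (m -ℚ m′)) ≡ (½ *ℚ (m +ℚ m′)) *ℚ (½ *ℚ (m +ℚ m′)) -ℚ m *ℚ m′
  square-gap = solve 2 (λ m m′ → (con ½ :* (m :- m′)) :* (con ½ :* (m :- m′)) :=
                                 (con ½ :* (m :+ m′)) :* (con ½ :* (m :+ m′)) :- m :* m′) refl m m′

-- On [-1, 1] the product of 1 + x/4 and 13/12 - x/4 exceeds 1 by (1 + x)(4 - 3x)/48, which is
-- nonnegative. At x = ½ the second factor is 23/24, below 1: a mean above ½ becomes an exponential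
-- gain.
¼ 1/12 23/24 : ℚ
¼     = + 1 / 4
1/12  = + 1 / 12
23/24 = + 23 / 24

Bounded : ∀ u → (El u → ℚ) → Set
Bounded u χ = ∀ z → -ℚ 1ℚ ≤ℚ χ z × χ z ≤ℚ 1ℚ

module _ (x : ℚ) (-1≤x : -ℚ 1ℚ ≤ℚ x) (x≤1 : x ≤ℚ 1ℚ) where
  private
    0≤1+x : 0ℚ ≤ℚ 1ℚ +ℚ x
    0≤1+x = subst (_≤ℚ 1ℚ +ℚ x) (ℚₚ.+-inverseʳ 1ℚ) (ℚₚ.+-monoʳ-≤ 1ℚ -1≤x)

    0≤1-x : 0ℚ ≤ℚ 1ℚ -ℚ x
    0≤1-x = a≤b⇒0≤b-a x≤1

    scaled : ∀ c d {a} → 0ℚ ≤ℚ c → 0ℚ ≤ℚ d → 0ℚ ≤ℚ a → 0ℚ ≤ℚ d +ℚ c *ℚ a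
    scaled c d 0≤c 0≤d 0≤a = ℚₚ.+-mono-≤ {0ℚ} {d} {0ℚ} 0≤d (0≤* 0≤c 0≤a)

  0≤1+¼x : 0ℚ ≤ℚ 1ℚ +ℚ ¼ *ℚ x
  0≤1+¼x = subst (0ℚ ≤ℚ_) (solve 1 (λ x → con (+ 3 / 4) :+ con ¼ :* (con 1ℚ :+ x) := con 1ℚ :+ con ¼ :* x) refl x)
    (scaled ¼ (+ 3 / 4) (ℚₚ.nonNegative⁻¹ ¼) (ℚₚ.nonNegative⁻¹ (+ 3 / 4)) 0≤1+x)

  0≤13/12-¼x : 0ℚ ≤ℚ (1ℚ +ℚ 1/12) -ℚ ¼ *ℚ x
  0≤13/12-¼x = subst (0ℚ ≤ℚ_)
    (solve 1 (λ x → con (+ 10 / 12) :+ con ¼ :* (con 1ℚ :- x) := (con 1ℚ :+ con 1/12) :- con ¼ :* x) refl x)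
    (scaled ¼ (+ 10 / 12) (ℚₚ.nonNegative⁻¹ ¼) (ℚₚ.nonNegative⁻¹ (+ 10 / 12)) 0≤1-x)

  1≤[1+¼x][13/12-¼x] : 1ℚ ≤ℚ (1ℚ +ℚ ¼ *ℚ x) *ℚ ((1ℚ +ℚ 1/12) -ℚ ¼ *ℚ x)
  1≤[1+¼x][13/12-¼x] = 0≤b-a⇒a≤b (subst (0ℚ ≤ℚ_)
    (solve 1 (λ x → con (+ 1 / 48) :* ((con 1ℚ :+ x) :* (con 1ℚ :+ con (+ 3 / 1) :* (con 1ℚ :- x))) :=
                    (con 1ℚ :+ con ¼ :* x) :* ((con 1ℚ :+ con 1/12) :- con ¼ :* x) :- con 1ℚ) refl x)
    (0≤* (ℚₚ.nonNegative⁻¹ (+ 1 / 48)) (0≤* 0≤1+x (scaled (+ 3 / 1) 1ℚ (ℚₚ.nonNegative⁻¹ (+ 3 / 1)) (ℚₚ.nonNegative⁻¹ 1ℚ) 0≤1-x))))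

-- (23/24)^32 is below ½ whereas (23/24)^16 is not; hence the 5 in the depth 5 + β of the tables.
squarings-23/24 : ∀ β → squarings (5 + β) 23/24 ≤ℚ ½^ (2 ^ β)
squarings-23/24 β = ℚₚ.≤-trans
  (squarings-mono β (toWitness {a? = 0ℚ ℚₚ.≤? squarings 5 23/24} _) (toWitness {a? = squarings 5 23/24 ℚₚ.≤? ½^ 1} _))
  (ℚₚ.≤-reflexive (trans (squarings-½ β 1) (cong ½^ (ℕₚ.*-identityʳ (2 ^ β)))))

p2-½^-small : ∀ {n m} → suc n ≤ m → ¬ 1ℚ ≤ℚ p2 n *ℚ ½^ m
p2-½^-small {n} {m} n<m 1≤ with ℕₚ.m≤n⇒∃[o]m+o≡n n<m
... | k , refl = ℚₚ.<-irrefl refl (ℚₚ.<-≤-trans (toWitness {a? = ½ ℚₚ.<? 1ℚ} _) (ℚₚ.≤-trans 1≤ bound))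
  where
  open ℚₚ.≤-Reasoning
  bound : p2 n *ℚ ½^ (suc n + k) ≤ℚ ½
  bound = begin
    p2 n *ℚ (½ *ℚ ½^ (n + k))        ≡⟨ cong (λ z → p2 n *ℚ (½ *ℚ z)) (½^-+ n k) ⟩
    p2 n *ℚ (½ *ℚ (½^ n *ℚ ½^ k))
      ≡⟨ solve 3 (λ a b c → a :* (con ½ :* (b :* c)) := (a :* b) :* (con ½ :* c)) refl (p2 n) (½^ n) (½^ k) ⟩
    (p2 n *ℚ ½^ n) *ℚ (½ *ℚ ½^ k)    ≡⟨ cong (_*ℚ (½ *ℚ ½^ k)) (p2-½^ n) ⟩
    1ℚ *ℚ (½ *ℚ ½^ k)                ≡⟨ ℚₚ.*-identityˡ _ ⟩
    ½ *ℚ ½^ k                        ≤⟨ ℚₚ.*-monoˡ-≤-nonNeg ½ (½^≤1 k) ⟩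
    ½ *ℚ 1ℚ                          ∎

-- If the average exceeded ½, AM-GM applied to 13/12 - ¼ χ, which inverts 1 + ¼ χ up to a factor
-- at least 1, would make the product of the 1 + ¼ χ exponentially large.
average≤½ : ∀ Z β n {χ : El Z → ℚ} → Bounded Z χ → n + 2 ≤ 2 ^ β → (t : El (table Z (5 + β))) →
            leafProduct Z (5 + β) (λ z → 1ℚ +ℚ ¼ *ℚ χ z) t ≤ℚ p2 (suc n) →
            (𝔼 (vec bit (5 + β)) λ i → χ (get Z t i)) ≤ℚ ½
average≤½ Z β n {χ} χ-bd n≤ t prod≤ with (𝔼 (vec bit (5 + β)) λ i → χ (get Z t i)) ℚₚ.≤? ½
... | yes p = p
-- `big` bounds 1 by 2^(n+1) · 2^-(2^β), which is at most ½ because n + 2 ≤ 2^β.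
... | no ¬p = ⊥-elim (p2-½^-small {suc n} {2 ^ β} (subst (_≤ 2 ^ β) (ℕₚ.+-comm n 2) n≤) big)
  where
  open ℚₚ.≤-Reasoning
  b = 5 + β
  g h : El Z → ℚ
  g z = 1ℚ +ℚ ¼ *ℚ χ z
  h z = (1ℚ +ℚ 1/12) -ℚ ¼ *ℚ χ z
  g≥0 : ∀ z → 0ℚ ≤ℚ g z
  g≥0 z = 0≤1+¼x (χ z) (proj₁ (χ-bd z)) (proj₂ (χ-bd z))
  h≥0 : ∀ z → 0ℚ ≤ℚ h z
  h≥0 z = 0≤13/12-¼x (χ z) (proj₁ (χ-bd z)) (proj₂ (χ-bd z))
  avg = 𝔼 (vec bit b) λ i → χ (get Z t i)
  mean-h : (𝔼 (vec bit b) λ i → h (get Z t i)) ≤ℚ 23/24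
  mean-h = begin
    (𝔼 (vec bit b) λ i → h (get Z t i))
      ≡⟨ 𝔼-+ (vec bit b) (λ _ → 1ℚ +ℚ 1/12) (λ i → -ℚ (¼ *ℚ χ (get Z t i))) ⟩
    𝔼 (vec bit b) (λ _ → 1ℚ +ℚ 1/12) +ℚ 𝔼 (vec bit b) (λ i → -ℚ (¼ *ℚ χ (get Z t i)))
      ≡⟨ cong₂ _+ℚ_ (𝔼-const (vec bit b) (1ℚ +ℚ 1/12))
           (trans (𝔼-neg (vec bit b) (λ i → ¼ *ℚ χ (get Z t i)))
                  (cong -ℚ_ (𝔼-* (vec bit b) ¼ (λ i → χ (get Z t i))))) ⟩
    (1ℚ +ℚ 1/12) -ℚ ¼ *ℚ avg
      ≤⟨ ℚₚ.+-monoʳ-≤ (1ℚ +ℚ 1/12)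
           (ℚₚ.neg-antimono-≤ (ℚₚ.*-monoˡ-≤-nonNeg ¼ (ℚₚ.<⇒≤ (ℚₚ.≰⇒> ¬p)))) ⟩
    (1ℚ +ℚ 1/12) -ℚ ¼ *ℚ ½ ≡⟨⟩
    23/24 ∎
  big : 1ℚ ≤ℚ p2 (suc n) *ℚ ½^ (2 ^ β)
  big = begin
    1ℚ ≤⟨ leafProduct-inverse Z b g≥0 h≥0
            (λ z → 1≤[1+¼x][13/12-¼x] (χ z) (proj₁ (χ-bd z)) (proj₂ (χ-bd z))) t ⟩
    leafProduct Z b g t *ℚ leafProduct Z b h t
      ≤⟨ *-mono-≤ℚ (leafProduct-nonneg Z b g≥0 t) (0≤½^ (2 ^ β)) prod≤
           (ℚₚ.≤-trans (am-gm Z b h≥0 t)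
           (ℚₚ.≤-trans (squarings-mono b (𝔼-bounded-below (vec bit b) (λ i → h≥0 (get Z t i))) mean-h)
                       (squarings-23/24 β))) ⟩
    p2 (suc n) *ℚ ½^ (2 ^ β) ∎

-- Derandomised Chernoff bound: the potential 𝔼ₐ [Π (1 + ¼ χₐ) + Π (1 - ¼ χₐ)] has mean 2 over random tables.
sample : ∀ A Z β (χ : El A → El Z → ℚ) → (∀ a → Bounded Z (χ a)) → (∀ a → 𝔼 Z (χ a) ≡ 0ℚ) →
         bits A + 2 ≤ 2 ^ β →
         Σ (El (table Z (5 + β))) λ t → ∀ a →
           Close ½ (𝔼 (vec bit (5 + β)) λ i → χ a (get Z t i)) 0ℚ
sample A Z β χ χ-bd χ-mean size≤ = t , λ a → upper a , lower a
  where
  b = 5 + β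
  χ⁻ : El A → El Z → ℚ
  χ⁻ a z = -ℚ χ a z
  χ⁻-bd : ∀ a → Bounded Z (χ⁻ a)
  χ⁻-bd a z = ℚₚ.neg-antimono-≤ (proj₂ (χ-bd a z)) , ℚₚ.neg-antimono-≤ (proj₁ (χ-bd a z))
  tilt : (El A → El Z → ℚ) → El A → El Z → ℚ
  tilt ξ a z = 1ℚ +ℚ ¼ *ℚ ξ a z
  weight : (El A → El Z → ℚ) → El A → El (table Z b) → ℚ
  weight ξ a = leafProduct Z b (tilt ξ a)
  weight≥0 : ∀ ξ → (∀ a → Bounded Z (ξ a)) → ∀ a s → 0ℚ ≤ℚ weight ξ a s
  weight≥0 ξ bd a = leafProduct-nonneg Z b λ z → 0≤1+¼x (ξ a z) (proj₁ (bd a z)) (proj₂ (bd a z))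
  mean-weight : ∀ ξ → (∀ a → 𝔼 Z (ξ a) ≡ 0ℚ) → ∀ a → 𝔼 (table Z b) (weight ξ a) ≡ 1ℚ
  mean-weight ξ ξ-mean a = 𝔼-leafProduct Z b (begin
    𝔼 Z (tilt ξ a)                                   ≡⟨ 𝔼-+ Z (λ _ → 1ℚ) (λ z → ¼ *ℚ ξ a z) ⟩
    𝔼 Z (λ _ → 1ℚ) +ℚ 𝔼 Z (λ z → ¼ *ℚ ξ a z)        ≡⟨ cong₂ _+ℚ_ (𝔼-const Z 1ℚ) (𝔼-* Z ¼ (ξ a)) ⟩
    1ℚ +ℚ ¼ *ℚ 𝔼 Z (ξ a)                             ≡⟨ cong (λ e → 1ℚ +ℚ ¼ *ℚ e) (ξ-mean a) ⟩
    1ℚ                                               ∎)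
    where open ≡-Reasoning
  χ⁻-mean : ∀ a → 𝔼 Z (χ⁻ a) ≡ 0ℚ
  χ⁻-mean a = trans (𝔼-neg Z (χ a)) (cong -ℚ_ (χ-mean a))
  pot : El A → El (table Z b) → ℚ
  pot a s = weight χ a s +ℚ weight χ⁻ a s
  pot≥0 : ∀ a s → 0ℚ ≤ℚ pot a s
  pot≥0 a s = ℚₚ.+-mono-≤ {0ℚ} {weight χ a s} {0ℚ} (weight≥0 χ χ-bd a s) (weight≥0 χ⁻ χ⁻-bd a s)
  mean-pot : (𝔼 (table Z b) λ s → 𝔼 A λ a → pot a s) ≡ p2 1
  mean-pot = begin
    (𝔼 (table Z b) λ s → 𝔼 A λ a → pot a s) ≡⟨ 𝔼-swap (table Z b) A (λ s a → pot a s) ⟩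
    (𝔼 A λ a → 𝔼 (table Z b) (pot a))       ≡⟨ 𝔼-cong A (λ a → trans (𝔼-+ (table Z b) (weight χ a) (weight χ⁻ a))
                                                 (cong₂ _+ℚ_ (mean-weight χ χ-mean a) (mean-weight χ⁻ χ⁻-mean a))) ⟩
    (𝔼 A λ a → p2 1)                        ≡⟨ 𝔼-const A (p2 1) ⟩
    p2 1                                    ∎
    where open ≡-Reasoning
  best = 𝔼-attained (table Z b) λ s → 𝔼 A λ a → pot a s
  t = proj₁ best
  -- The union bound over tests: all potentials are nonnegative, so a single test has at most
  -- 2^(bits A) times the mean, which is at most 2.
  pot≤ : ∀ a → pot a t ≤ℚ p2 (suc (bits A))
  pot≤ a = begin
    pot a t                              ≤⟨ point≤𝔼 A (λ a → pot a t) (λ a → pot≥0 a t) a ⟩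
    p2 (bits A) *ℚ 𝔼 A (λ a → pot a t)   ≤⟨ ℚₚ.*-monoˡ-≤-nonNeg (p2 (bits A)) {{nonNegative (0≤p2 (bits A))}}
                                              (ℚₚ.≤-trans (proj₂ best) (ℚₚ.≤-reflexive mean-pot)) ⟩
    p2 (bits A) *ℚ p2 1                  ≡⟨ p2-+ (bits A) 1 ⟨
    p2 (bits A + 1)                      ≡⟨ cong p2 (ℕₚ.+-comm (bits A) 1) ⟩
    p2 (suc (bits A))                    ∎
    where open ℚₚ.≤-Reasoning
  weight≤pot : ∀ a → weight χ a t ≤ℚ pot a t
  weight≤pot a = subst (_≤ℚ pot a t) (ℚₚ.+-identityʳ (weight χ a t)) (ℚₚ.+-monoʳ-≤ (weight χ a t) (weight≥0 χ⁻ χ⁻-bd a t))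
  weight⁻≤pot : ∀ a → weight χ⁻ a t ≤ℚ pot a t
  weight⁻≤pot a = subst (_≤ℚ pot a t) (ℚₚ.+-identityˡ (weight χ⁻ a t)) (ℚₚ.+-monoˡ-≤ (weight χ⁻ a t) (weight≥0 χ χ-bd a t))
  avg : El A → ℚ
  avg a = 𝔼 (vec bit b) λ i → χ a (get Z t i)
  upper : ∀ a → avg a ≤ℚ 0ℚ +ℚ ½
  upper a = average≤½ Z β (bits A) (χ-bd a) size≤ t (ℚₚ.≤-trans (weight≤pot a) (pot≤ a))
  lower : ∀ a → 0ℚ ≤ℚ avg a +ℚ ½
  lower a = subst (_≤ℚ avg a +ℚ ½) (ℚₚ.+-inverseʳ (avg a)) (ℚₚ.+-monoʳ-≤ (avg a)
    (subst (_≤ℚ ½) (𝔼-neg (vec bit b) (λ i → χ a (get Z t i)))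
      (average≤½ Z β (bits A) (χ⁻-bd a) size≤ t (ℚₚ.≤-trans (weight⁻≤pot a) (pot≤ a)))))

⊞-identityʳ : ∀ u x → _⊞_ {u} x (⊞-0 u) ≡ x
⊞-identityʳ bit             x        = 𝔹ₚ.xor-identityʳ x
⊞-identityʳ (u ⊗ v)         (x , y)  = cong₂ _,_ (⊞-identityʳ u x) (⊞-identityʳ v y)
⊞-identityʳ (vec u zero)    []       = refl
⊞-identityʳ (vec u (suc n)) (x ∷ xs) = cong₂ _∷_ (⊞-identityʳ u x) (⊞-identityʳ (vec u n) xs)

combine : ∀ Z {b q} → Vec (El (table Z b)) q → Vec (Vec Bool b) q → El Z
combine Z []       []       = ⊞-0 Z
combine Z (t ∷ ts) (i ∷ is) = _⊞_ {Z} (get Z t i) (combine Z ts is)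

-- Every table halves the error: after translation by all z, the averaged function, doubled, is again bounded by 1.
samples-centred : ∀ A Z β q (ψ : El A → El Z → ℚ) → (∀ a → Bounded Z (ψ a)) → (∀ a → 𝔼 Z (ψ a) ≡ 0ℚ) →
                  bits A + bits Z + 2 ≤ 2 ^ β →
                  Σ (Vec (El (table Z (5 + β))) q) λ ts → ∀ a z →
                    Close (½^ q) (𝔼 (vec (vec bit (5 + β)) q) λ is → ψ a (_⊞_ {Z} (combine Z ts is) z)) 0ℚ
samples-centred A Z β zero ψ ψ-bd ψ-mean size≤ = [] , λ a z →
  subst (λ w → Close 1ℚ (ψ a w) 0ℚ) (sym (⊞-identityˡ Z z))
    (proj₂ (ψ-bd a z) , subst (_≤ℚ ψ a z +ℚ 1ℚ) (ℚₚ.+-inverseˡ 1ℚ) (ℚₚ.+-monoˡ-≤ 1ℚ (proj₁ (ψ-bd a z))))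
samples-centred A Z β (suc q) ψ ψ-bd ψ-mean size≤ = t ∷ proj₁ rest , close
  where
  b = 5 + β
  -- The translation z counts as part of the test, since the entries from the later tables translate
  -- by amounts not yet known. This brings `bits Z` into the size condition.
  step = sample (A ⊗ Z) Z β (λ { (a , z) w → ψ a (_⊞_ {Z} w z) }) (λ { (a , z) w → ψ-bd a (_⊞_ {Z} w z) })
           (λ { (a , z) → trans (𝔼-shift Z z (ψ a)) (ψ-mean a) }) size≤
  t = proj₁ step
  inner : El A → El Z → ℚ
  inner a z = 𝔼 (vec bit b) λ i → ψ a (_⊞_ {Z} (get Z t i) z)
  ψ′ : El A → El Z → ℚ
  ψ′ a z = p2 1 *ℚ inner a z
  ψ′-bd : ∀ a → Bounded Z (ψ′ a)
  ψ′-bd a z =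
    0≤b-a⇒a≤b (subst (0ℚ ≤ℚ_) (solve 1 (λ x → con (p2 1) :* (x :+ con ½) := con (p2 1) :* x :- (:- con 1ℚ)) refl (inner a z))
      (0≤* (0≤p2 1) (proj₂ (proj₂ step (a , z))))) ,
    ℚₚ.*-monoˡ-≤-nonNeg (p2 1) (proj₁ (proj₂ step (a , z)))
  ψ′-mean : ∀ a → 𝔼 Z (ψ′ a) ≡ 0ℚ
  ψ′-mean a = begin
    𝔼 Z (ψ′ a)           ≡⟨ 𝔼-* Z (p2 1) (inner a) ⟩
    p2 1 *ℚ 𝔼 Z (inner a) ≡⟨ cong (p2 1 *ℚ_) (begin
      𝔼 Z (inner a)
        ≡⟨ 𝔼-swap Z (vec bit b) (λ z i → ψ a (_⊞_ {Z} (get Z t i) z)) ⟩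
      (𝔼 (vec bit b) λ i → 𝔼 Z λ z → ψ a (_⊞_ {Z} (get Z t i) z))
        ≡⟨ 𝔼-cong (vec bit b) (λ i → trans (𝔼-shiftˡ (get Z t i) (ψ a)) (ψ-mean a)) ⟩
      (𝔼 (vec bit b) λ i → 0ℚ)
        ≡⟨ 𝔼-const (vec bit b) 0ℚ ⟩
      0ℚ ∎) ⟩
    p2 1 *ℚ 0ℚ           ≡⟨ ℚₚ.*-zeroʳ (p2 1) ⟩
    0ℚ                   ∎
    where
    open ≡-Reasoning
    ⊞-comm : ∀ u x y → _⊞_ {u} x y ≡ _⊞_ {u} y x
    ⊞-comm bit x y = 𝔹ₚ.xor-comm x y
    ⊞-comm (u ⊗ v) (x , x′) (y , y′) = cong₂ _,_ (⊞-comm u x y) (⊞-comm v x′ y′)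
    ⊞-comm (vec u zero) [] [] = refl
    ⊞-comm (vec u (suc n)) (x ∷ xs) (y ∷ ys) = cong₂ _∷_ (⊞-comm u x y) (⊞-comm (vec u n) xs ys)
    𝔼-shiftˡ : ∀ w (f : El Z → ℚ) → 𝔼 Z (λ z → f (_⊞_ {Z} w z)) ≡ 𝔼 Z f
    𝔼-shiftˡ w f = trans (𝔼-cong Z λ z → cong f (⊞-comm Z w z)) (𝔼-shift Z w f)
  rest = samples-centred A Z β q ψ′ ψ′-bd ψ′-mean size≤
  close : ∀ a z → Close (½^ (suc q))
            (𝔼 (vec (vec bit b) (suc q)) λ is → ψ a (_⊞_ {Z} (combine Z (t ∷ proj₁ rest) is) z)) 0ℚ
  close a z = subst (λ e → Close (½ *ℚ ½^ q) e 0ℚ) (sym halved)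
      (ℚₚ.≤-trans (ℚₚ.*-monoˡ-≤-nonNeg ½ (proj₁ ih)) (ℚₚ.≤-reflexive (solve 1 (λ x → con ½ :* (con 0ℚ :+ x) := con 0ℚ :+ con ½ :* x) refl (½^ q))) ,
       subst (0ℚ ≤ℚ_) (ℚₚ.*-distribˡ-+ ½ X (½^ q)) (0≤* (ℚₚ.nonNegative⁻¹ ½) (proj₂ ih)))
    where
    open ≡-Reasoning
    ih = proj₂ rest a z
    c : Vec (Vec Bool b) q → El Z
    c = combine Z (proj₁ rest)
    X = 𝔼 (vec (vec bit b) q) λ is → ψ′ a (_⊞_ {Z} (c is) z)
    halved : (𝔼 (vec bit b) λ i → 𝔼 (vec (vec bit b) q) λ is → ψ a (_⊞_ {Z} (_⊞_ {Z} (get Z t i) (c is)) z)) ≡ ½ *ℚ X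
    halved = begin
      (𝔼 (vec bit b) λ i → 𝔼 (vec (vec bit b) q) λ is → ψ a (_⊞_ {Z} (_⊞_ {Z} (get Z t i) (c is)) z))
        ≡⟨ 𝔼-swap (vec bit b) (vec (vec bit b) q) (λ i is → ψ a (_⊞_ {Z} (_⊞_ {Z} (get Z t i) (c is)) z)) ⟩
      (𝔼 (vec (vec bit b) q) λ is → 𝔼 (vec bit b) λ i → ψ a (_⊞_ {Z} (_⊞_ {Z} (get Z t i) (c is)) z))
        ≡⟨ 𝔼-cong (vec (vec bit b) q) (λ is → trans
             (𝔼-cong (vec bit b) λ i → cong (ψ a) (⊞-assoc Z (get Z t i) (c is) z))
             (solve 1 (λ x → x := con ½ :* (con (p2 1) :* x)) refl (inner a (_⊞_ {Z} (c is) z)))) ⟩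
      (𝔼 (vec (vec bit b) q) λ is → ½ *ℚ ψ′ a (_⊞_ {Z} (c is) z))
        ≡⟨ 𝔼-* (vec (vec bit b) q) ½ (λ is → ψ′ a (_⊞_ {Z} (c is) z)) ⟩
      ½ *ℚ X ∎

-- Subtracting the mean turns tests with values in [0, 1] into centred tests bounded by 1; the claim
-- is then the case of the zero translation.
samples : ∀ A Z β q (φ : El A → El Z → ℚ) → (∀ a z → 0ℚ ≤ℚ φ a z × φ a z ≤ℚ 1ℚ) →
          bits A + bits Z + 2 ≤ 2 ^ β →
          Σ (Vec (El (table Z (5 + β))) q) λ ts → ∀ a →
            Close (½^ q) (𝔼 (vec (vec bit (5 + β)) q) λ is → φ a (combine Z ts is)) (𝔼 Z (φ a))
samples A Z β q φ φ-bd size≤ = proj₁ centred , close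
  where
  b = 5 + β
  μ : El A → ℚ
  μ a = 𝔼 Z (φ a)
  ψ : El A → El Z → ℚ
  ψ a z = φ a z -ℚ μ a
  0≤μ : ∀ a → 0ℚ ≤ℚ μ a
  0≤μ a = 𝔼-bounded-below Z λ z → proj₁ (φ-bd a z)
  μ≤1 : ∀ a → μ a ≤ℚ 1ℚ
  μ≤1 a = 𝔼-bounded Z λ z → proj₂ (φ-bd a z)
  ψ-bd : ∀ a → Bounded Z (ψ a)
  ψ-bd a z = ℚₚ.+-mono-≤ {0ℚ} (proj₁ (φ-bd a z)) (ℚₚ.neg-antimono-≤ (μ≤1 a)) ,
             ℚₚ.+-mono-≤ (proj₂ (φ-bd a z)) (ℚₚ.neg-antimono-≤ (0≤μ a))
  ψ-mean : ∀ a → 𝔼 Z (ψ a) ≡ 0ℚ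
  ψ-mean a = trans (𝔼-+ Z (φ a) (λ _ → -ℚ μ a)) (trans (cong (μ a +ℚ_) (𝔼-const Z (-ℚ μ a))) (ℚₚ.+-inverseʳ (μ a)))
  centred = samples-centred A Z β q ψ ψ-bd ψ-mean size≤
  close : ∀ a → Close (½^ q) (𝔼 (vec (vec bit b) q) λ is → φ a (combine Z (proj₁ centred) is)) (μ a)
  close a = 
    0≤b-a⇒a≤b (subst (0ℚ ≤ℚ_) (solve 3 (λ e m ε → (con 0ℚ :+ ε) :- (e :- m) := (m :+ ε) :- e) refl e (μ a) (½^ q))
      (a≤b⇒0≤b-a (proj₁ at0))) ,
    0≤b-a⇒a≤b (subst (0ℚ ≤ℚ_) (solve 3 (λ e m ε → (e :- m) :+ ε := (e :+ ε) :- m) refl e (μ a) (½^ q)) (proj₂ at0))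
    where
    is-space = vec (vec bit b) q
    e = 𝔼 is-space λ is → φ a (combine Z (proj₁ centred) is)
    at0 : Close (½^ q) (e -ℚ μ a) 0ℚ
    at0 = subst (λ x → Close (½^ q) x 0ℚ)
      (trans (𝔼-cong is-space λ is → cong (ψ a) (⊞-identityʳ Z (combine Z (proj₁ centred) is)))
      (trans (𝔼-+ is-space (λ is → φ a (combine Z (proj₁ centred) is)) (λ _ → -ℚ μ a))
             (cong (e +ℚ_) (𝔼-const is-space (-ℚ μ a)))))
      (proj₂ centred a (⊞-0 Z))

-- Comparator circuits and their restrictions

step : ∀ {m} → Vec Bool m → Fin m × Fin m → Vec Bool m
step w (p , q) = (w [ p ]≔ (lookup w p ∧ lookup w q)) [ q ]≔ (lookup w p ∨ lookup w q)

run : ∀ {m} → Vec Bool m → List (Fin m × Fin m) → Vec Bool m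
run = foldl step

lookup-step-∨ : ∀ {m} (w : Vec Bool m) p q → lookup (step w (p , q)) q ≡ lookup w p ∨ lookup w q
lookup-step-∨ w p q = Vecₚ.lookup∘update q (w [ p ]≔ _) _

lookup-step-∧ : ∀ {m} (w : Vec Bool m) {p q} → p ≢ q → lookup (step w (p , q)) p ≡ lookup w p ∧ lookup w q
lookup-step-∧ w {p} {q} p≢q = trans (Vecₚ.lookup∘update′ p≢q (w [ p ]≔ _) _) (Vecₚ.lookup∘update p w _)

lookup-step-≢ : ∀ {m} (w : Vec Bool m) {p q r} → r ≢ p → r ≢ q → lookup (step w (p , q)) r ≡ lookup w r
lookup-step-≢ w {p} {q} r≢p r≢q =
  trans (Vecₚ.lookup∘update′ r≢q (w [ p ]≔ _) _) (Vecₚ.lookup∘update′ r≢p w _)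

step-diagonal : ∀ {m} (w : Vec Bool m) p → step w (p , p) ≡ w
step-diagonal w p =
  trans (Vecₚ.[]≔-idempotent w p)
  (trans (cong (w [ p ]≔_) (𝔹ₚ.∨-idem (lookup w p))) (Vecₚ.[]≔-lookup w p))

record Circ (V : Set) (m : ℕ) : Set where
  field
    label : Fin m → V × Bool
    gates : List (Fin m × Fin m)
    out   : Fin m

-- Signs are XORed on, so that a translation of the assignment is absorbed by the labels.
literal : ∀ {V : Set} → (V → Bool) → V × Bool → Bool
literal a (v , s) = a v xor s

opaque
  eval : ∀ {V m} → Circ V m → (V → Bool) → Bool
  eval c a = lookup (run (Data.Vec.tabulate (literal a ∘ label)) gates) out
    where open Circ c

  eval-unfold : ∀ {V : Set} {m} (c : Circ V m) (a : V → Bool) →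
                eval c a ≡ lookup (run (Data.Vec.tabulate (literal a ∘ Circ.label c)) (Circ.gates c)) (Circ.out c)
  eval-unfold c a = refl

  eval-ext : ∀ {V : Set} {m} (c : Circ V m) {a a′ : V → Bool} → (∀ v → a v ≡ a′ v) → eval c a ≡ eval c a′
  eval-ext c {a} {a′} h = cong (λ w → lookup (run w gates) out)
    (Vecₚ.tabulate-cong λ i → cong (_xor proj₂ (label i)) (h (proj₁ (label i))))
    where open Circ c

false≢true : false ≢ true
false≢true ()

toℕᵇ : Bool → ℕ
toℕᵇ true  = 1
toℕᵇ false = 0

sumV : ∀ {A : Set} {n} → (A → ℕ) → Vec A n → ℕ
sumV f []       = 0
sumV f (x ∷ xs) = f x + sumV f xs

sumV-update : ∀ {A : Set} {n} (f : A → ℕ) (v : Vec A n) i a →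
              sumV f (v [ i ]≔ a) + f (lookup v i) ≡ sumV f v + f a
sumV-update f (x ∷ xs) zero a = begin
  (f a + sumV f xs) + f x   ≡⟨ ℕₚ.+-comm (f a + sumV f xs) (f x) ⟩
  f x + (f a + sumV f xs)   ≡⟨ cong (λ k → f x + k) (ℕₚ.+-comm (f a) (sumV f xs)) ⟩
  f x + (sumV f xs + f a)   ≡⟨ ℕₚ.+-assoc (f x) (sumV f xs) (f a) ⟨
  (f x + sumV f xs) + f a   ∎
  where open ≡-Reasoning
sumV-update f (x ∷ xs) (suc i) a = begin
  (f x + sumV f (xs [ i ]≔ a)) + f (lookup xs i) ≡⟨ ℕₚ.+-assoc (f x) _ _ ⟩
  f x + (sumV f (xs [ i ]≔ a) + f (lookup xs i)) ≡⟨ cong (λ k → f x + k) (sumV-update f xs i a) ⟩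
  f x + (sumV f xs + f a)                        ≡⟨ ℕₚ.+-assoc (f x) _ _ ⟨
  (f x + sumV f xs) + f a                        ∎
  where open ≡-Reasoning

sumV-update₂ : ∀ {A : Set} {n} (f : A → ℕ) (v : Vec A n) {i j} a b → i ≢ j →
               f a + f b ≡ f (lookup v i) + f (lookup v j) →
               sumV f ((v [ i ]≔ a) [ j ]≔ b) ≡ sumV f v
sumV-update₂ f v {i} {j} a b i≢j eq = ℕₚ.+-cancelʳ-≡ (f (lookup v i) + f (lookup v j)) _ _ (begin
  S₂ + (f (lookup v i) + f (lookup v j))   ≡⟨ cong (λ k → S₂ + k) (ℕₚ.+-comm (f (lookup v i)) _) ⟩
  S₂ + (f (lookup v j) + f (lookup v i))   ≡⟨ ℕₚ.+-assoc S₂ _ _ ⟨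
  (S₂ + f (lookup v j)) + f (lookup v i)
    ≡⟨ cong (λ x → S₂ + f x + f (lookup v i)) (sym (Vecₚ.lookup∘update′ (i≢j ∘ sym) v a)) ⟩
  (S₂ + f (lookup (v [ i ]≔ a) j)) + f (lookup v i) ≡⟨ cong (λ k → k + f (lookup v i)) (sumV-update f (v [ i ]≔ a) j b) ⟩
  (S₁ + f b) + f (lookup v i)              ≡⟨ ℕₚ.+-assoc S₁ _ _ ⟩
  S₁ + (f b + f (lookup v i))              ≡⟨ cong (λ k → S₁ + k) (ℕₚ.+-comm (f b) _) ⟩
  S₁ + (f (lookup v i) + f b)              ≡⟨ ℕₚ.+-assoc S₁ _ _ ⟨
  (S₁ + f (lookup v i)) + f b              ≡⟨ cong (λ k → k + f b) (sumV-update f v i a) ⟩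
  (sumV f v + f a) + f b                   ≡⟨ ℕₚ.+-assoc (sumV f v) _ _ ⟩
  sumV f v + (f a + f b)                   ≡⟨ cong (λ k → sumV f v + k) eq ⟩
  sumV f v + (f (lookup v i) + f (lookup v j)) ∎)
  where
  open ≡-Reasoning
  S₁ = sumV f (v [ i ]≔ a)
  S₂ = sumV f ((v [ i ]≔ a) [ j ]≔ b)

sumV-bound : ∀ {A : Set} {n} (f : A → ℕ) {c} → (∀ x → f x ≤ c) → (v : Vec A n) → sumV f v ≤ n * c
sumV-bound f h []       = z≤n
sumV-bound f h (x ∷ xs) = ℕₚ.+-mono-≤ (h x) (sumV-bound f h xs)

ones : ∀ {n} → Vec Bool n → ℕ
ones = sumV toℕᵇ

toℕᵇ-∧-∨ : ∀ a b → toℕᵇ (a ∧ b) + toℕᵇ (a ∨ b) ≡ toℕᵇ a + toℕᵇ b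
toℕᵇ-∧-∨ true  true  = refl
toℕᵇ-∧-∨ true  false = refl
toℕᵇ-∧-∨ false b     = refl

ones-step : ∀ {m} (w : Vec Bool m) {p q} → p ≢ q → ones (step w (p , q)) ≡ ones w
ones-step w {p} {q} p≢q = sumV-update₂ toℕᵇ w _ _ p≢q (toℕᵇ-∧-∨ (lookup w p) (lookup w q))

ones-∧-∨ : ∀ {n} (r s : Vec Bool n) →
           ones (Data.Vec.zipWith _∨_ r s) + ones (Data.Vec.zipWith _∧_ r s) ≡ ones r + ones s
ones-∧-∨ [] [] = refl
ones-∧-∨ (a ∷ r) (b ∷ s) = begin
  (x + X) + (y + Y)                     ≡⟨ interchange x X y Y ⟩
  (x + y) + (X + Y)                     ≡⟨ cong₂ _+_ (trans (ℕₚ.+-comm x y) (toℕᵇ-∧-∨ a b)) (ones-∧-∨ r s) ⟩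
  (toℕᵇ a + toℕᵇ b) + (ones r + ones s) ≡⟨ interchange (toℕᵇ a) (toℕᵇ b) (ones r) (ones s) ⟩
  (toℕᵇ a + ones r) + (toℕᵇ b + ones s) ∎
  where
  open ≡-Reasoning
  x = toℕᵇ (a ∨ b)
  y = toℕᵇ (a ∧ b)
  X = ones (Data.Vec.zipWith _∨_ r s)
  Y = ones (Data.Vec.zipWith _∧_ r s)

-- Tracking which wires are known to be comparable

infix 4 _⊑_
_⊑_ : Bool → Bool → Set
a ⊑ b = a ∧ b ≡ a

⊑⇒∨ : ∀ {a b} → a ⊑ b → a ∨ b ≡ b
⊑⇒∨ {true}  {true}  _ = refl
⊑⇒∨ {false} {b}     _ = refl

-- Entry (p , q) records that the value of wire p is known to be at most that of wire q.
Order : ℕ → Set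
Order m = Vec (Vec Bool m) m

entry : ∀ {m} → Order m → Fin m → Fin m → Bool
entry K p q = lookup (lookup K p) q

Sound : ∀ {m} → Order m → Vec Bool m → Set
Sound K w = ∀ p q → entry K p q ≡ true → lookup w p ⊑ lookup w q

-- A convention of bookkeeping: a stored fact (p , p) would be carried to (p , q) by the gate, and
-- the entry (p , q) would no longer be new.
Irreflexive : ∀ {m} → Order m → Set
Irreflexive K = ∀ p → entry K p p ≡ false

∣_∣ᴷ : ∀ {m} → Order m → ℕ
∣ K ∣ᴷ = sumV ones K

-- The minimum, now on p, lies below whatever one of the wires lay below; the maximum, on q, only
-- below what both lay below.
rowStep : ∀ {m} → Order m → Fin m × Fin m → Order m
rowStep K (p , q) = (K [ p ]≔ Data.Vec.zipWith _∨_ (lookup K p) (lookup K q))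
                       [ q ]≔ Data.Vec.zipWith _∧_ (lookup K p) (lookup K q)

-- Dually, lying below the minimum takes both facts and lying below the maximum one of them, so the
-- gate itself acts on each row.
colStep : ∀ {m} → Order m → Fin m × Fin m → Order m
colStep K g = Data.Vec.map (λ row → step row g) K

-- Both steps preserve the number of true entries, because a ∧ b and a ∨ b have as many as a and b.
orderStep : ∀ {m} → Order m → Fin m × Fin m → Order m
orderStep K (p , q) = K′ [ p ]≔ (lookup K′ p [ q ]≔ true)
  where K′ = colStep (rowStep K (p , q)) (p , q)

module _ {m} (K : Order m) {p q : Fin m} (p≢q : p ≢ q) where
  private
    M K′ : Order m
    M  = rowStep K (p , q)
    K′ = colStep M (p , q)

    row-p : ∀ k → entry M p k ≡ entry K p k ∨ entry K q k
    row-p k = trans (cong (λ r → lookup r k) (trans (Vecₚ.lookup∘update′ p≢q (K [ p ]≔ _) _) (Vecₚ.lookup∘update p K _)))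
                    (Vecₚ.lookup-zipWith _∨_ k (lookup K p) (lookup K q))

    row-q : ∀ k → entry M q k ≡ entry K p k ∧ entry K q k
    row-q k = trans (cong (λ r → lookup r k) (Vecₚ.lookup∘update q (K [ p ]≔ _) _))
                    (Vecₚ.lookup-zipWith _∧_ k (lookup K p) (lookup K q))

    row-≢ : ∀ {r} → r ≢ p → r ≢ q → ∀ k → entry M r k ≡ entry K r k
    row-≢ r≢p r≢q k = cong (λ r → lookup r k)
      (trans (Vecₚ.lookup∘update′ r≢q (K [ p ]≔ _) _) (Vecₚ.lookup∘update′ r≢p K _))

    row-K′ : ∀ r → lookup K′ r ≡ step (lookup M r) (p , q)
    row-K′ r = Vecₚ.lookup-map r (λ row → step row (p , q)) M

    col-p : ∀ r → entry K′ r p ≡ entry M r p ∧ entry M r q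
    col-p r = trans (cong (λ v → lookup v p) (row-K′ r)) (lookup-step-∧ (lookup M r) p≢q)

    col-q : ∀ r → entry K′ r q ≡ entry M r p ∨ entry M r q
    col-q r = trans (cong (λ v → lookup v q) (row-K′ r)) (lookup-step-∨ (lookup M r) p q)

    col-≢ : ∀ r {k} → k ≢ p → k ≢ q → entry K′ r k ≡ entry M r k
    col-≢ r {k} k≢p k≢q = trans (cong (λ v → lookup v k) (row-K′ r)) (lookup-step-≢ (lookup M r) k≢p k≢q)

    row-sum : ∣ M ∣ᴷ ≡ ∣ K ∣ᴷ
    row-sum = sumV-update₂ ones K _ _ p≢q (ones-∧-∨ (lookup K p) (lookup K q))

    col-sum : ∀ {n} (N : Vec (Vec Bool m) n) → sumV ones (Data.Vec.map (λ row → step row (p , q)) N) ≡ sumV ones N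
    col-sum []      = refl
    col-sum (r ∷ N) = cong₂ _+_ (ones-step r p≢q) (col-sum N)

  -- Before it is set, the entry (p , q) is the disjunction of the old (p , p), (q , p), (p , q) and
  -- (q , q), all absent; setting it gains exactly one.
  orderStep-grows : Irreflexive K → entry K p q ≡ false → entry K q p ≡ false →
                    ∣ orderStep K (p , q) ∣ᴷ ≡ suc ∣ K ∣ᴷ
  orderStep-grows irr pq qp = ℕₚ.+-cancelʳ-≡ (ones (lookup K′ p)) _ _ (begin
    ∣ orderStep K (p , q) ∣ᴷ + ones (lookup K′ p)   ≡⟨ sumV-update ones K′ p _ ⟩
    ∣ K′ ∣ᴷ + ones (lookup K′ p [ q ]≔ true)        ≡⟨ cong (λ k → ∣ K′ ∣ᴷ + k) one-more ⟩
    ∣ K′ ∣ᴷ + suc (ones (lookup K′ p))              ≡⟨ ℕₚ.+-suc ∣ K′ ∣ᴷ _ ⟩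
    suc (∣ K′ ∣ᴷ + ones (lookup K′ p))              ≡⟨ cong (λ k → suc (k + ones (lookup K′ p))) (trans (col-sum M) row-sum) ⟩
    suc ∣ K ∣ᴷ + ones (lookup K′ p)                 ∎)
    where
    open ≡-Reasoning
    absent : entry K′ p q ≡ false
    absent = trans (col-q p) (cong₂ _∨_ (trans (row-p p) (cong₂ _∨_ (irr p) qp)) (trans (row-p q) (cong₂ _∨_ pq (irr q))))
    one-more : ones (lookup K′ p [ q ]≔ true) ≡ suc (ones (lookup K′ p))
    one-more = begin
      ones (lookup K′ p [ q ]≔ true)                          ≡⟨ ℕₚ.+-identityʳ _ ⟨
      ones (lookup K′ p [ q ]≔ true) + 0                      ≡⟨ cong (λ b → ones (lookup K′ p [ q ]≔ true) + toℕᵇ b) absent ⟨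
      ones (lookup K′ p [ q ]≔ true) + toℕᵇ (entry K′ p q)    ≡⟨ sumV-update toℕᵇ (lookup K′ p) q true ⟩
      ones (lookup K′ p) + 1                                  ≡⟨ ℕₚ.+-comm _ 1 ⟩
      suc (ones (lookup K′ p))                                ∎

  orderStep-irreflexive : Irreflexive K → entry K p q ≡ false → entry K q p ≡ false →
                          Irreflexive (orderStep K (p , q))
  orderStep-irreflexive irr pq qp r with r Finₚ.≟ p
  ... | yes refl = trans (cong (λ v → lookup v p) (Vecₚ.lookup∘update p K′ _))
                   (trans (Vecₚ.lookup∘update′ p≢q (lookup K′ p) true)
                   (trans (col-p p) (cong (_∧ entry M p q) (trans (row-p p) (cong₂ _∨_ (irr p) qp)))))
  ... | no r≢p = trans (cong (λ v → lookup v r) (Vecₚ.lookup∘update′ r≢p K′ _)) (at-r r r≢p)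
    where
    at-r : ∀ r → r ≢ p → entry K′ r r ≡ false
    at-r r r≢p with r Finₚ.≟ q
    ... | yes refl = trans (col-q q) (cong₂ _∨_ (trans (row-q p) (cong (_∧ entry K q p) (irr p)))
                                                (trans (row-q q) (cong (_∧ entry K q q) pq)))
    ... | no r≢q = trans (col-≢ r r≢p r≢q) (trans (row-≢ r≢p r≢q r) (irr r))

  orderStep-sound : ∀ w → Sound K w → Sound (orderStep K (p , q)) (step w (p , q))
  orderStep-sound w sound = final
    where
    w′ = step w (p , q)
    ∨-cases : ∀ {a b} → a ∨ b ≡ true → a ≡ true ⊎ b ≡ true
    ∨-cases {true}  _ = inj₁ refl
    ∨-cases {false} e = inj₂ e
    ∧-both : ∀ {a b} → a ∧ b ≡ true → a ≡ true × b ≡ true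
    ∧-both {true} {true} _ = refl , refl
    ∧⊑ˡ : ∀ a b c → a ⊑ c → a ∧ b ⊑ c
    ∧⊑ˡ true  true  c h = h
    ∧⊑ˡ true  false c h = refl
    ∧⊑ˡ false b     c h = refl
    ∧⊑ʳ : ∀ a b c → b ⊑ c → a ∧ b ⊑ c
    ∧⊑ʳ true  b c h = h
    ∧⊑ʳ false b c h = refl
    ∨⊑ : ∀ a b c → a ⊑ c → b ⊑ c → a ∨ b ⊑ c
    ∨⊑ true  b c h h′ = h
    ∨⊑ false b c h h′ = h′
    ⊑∧ : ∀ a b c → a ⊑ b → a ⊑ c → a ⊑ b ∧ c
    ⊑∧ true  true b h h′ = h′
    ⊑∧ false b    c h h′ = refl
    ⊑∨ˡ : ∀ a b c → a ⊑ b → a ⊑ b ∨ c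
    ⊑∨ˡ true  true c h = refl
    ⊑∨ˡ false b    c h = refl
    ⊑∨ʳ : ∀ a b c → a ⊑ c → a ⊑ b ∨ c
    ⊑∨ʳ true  true  c    h = refl
    ⊑∨ʳ true  false true h = refl
    ⊑∨ʳ false b     c    h = refl
    ∧⊑∨ : ∀ a b → a ∧ b ⊑ a ∨ b
    ∧⊑∨ true  true  = refl
    ∧⊑∨ true  false = refl
    ∧⊑∨ false b     = refl
    at-p : lookup w′ p ≡ lookup w p ∧ lookup w q
    at-p = lookup-step-∧ w p≢q
    at-q : lookup w′ q ≡ lookup w p ∨ lookup w q
    at-q = lookup-step-∨ w p q
    -- Half-way invariant: the new value of r against the old value of k. The column step then
    -- updates the right-hand side.
    rows : ∀ r k → entry M r k ≡ true → lookup w′ r ⊑ lookup w k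
    rows r k e with r Finₚ.≟ p
    ... | yes refl = subst (_⊑ lookup w k) (sym at-p) (case-∨ (∨-cases (trans (sym (row-p k)) e)))
      where
      case-∨ : entry K p k ≡ true ⊎ entry K q k ≡ true → lookup w p ∧ lookup w q ⊑ lookup w k
      case-∨ (inj₁ h) = ∧⊑ˡ _ (lookup w q) _ (sound p k h)
      case-∨ (inj₂ h) = ∧⊑ʳ (lookup w p) _ _ (sound q k h)
    ... | no r≢p with r Finₚ.≟ q
    ... | yes refl = subst (_⊑ lookup w k) (sym at-q)
          (∨⊑ _ _ _ (sound p k (proj₁ both)) (sound q k (proj₂ both)))
      where both = ∧-both (trans (sym (row-q k)) e)
    ... | no r≢q = subst (_⊑ lookup w k) (sym (lookup-step-≢ w r≢p r≢q)) (sound r k (trans (sym (row-≢ r≢p r≢q k)) e))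
    cols : ∀ r k → entry K′ r k ≡ true → lookup w′ r ⊑ lookup w′ k
    cols r k e with k Finₚ.≟ p
    ... | yes refl = subst (lookup w′ r ⊑_) (sym at-p) (⊑∧ _ _ _ (rows r p (proj₁ both)) (rows r q (proj₂ both)))
      where both = ∧-both (trans (sym (col-p r)) e)
    ... | no k≢p with k Finₚ.≟ q
    ... | yes refl = subst (lookup w′ r ⊑_) (sym at-q) (case-∨ (∨-cases (trans (sym (col-q r)) e)))
      where
      case-∨ : entry M r p ≡ true ⊎ entry M r q ≡ true → lookup w′ r ⊑ lookup w p ∨ lookup w q
      case-∨ (inj₁ h) = ⊑∨ˡ _ _ (lookup w q) (rows r p h)
      case-∨ (inj₂ h) = ⊑∨ʳ _ (lookup w p) _ (rows r q h)
    ... | no k≢q = subst (lookup w′ r ⊑_) (sym (lookup-step-≢ w k≢p k≢q)) (rows r k (trans (sym (col-≢ r k≢p k≢q)) e))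
    final : Sound (orderStep K (p , q)) w′
    final r k e with r Finₚ.≟ p
    ... | no r≢p = cols r k (trans (sym (cong (λ v → lookup v k) (Vecₚ.lookup∘update′ r≢p K′ _))) e)
    ... | yes refl with k Finₚ.≟ q
    ... | yes refl = subst₂ _⊑_ (sym at-p) (sym at-q) (∧⊑∨ (lookup w p) (lookup w q))
    ... | no k≢q = cols p k (trans (sym (trans (cong (λ v → lookup v k) (Vecₚ.lookup∘update p K′ _))
                                               (Vecₚ.lookup∘update′ k≢q (lookup K′ p) true))) e)

-- The content of a wire of the given circuit: a wire of the reduced circuit, or a constant.
value : ∀ {m} → Fin m ⊎ Bool → Vec Bool m → Bool
value (inj₁ p) w = lookup w p
value (inj₂ c) w = c

Represents : ∀ {ℓ m} → (Fin ℓ → Fin m ⊎ Bool) → Vec Bool ℓ → Vec Bool m → Set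
Represents τ x w = ∀ k → lookup x k ≡ value (τ k) w

-- Keeps the two ends of an emitted gate distinct and ensures that the gate disturbs no further
-- wire.
WireInjective : ∀ {ℓ m} → (Fin ℓ → Fin m ⊎ Bool) → Set
WireInjective τ = ∀ k l p → τ k ≡ inj₁ p → τ l ≡ inj₁ p → k ≡ l

data Comparison {m} (K : Order m) : Fin m ⊎ Bool → Fin m ⊎ Bool → Set where
  below   : ∀ {s t} → (∀ w → Sound K w → value s w ⊑ value t w) → Comparison K s t
  above   : ∀ {s t} → (∀ w → Sound K w → value t w ⊑ value s w) → Comparison K s t
  unknown : ∀ {p q} → entry K p q ≡ false → entry K q p ≡ false → Comparison K (inj₁ p) (inj₁ q)

-- Constants compare with everything, so a gate with a constant input never reaches the reduced
-- circuit.
compare : ∀ {m} (K : Order m) s t → Comparison K s t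
compare K (inj₂ false) t            = below λ _ _ → refl
compare K (inj₂ true)  t            = above λ w _ → 𝔹ₚ.∧-identityʳ (value t w)
compare K (inj₁ p)     (inj₂ false) = above λ _ _ → refl
compare K (inj₁ p)     (inj₂ true)  = below λ w _ → 𝔹ₚ.∧-identityʳ (lookup w p)
compare K (inj₁ p)     (inj₁ q) with entry K p q in pq | entry K q p in qp
... | true  | _     = below λ w sound → sound p q pq
... | false | true  = above λ w sound → sound q p qp
... | false | false = unknown pq qp

-- Gates between wires known to be comparable only permute the contents, and every other gate adds an entry to K,
-- so at most m² gates are kept.
simulate : ∀ {ℓ m} (o : Fin ℓ) (gs : List (Fin ℓ × Fin ℓ)) (τ : Fin ℓ → Fin m ⊎ Bool) (K : Order m) →
           WireInjective τ → Irreflexive K →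
           Σ (List (Fin m × Fin m)) λ gs′ → Σ (Fin m ⊎ Bool) λ o′ →
             length gs′ + ∣ K ∣ᴷ ≤ m * m ×
             (∀ x w → Represents τ x w → Sound K w → lookup (run x gs) o ≡ value o′ (run w gs′))
simulate {m = m} o [] τ K inj irr =
  [] , τ o , sumV-bound ones ones≤ K , λ x w rep _ → rep o
  where
  toℕᵇ≤1 : ∀ b → toℕᵇ b ≤ 1
  toℕᵇ≤1 true  = s≤s z≤n
  toℕᵇ≤1 false = z≤n
  ones≤ : (r : Vec Bool m) → ones r ≤ m
  ones≤ r = subst (ones r ≤_) (ℕₚ.*-identityʳ m) (sumV-bound toℕᵇ toℕᵇ≤1 r)
simulate {ℓ} {m} o ((i , j) ∷ gs) τ K inj irr with i Finₚ.≟ j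
... | yes refl = proj₁ rest , proj₁ (proj₂ rest) , proj₁ (proj₂ (proj₂ rest)) ,
      λ x w rep sound → trans (cong (λ x′ → lookup (run x′ gs) o) (step-diagonal x i)) (proj₂ (proj₂ (proj₂ rest)) x w rep sound)
  where rest = simulate o gs τ K inj irr
... | no i≢j with τ i in τi | τ j in τj | compare K (τ i) (τ j)
... | s | t | below h = proj₁ rest , proj₁ (proj₂ rest) , proj₁ (proj₂ (proj₂ rest)) ,
      λ x w rep sound → proj₂ (proj₂ (proj₂ rest)) (step x (i , j)) w (rep′ x w rep sound) sound
  where
  rest = simulate o gs τ K inj irr
  rep′ : ∀ x w → Represents τ x w → Sound K w → Represents τ (step x (i , j)) w
  rep′ x w rep sound k with k Finₚ.≟ j
  ... | yes refl = trans (lookup-step-∨ x i j) (trans (⊑⇒∨ (subst₂ _⊑_ (trans (cong (λ s → value s w) (sym τi)) (sym (rep i)))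
                           (trans (cong (λ s → value s w) (sym τj)) (sym (rep j))) (h w sound))) (rep j))
  ... | no k≢j with k Finₚ.≟ i
  ... | yes refl = trans (lookup-step-∧ x i≢j) (trans (subst₂ _⊑_ (trans (cong (λ s → value s w) (sym τi)) (sym (rep i)))
                           (trans (cong (λ s → value s w) (sym τj)) (sym (rep j))) (h w sound)) (rep i))
  ... | no k≢i = trans (lookup-step-≢ x k≢i k≢j) (rep k)
... | s | t | above h = proj₁ rest , proj₁ (proj₂ rest) , proj₁ (proj₂ (proj₂ rest)) ,
      λ x w rep sound → proj₂ (proj₂ (proj₂ rest)) (step x (i , j)) w (rep′ x w rep sound) sound
  where
  -- The larger value sits on i, so the gate exchanges the two contents. Renaming the wires does the
  -- same, and no gate is emitted.
  τ′ : Fin ℓ → Fin m ⊎ Bool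
  τ′ k = τ (transpose i j k)
  inj′ : WireInjective τ′
  inj′ k l p ek el = trans (sym (transpose-inverse j i))
    (trans (cong (transpose j i) (inj _ _ p ek el)) (transpose-inverse j i))
  rest = simulate o gs τ′ K inj′ irr
  rep′ : ∀ x w → Represents τ x w → Sound K w → Represents τ′ (step x (i , j)) w
  rep′ x w rep sound k with k Finₚ.≟ i
  ... | yes refl = trans (lookup-step-∧ x i≢j)
        (trans (𝔹ₚ.∧-comm (lookup x i) (lookup x j))
        (trans (subst₂ _⊑_ (trans (cong (λ s → value s w) (sym τj)) (sym (rep j)))
                           (trans (cong (λ s → value s w) (sym τi)) (sym (rep i))) (h w sound)) (rep j)))
  ... | no k≢i with k Finₚ.≟ j
  ... | yes refl = trans (lookup-step-∨ x i j)
        (trans (𝔹ₚ.∨-comm (lookup x i) (lookup x j))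
        (trans (⊑⇒∨ (subst₂ _⊑_ (trans (cong (λ s → value s w) (sym τj)) (sym (rep j)))
                           (trans (cong (λ s → value s w) (sym τi)) (sym (rep i))) (h w sound))) (rep i)))
  ... | no k≢j = trans (lookup-step-≢ x k≢i k≢j) (rep k)
... | .(inj₁ p) | .(inj₁ q) | unknown {p} {q} pq qp =
      ((p , q) ∷ proj₁ rest) , proj₁ (proj₂ rest) ,
      subst (_≤ m * m) (trans (cong (λ k → length (proj₁ rest) + k) (orderStep-grows K p≢q irr pq qp)) (ℕₚ.+-suc _ _)) (proj₁ (proj₂ (proj₂ rest))) ,
      λ x w rep sound → proj₂ (proj₂ (proj₂ rest)) (step x (i , j)) (step w (p , q)) (rep′ x w rep)
                          (orderStep-sound K p≢q w sound)
  where
  p≢q : p ≢ q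
  p≢q refl = i≢j (inj i j p τi τj)
  rest = simulate o gs τ (orderStep K (p , q)) inj (orderStep-irreflexive K p≢q irr pq qp)
  at : ∀ x w → Represents τ x w → ∀ k {r} → τ k ≡ inj₁ r → lookup x k ≡ lookup w r
  at x w rep k τk = trans (rep k) (cong (λ s → value s w) τk)
  rep′ : ∀ x w → Represents τ x w → Represents τ (step x (i , j)) (step w (p , q))
  rep′ x w rep k with k Finₚ.≟ j
  ... | yes refl = trans (lookup-step-∨ x i j) (trans (cong₂ _∨_ (at x w rep i τi) (at x w rep j τj))
        (sym (trans (cong (λ s → value s w′) τj) (lookup-step-∨ w p q))))
    where w′ = step w (p , q)
  ... | no k≢j with k Finₚ.≟ i
  ... | yes refl = trans (lookup-step-∧ x i≢j) (trans (cong₂ _∧_ (at x w rep i τi) (at x w rep j τj))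
        (sym (trans (cong (λ s → value s w′) τi) (lookup-step-∧ w p≢q))))
    where w′ = step w (p , q)
  ... | no k≢i = trans (lookup-step-≢ x k≢i k≢j) (trans (rep k) (unchanged (τ k) refl))
    where
    unchanged : ∀ s → τ k ≡ s → value s w ≡ value s (step w (p , q))
    unchanged (inj₂ c) _  = refl
    unchanged (inj₁ r) τk = sym (lookup-step-≢ w
      (λ { refl → k≢i (inj k i r τk τi) }) (λ { refl → k≢j (inj k j r τk τj) }))

count : ∀ {ℓ} → (Fin ℓ → Bool) → ℕ
count {zero}  f = 0
count {suc ℓ} f = toℕᵇ (f zero) + count (f ∘ suc)

-- Numbers the live wires consecutively. The extra label fills the reduced wires beyond them, to
-- which no live wire is sent.
rename : ∀ {L : Set} {ℓ} m → (alive : Fin ℓ → Bool) (const : Fin ℓ → Bool) (lab : Fin ℓ → L) → L →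
         count alive ≤ m →
         Σ (Fin ℓ → Fin m ⊎ Bool) λ τ → Σ (Fin m → L) λ lab′ →
           WireInjective τ ×
           (∀ k → (alive k ≡ true × Σ (Fin m) λ p → τ k ≡ inj₁ p × lab′ p ≡ lab k) ⊎
                  (alive k ≡ false × τ k ≡ inj₂ (const k)))
rename {ℓ = zero} m alive const lab d h = (λ ()) , (λ _ → d) , (λ ()) , λ ()
rename {ℓ = suc ℓ} m alive const lab d h with alive zero in a₀
rename {L} {suc ℓ} (suc m) alive const lab d (s≤s h) | true
  with rename m (alive ∘ suc) (const ∘ suc) (lab ∘ suc) d h
... | τ , lab′ , inj , spec = τ⁺ , lab⁺ , inj⁺ , spec⁺
  where
  lift : Fin m ⊎ Bool → Fin (suc m) ⊎ Bool
  lift (inj₁ p) = inj₁ (suc p)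
  lift (inj₂ c) = inj₂ c
  τ⁺ : Fin (suc ℓ) → Fin (suc m) ⊎ Bool
  τ⁺ zero    = inj₁ zero
  τ⁺ (suc k) = lift (τ k)
  lab⁺ : Fin (suc m) → L
  lab⁺ zero    = lab zero
  lab⁺ (suc p) = lab′ p
  lift≢zero : ∀ s → lift s ≢ inj₁ zero
  lift≢zero (inj₁ p) ()
  lift≢zero (inj₂ c) ()
  unlift : ∀ s {p} → lift s ≡ inj₁ (suc p) → s ≡ inj₁ p
  unlift (inj₁ p) refl = refl
  inj⁺ : WireInjective τ⁺
  inj⁺ zero    zero    p       _ _ = refl
  inj⁺ zero    (suc l) .zero   refl e = ⊥-elim (lift≢zero (τ l) e)
  inj⁺ (suc k) zero    .zero   e refl = ⊥-elim (lift≢zero (τ k) e)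
  inj⁺ (suc k) (suc l) zero    e _ = ⊥-elim (lift≢zero (τ k) e)
  inj⁺ (suc k) (suc l) (suc p) e e′ = cong suc (inj k l p (unlift (τ k) e) (unlift (τ l) e′))
  spec⁺ : ∀ k → (alive k ≡ true × Σ (Fin (suc m)) λ p → τ⁺ k ≡ inj₁ p × lab⁺ p ≡ lab k) ⊎
                (alive k ≡ false × τ⁺ k ≡ inj₂ (const k))
  spec⁺ zero = inj₁ (a₀ , zero , refl , refl)
  spec⁺ (suc k) with spec k
  ... | inj₁ (a , p , e , e′) = inj₁ (a , suc p , cong lift e , e′)
  ... | inj₂ (a , e)          = inj₂ (a , cong lift e)
rename {L} {suc ℓ} m alive const lab d h | false
  with rename m (alive ∘ suc) (const ∘ suc) (lab ∘ suc) d h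
... | τ , lab′ , inj , spec = τ⁺ , lab′ , inj⁺ , spec⁺
  where
  τ⁺ : Fin (suc ℓ) → Fin m ⊎ Bool
  τ⁺ zero    = inj₂ (const zero)
  τ⁺ (suc k) = τ k
  inj⁺ : WireInjective τ⁺
  inj⁺ zero    l       p () _
  inj⁺ (suc k) zero    p _ ()
  inj⁺ (suc k) (suc l) p e e′ = cong suc (inj k l p e e′)
  spec⁺ : ∀ k → (alive k ≡ true × Σ (Fin m) λ p → τ⁺ k ≡ inj₁ p × lab′ p ≡ lab k) ⊎
                (alive k ≡ false × τ⁺ k ≡ inj₂ (const k))
  spec⁺ zero    = inj₂ (a₀ , refl)
  spec⁺ (suc k) = spec k

-- Codes of bounded length for restricted circuits

fromBits : ∀ {b} → Vec Bool b → ℕ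
fromBits []      = 0
fromBits (x ∷ v) = toℕᵇ x + fromBits v * 2

fromBits-toBits : ∀ b j → j < 2 ^ b → fromBits (toBits b j) ≡ j
fromBits-toBits zero    zero    _ = refl
fromBits-toBits zero    (suc j) (s≤s ())
fromBits-toBits (suc b) j h =
  trans (cong₂ (λ x y → x + y * 2) (parity (j Data.Nat.% 2) (m%n<n j 2))
          (fromBits-toBits b (j Data.Nat./ 2) (m<n*o⇒m/o<n (subst (j <_) (ℕₚ.*-comm 2 (2 ^ b)) h))))
        (sym (m≡m%n+[m/n]*n j 2))
  where
  parity : ∀ r → r < 2 → toℕᵇ (r Data.Nat.≡ᵇ 1) ≡ r
  parity zero          _ = refl
  parity (suc zero)    _ = refl
  parity (suc (suc r)) (s≤s (s≤s ()))

wire : ∀ μ → Vec Bool μ → Fin (2 ^ μ)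
wire μ v = (fromBits v mod (2 ^ μ)) {{ℕₚ.m^n≢0 2 μ}}

wire⁻¹ : ∀ μ → Fin (2 ^ μ) → Vec Bool μ
wire⁻¹ μ i = toBits μ (toℕ i)

wire-wire⁻¹ : ∀ μ i → wire μ (wire⁻¹ μ i) ≡ i
wire-wire⁻¹ μ i = Finₚ.toℕ-injective (begin
  toℕ (wire μ (wire⁻¹ μ i))          ≡⟨ Finₚ.toℕ-fromℕ< _ ⟩
  fromBits (toBits μ (toℕ i)) % 2 ^ μ ≡⟨ cong (_% 2 ^ μ) (fromBits-toBits μ (toℕ i) (Finₚ.toℕ<n i)) ⟩
  toℕ i % 2 ^ μ                      ≡⟨ m<n⇒m%n≡m (Finₚ.toℕ<n i) ⟩
  toℕ i                              ∎)
  where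
  open ≡-Reasoning
  instance
    2^μ≢0 : NonZero (2 ^ μ)
    2^μ≢0 = ℕₚ.m^n≢0 2 μ

-- The first bit marks a constant function, whose value is the second bit.
-- Equal indices make a gate a no-op, so that circuits with fewer than 4^μ gates can be padded.
code : ℕ → ℕ → U
code l μ = bit ⊗ bit ⊗ vec (vec bit μ ⊗ vec bit μ) (2 ^ μ * 2 ^ μ) ⊗ vec (vec bit l ⊗ bit) (2 ^ μ) ⊗ vec bit μ

wirePair : ∀ μ → Vec Bool μ × Vec Bool μ → Fin (2 ^ μ) × Fin (2 ^ μ)
wirePair μ (p , q) = wire μ p , wire μ q

codeCirc : ∀ {l} μ {k} → Vec (Vec Bool μ × Vec Bool μ) k → Vec (Vec Bool l × Bool) (2 ^ μ) → Vec Bool μ →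
           Circ (Vec Bool l) (2 ^ μ)
codeCirc μ gs ls o = record
  { label = lookup ls ; gates = Data.Vec.toList (Data.Vec.map (wirePair μ) gs) ; out = wire μ o }

evalCode : ∀ l μ → El (code l μ) → (Vec Bool l → Bool) → Bool
evalCode l μ (true  , c , gs , ls , o) a = c
evalCode l μ (false , c , gs , ls , o) a = eval (codeCirc μ gs ls o) a

-- What a circuit sees when one bucket B varies: the bits σ under test, translated by x, inside B,
-- and the fixed assignment f outside.
overlay : ∀ {V : Set} → (B x σ f : V → Bool) → V → Bool
overlay B x σ f v = if B v then x v xor σ v else f v

encodeGates : ∀ μ {k} (gs : List (Fin (2 ^ μ) × Fin (2 ^ μ))) → Fin (2 ^ μ) → length gs ≤ k →
              Σ (Vec (Vec Bool μ × Vec Bool μ) k) λ v →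
                ∀ w → run w (Data.Vec.toList (Data.Vec.map (wirePair μ) v)) ≡ run w gs
encodeGates μ {zero}  []       o h = [] , λ w → refl
encodeGates μ {suc k} []       o h = ((wire⁻¹ μ o , wire⁻¹ μ o) ∷ proj₁ rest) , λ w →
  trans (proj₂ rest (step w (wire μ (wire⁻¹ μ o) , wire μ (wire⁻¹ μ o)))) (step-diagonal w (wire μ (wire⁻¹ μ o)))
  where rest = encodeGates μ {k} [] o z≤n
encodeGates μ {suc k} ((p , q) ∷ gs) o (s≤s h) = ((wire⁻¹ μ p , wire⁻¹ μ q) ∷ proj₁ rest) , λ w →
  trans (proj₂ rest (step w (wire μ (wire⁻¹ μ p) , wire μ (wire⁻¹ μ q))))
        (cong₂ (λ p q → run (step w (p , q)) gs) (wire-wire⁻¹ μ p) (wire-wire⁻¹ μ q))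
  where rest = encodeGates μ {k} gs o h

noOrder : ∀ m → Order m
noOrder m = Data.Vec.replicate m (Data.Vec.replicate m false)

entry-noOrder : ∀ {m} (p q : Fin m) → entry (noOrder m) p q ≡ false
entry-noOrder {m} p q =
  trans (cong (λ r → lookup r q) (Vecₚ.lookup-replicate p (Data.Vec.replicate m false))) (Vecₚ.lookup-replicate q false)

-- Wires outside B become constants, the translation v goes into the signs, and `simulate`, started
-- without any known comparison, leaves at most 4^μ gates. The code length depends on neither ℓ nor
-- the number of gates of c.
restrict : ∀ {l ℓ} μ (c : Circ (Vec Bool l) ℓ) (B v f : Vec Bool l → Bool) →
           count (λ i → B (proj₁ (Circ.label c i))) ≤ 2 ^ μ →
           Σ (El (code l μ)) λ d → ∀ s →
             eval c (overlay B v s f) ≡ evalCode l μ d s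
restrict {l} {ℓ} μ c B v f few = finish (proj₁ (proj₂ sim)) refl
  where
  open Circ c
  m = 2 ^ μ
  alive : Fin ℓ → Bool
  alive i = B (proj₁ (label i))
  fixed : Fin ℓ → Bool
  fixed i = f (proj₁ (label i)) xor proj₂ (label i)
  shifted : Fin ℓ → Vec Bool l × Bool
  shifted i = proj₁ (label i) , (v (proj₁ (label i)) xor proj₂ (label i))
  renaming′ = rename m alive fixed shifted (Data.Vec.replicate l false , false) few
  τ = proj₁ renaming′
  lab′ = proj₁ (proj₂ renaming′)
  sim = simulate out gates τ (noOrder m) (proj₁ (proj₂ (proj₂ renaming′))) (λ p → entry-noOrder p p)
  gs′ = proj₁ sim
  mixed : (Vec Bool l → Bool) → Vec Bool l → Bool
  mixed s = overlay B v s f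
  start : (Vec Bool l → Bool) → Vec Bool ℓ
  start s = Data.Vec.tabulate (literal (mixed s) ∘ label)
  start′ : (Vec Bool l → Bool) → Vec Bool m
  start′ s = Data.Vec.tabulate (literal s ∘ lab′)
  represents : ∀ s → Represents τ (start s) (start′ s)
  represents s k with proj₂ (proj₂ (proj₂ renaming′)) k
  ... | inj₁ (a , p , e , e′) = begin
    lookup (start s) k                    ≡⟨ Vecₚ.lookup∘tabulate (literal (mixed s) ∘ label) k ⟩
    (if B x then v x xor s x else f x) xor sgn ≡⟨ cong (λ b → (if b then v x xor s x else f x) xor sgn) a ⟩
    (v x xor s x) xor sgn                 ≡⟨ cong (_xor sgn) (𝔹ₚ.xor-comm (v x) (s x)) ⟩
    (s x xor v x) xor sgn                 ≡⟨ 𝔹ₚ.xor-assoc (s x) (v x) sgn ⟩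
    literal s (shifted k)                 ≡⟨ cong (literal s) e′ ⟨
    literal s (lab′ p)                    ≡⟨ Vecₚ.lookup∘tabulate (literal s ∘ lab′) p ⟨
    lookup (start′ s) p                   ≡⟨ cong (λ t → value t (start′ s)) e ⟨
    value (τ k) (start′ s)                ∎
    where
    open ≡-Reasoning
    x = proj₁ (label k)
    sgn = proj₂ (label k)
  ... | inj₂ (a , e) = begin
    lookup (start s) k                    ≡⟨ Vecₚ.lookup∘tabulate (literal (mixed s) ∘ label) k ⟩
    (if B x then v x xor s x else f x) xor sgn ≡⟨ cong (λ b → (if b then v x xor s x else f x) xor sgn) a ⟩
    fixed k                               ≡⟨ cong (λ t → value t (start′ s)) e ⟨
    value (τ k) (start′ s)                ∎
    where
    open ≡-Reasoning
    x = proj₁ (label k)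
    sgn = proj₂ (label k)
  correct : ∀ s → eval c (mixed s) ≡ value (proj₁ (proj₂ sim)) (run (start′ s) gs′)
  correct s = trans (eval-unfold c (mixed s)) (proj₂ (proj₂ (proj₂ sim)) (start s) (start′ s) (represents s)
    λ p q e → ⊥-elim (false≢true (trans (sym (entry-noOrder p q)) e)))
  finish : ∀ o′ → proj₁ (proj₂ sim) ≡ o′ →
           Σ (El (code l μ)) λ d → ∀ s → eval c (mixed s) ≡ evalCode l μ d s
  finish (inj₂ b) e = (true , b , ⊞-0 _) ,
    λ s → trans (correct s) (cong (λ t → value t (run (start′ s) gs′)) e)
  finish (inj₁ p) e = (false , false , proj₁ enc , Data.Vec.tabulate lab′ , wire⁻¹ μ p) , λ s → begin
      eval c (mixed s)                                ≡⟨ correct s ⟩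
      value (proj₁ (proj₂ sim)) (run (start′ s) gs′)  ≡⟨ cong (λ t → value t (run (start′ s) gs′)) e ⟩
      lookup (run (start′ s) gs′) p                   ≡⟨ cong (λ w → lookup w p) (proj₂ enc (start′ s)) ⟨
      lookup (run (start′ s) gates′) p
        ≡⟨ cong₂ (λ w p → lookup (run w gates′) p)
             (Vecₚ.tabulate-cong λ i → cong (literal s) (Vecₚ.lookup∘tabulate lab′ i)) (wire-wire⁻¹ μ p) ⟨
      lookup (run (Data.Vec.tabulate (literal s ∘ lookup (Data.Vec.tabulate lab′))) gates′) (wire μ (wire⁻¹ μ p))
        ≡⟨ eval-unfold (codeCirc μ (proj₁ enc) (Data.Vec.tabulate lab′) (wire⁻¹ μ p)) s ⟨
      evalCode l μ (false , false , proj₁ enc , Data.Vec.tabulate lab′ , wire⁻¹ μ p) s ∎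
    where
    open ≡-Reasoning
    enc = encodeGates μ gs′ p (ℕₚ.≤-trans (ℕₚ.m≤m+n (length gs′) ∣ noOrder m ∣ᴷ) (proj₁ (proj₂ (proj₂ sim))))
    gates′ = Data.Vec.toList (Data.Vec.map (wirePair μ) (proj₁ enc))

-- Hashing

fromℕ : ℕ → ℚ
fromℕ zero    = 0ℚ
fromℕ (suc n) = 1ℚ +ℚ fromℕ n

fromℕ-+ : ∀ m n → fromℕ (m + n) ≡ fromℕ m +ℚ fromℕ n
fromℕ-+ zero    n = sym (ℚₚ.+-identityˡ (fromℕ n))
fromℕ-+ (suc m) n = trans (cong (1ℚ +ℚ_) (fromℕ-+ m n)) (sym (ℚₚ.+-assoc 1ℚ (fromℕ m) (fromℕ n)))

fromℕ-* : ∀ m n → fromℕ (m * n) ≡ fromℕ m *ℚ fromℕ n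
fromℕ-* zero    n = sym (ℚₚ.*-zeroˡ (fromℕ n))
fromℕ-* (suc m) n = trans (fromℕ-+ n (m * n)) (trans (cong (fromℕ n +ℚ_) (fromℕ-* m n))
  (solve 2 (λ x y → y :+ x :* y := (con 1ℚ :+ x) :* y) refl (fromℕ m) (fromℕ n)))

0≤fromℕ : ∀ n → 0ℚ ≤ℚ fromℕ n
0≤fromℕ zero    = ℚₚ.≤-refl
0≤fromℕ (suc n) = ℚₚ.+-mono-≤ {0ℚ} {1ℚ} {0ℚ} (ℚₚ.nonNegative⁻¹ 1ℚ) (0≤fromℕ n)

fromℕ-mono : ∀ {m n} → m ≤ n → fromℕ m ≤ℚ fromℕ n
fromℕ-mono {n = n} z≤n = 0≤fromℕ n
fromℕ-mono (s≤s h)     = ℚₚ.+-monoʳ-≤ 1ℚ (fromℕ-mono h)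

fromℕ-2^ : ∀ n → fromℕ (2 ^ n) ≡ p2 n
fromℕ-2^ zero    = refl
fromℕ-2^ (suc n) = trans (fromℕ-+ (2 ^ n) (2 ^ n + 0)) (cong₂ _+ℚ_ (fromℕ-2^ n)
  (trans (cong fromℕ (ℕₚ.+-identityʳ (2 ^ n))) (fromℕ-2^ n)))

eqV : ∀ {b} → Vec Bool b → Vec Bool b → Bool
eqV []       []       = true
eqV (x ∷ xs) (y ∷ ys) = not (x xor y) ∧ eqV xs ys

eqV-refl : ∀ {b} (x : Vec Bool b) → eqV x x ≡ true
eqV-refl []          = refl
eqV-refl (true ∷ x)  = eqV-refl x
eqV-refl (false ∷ x) = eqV-refl x

eqV⇒≡ : ∀ {b} (x y : Vec Bool b) → eqV x y ≡ true → x ≡ y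
eqV⇒≡ []          []          _ = refl
eqV⇒≡ (true ∷ x)  (true ∷ y)  e = cong (true ∷_) (eqV⇒≡ x y e)
eqV⇒≡ (false ∷ x) (false ∷ y) e = cong (false ∷_) (eqV⇒≡ x y e)

dot : ∀ {l} → Vec Bool l → Vec Bool l → Bool
dot []       []       = false
dot (a ∷ as) (x ∷ xs) = (a ∧ x) xor dot as xs

-- A linear map over the field with two elements; its rows are the key.
hash : ∀ {l b} → Vec (Vec Bool l) b → Vec Bool l → Vec Bool b
hash []      v = []
hash (a ∷ A) v = dot a v ∷ hash A v

ind-∧ : ∀ a b → ind (a ∧ b) ≡ ind a *ℚ ind b
ind-∧ true  b = sym (ℚₚ.*-identityˡ (ind b))
ind-∧ false b = sym (ℚₚ.*-zeroˡ (ind b))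

-- Where u and v differ, flipping that bit of a exchanges collision and non-collision; where they
-- agree, the bit does not affect the comparison.
dot-collision : ∀ {l} (u v : Vec Bool l) → u ≢ v →
                (𝔼 (vec bit l) λ a → ind (not (dot a u xor dot a v))) ≡ ½
dot-collision []          []          u≢v = ⊥-elim (u≢v refl)
dot-collision {suc l} (false ∷ u) (false ∷ v) u≢v =
  trans (𝔼-const bit _) (dot-collision u v (u≢v ∘ cong (false ∷_)))
dot-collision {suc l} (true ∷ u)  (true ∷ v)  u≢v =
  trans (cong (λ e → ½ *ℚ (E +ℚ e)) (𝔼-cong (vec bit l) λ a → cong (ind ∘ not) (not-xor-not (dot a u) (dot a v))))
        (trans (𝔼-const bit E) (dot-collision u v (u≢v ∘ cong (true ∷_))))
  where
  E = 𝔼 (vec bit l) λ a → ind (not (dot a u xor dot a v))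
  not-xor-not : ∀ x y → not x xor not y ≡ x xor y
  not-xor-not true  y = refl
  not-xor-not false y = 𝔹ₚ.not-involutive y
dot-collision {suc l} (true ∷ u)  (false ∷ v) _ =
  cong (½ *ℚ_) (trans (sym (𝔼-+ (vec bit l) (λ a → ind (not (dot a u xor dot a v))) (λ a → ind (not (not (dot a u) xor dot a v)))))
    (trans (𝔼-cong (vec bit l) λ a → total (dot a u) (dot a v)) (𝔼-const (vec bit l) 1ℚ)))
  where
  total : ∀ x y → ind (not (x xor y)) +ℚ ind (not (not x xor y)) ≡ 1ℚ
  total true  true  = refl
  total true  false = refl
  total false true  = refl
  total false false = refl
dot-collision {suc l} (false ∷ u) (true ∷ v)  _ =
  cong (½ *ℚ_) (trans (sym (𝔼-+ (vec bit l) (λ a → ind (not (dot a u xor dot a v))) (λ a → ind (not (dot a u xor not (dot a v))))))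
    (trans (𝔼-cong (vec bit l) λ a → total (dot a u) (dot a v)) (𝔼-const (vec bit l) 1ℚ)))
  where
  total : ∀ x y → ind (not (x xor y)) +ℚ ind (not (x xor not y)) ≡ 1ℚ
  total true  true  = refl
  total true  false = refl
  total false true  = refl
  total false false = refl

hash-collision : ∀ {l} b (u v : Vec Bool l) → u ≢ v →
                 (𝔼 (vec (vec bit l) b) λ A → ind (eqV (hash A u) (hash A v))) ≡ ½^ b
hash-collision zero    u v u≢v = refl
hash-collision {l} (suc b) u v u≢v =
  trans (𝔼-cong (vec bit l) λ a → 𝔼-cong (vec (vec bit l) b) λ A → ind-∧ (not (dot a u xor dot a v)) (eqV (hash A u) (hash A v)))
  (trans (𝔼-product (vec bit l) (vec (vec bit l) b) (λ a → ind (not (dot a u xor dot a v))) (λ A → ind (eqV (hash A u) (hash A v))))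
         (cong₂ _*ℚ_ (dot-collision u v u≢v) (hash-collision b u v u≢v)))

𝔼-count : ∀ u {M} (f : El u → Fin M → Bool) δ → (∀ i → (𝔼 u λ x → ind (f x i)) ≤ℚ δ) →
          (𝔼 u λ x → fromℕ (count (f x))) ≤ℚ fromℕ M *ℚ δ
𝔼-count u {zero}  f δ h = ℚₚ.≤-reflexive (trans (𝔼-const u 0ℚ) (sym (ℚₚ.*-zeroˡ δ)))
𝔼-count u {suc M} f δ h = begin
  (𝔼 u λ x → fromℕ (toℕᵇ (f x zero) + count (f x ∘ suc)))
    ≡⟨ 𝔼-cong u (λ x → trans (fromℕ-+ (toℕᵇ (f x zero)) _) (cong (_+ℚ fromℕ (count (f x ∘ suc))) (fromℕ-toℕᵇ (f x zero)))) ⟩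
  (𝔼 u λ x → ind (f x zero) +ℚ fromℕ (count (f x ∘ suc)))
    ≡⟨ 𝔼-+ u (λ x → ind (f x zero)) (λ x → fromℕ (count (f x ∘ suc))) ⟩
  (𝔼 u λ x → ind (f x zero)) +ℚ (𝔼 u λ x → fromℕ (count (f x ∘ suc)))
    ≤⟨ ℚₚ.+-mono-≤ (h zero) (𝔼-count u (λ x → f x ∘ suc) δ (h ∘ suc)) ⟩
  δ +ℚ fromℕ M *ℚ δ
    ≡⟨ solve 2 (λ δ m → δ :+ m :* δ := (con 1ℚ :+ m) :* δ) refl δ (fromℕ M) ⟩
  fromℕ (suc M) *ℚ δ ∎
  where
  open ℚₚ.≤-Reasoning
  fromℕ-toℕᵇ : ∀ b → fromℕ (toℕᵇ b) ≡ ind b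
  fromℕ-toℕᵇ true  = refl
  fromℕ-toℕᵇ false = refl

count-mono : ∀ {M} {f g : Fin M → Bool} → (∀ i → f i ≡ true → g i ≡ true) → count f ≤ count g
count-mono {zero}          h = z≤n
count-mono {suc M} {f} {g} h = ℕₚ.+-mono-≤ (at (f zero) (g zero) (h zero)) (count-mono (h ∘ suc))
  where
  at : ∀ a b → (a ≡ true → b ≡ true) → toℕᵇ a ≤ toℕᵇ b
  at true  b h = ℕₚ.≤-reflexive (cong toℕᵇ (sym (h refl)))
  at false b h = z≤n

count-split : ∀ {M} (f g : Fin M → Bool) → count f ≤ count (λ i → not (g i) ∧ f i) + count g
count-split {zero}  f g = z≤n
count-split {suc M} f g = ℕₚ.≤-trans (ℕₚ.+-mono-≤ (at (f zero) (g zero)) (count-split (f ∘ suc) (g ∘ suc)))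
  (ℕₚ.≤-reflexive (interchange (toℕᵇ (not (g zero) ∧ f zero)) (toℕᵇ (g zero)) _ _))
  where
  at : ∀ a b → toℕᵇ a ≤ toℕᵇ (not b ∧ a) + toℕᵇ b
  at true  true  = ℕₚ.≤-refl
  at true  false = ℕₚ.≤-refl
  at false b     = z≤n

others : ∀ {l b M} → Circ (Vec Bool l) M → Vec (Vec Bool l) b → Vec Bool l → ℕ
others c A v = count λ i → not (eqV (var i) v) ∧ eqV (hash A (var i)) (hash A v)
  where var = proj₁ ∘ Circ.label c

occurrences : ∀ {l M} → Circ (Vec Bool l) M → Vec Bool l → ℕ
occurrences c v = count λ i → eqV (proj₁ (Circ.label c i)) v

-- Half of the 2^μ wires allowed in a bucket is granted to variables other than v; the other half is
-- kept for a light v itself.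
crowded : ∀ {l b M} → ℕ → Circ (Vec Bool l) M → Vec (Vec Bool l) b → Vec Bool l → Bool
crowded μ c A v = not ⌊ 2 * others c A v ≤? 2 ^ μ ⌋

-- Markov: the expected number of foreign wires is at most M/2^b ≤ 2^μ/4, half of the threshold
-- 2^μ/2. This is the origin of the 4.
crowded-rare : ∀ {l M} b μ (c : Circ (Vec Bool l) M) v → 4 * M ≤ 2 ^ μ * 2 ^ b →
               (𝔼 (vec (vec bit l) b) λ A → ind (crowded μ c A v)) ≤ℚ ½
crowded-rare {l} {M} b μ c v 4M≤ = begin
  E (ind ∘ bad)                             ≡⟨ ℚₚ.*-identityˡ _ ⟨
  1ℚ *ℚ E (ind ∘ bad)                       ≡⟨ cong (_*ℚ E (ind ∘ bad)) (trans (ℚₚ.*-comm (½^ μ) (p2 μ)) (p2-½^ μ)) ⟨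
  (½^ μ *ℚ p2 μ) *ℚ E (ind ∘ bad)           ≡⟨ ℚₚ.*-assoc (½^ μ) (p2 μ) _ ⟩
  ½^ μ *ℚ (p2 μ *ℚ E (ind ∘ bad))           ≤⟨ mul μ markov ⟩
  ½^ μ *ℚ (p2 1 *ℚ (fromℕ M *ℚ ½^ b))
    ≡⟨ solve 3 (λ x m y → x :* (con (p2 1) :* (m :* y)) := con ½ :* ((x :* y) :* (con (p2 2) :* m))) refl (½^ μ) (fromℕ M) (½^ b) ⟩
  ½ *ℚ ((½^ μ *ℚ ½^ b) *ℚ (p2 2 *ℚ fromℕ M))
    ≤⟨ ℚₚ.*-monoˡ-≤-nonNeg ½ (ℚₚ.*-monoˡ-≤-nonNeg (½^ μ *ℚ ½^ b) {{nonNegative (0≤* (0≤½^ μ) (0≤½^ b))}} four) ⟩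
  ½ *ℚ ((½^ μ *ℚ ½^ b) *ℚ (p2 μ *ℚ p2 b))
    ≡⟨ cong (½ *ℚ_) (solve 4 (λ a b c d → (a :* b) :* (c :* d) := (c :* a) :* (d :* b)) refl (½^ μ) (½^ b) (p2 μ) (p2 b)) ⟩
  ½ *ℚ ((p2 μ *ℚ ½^ μ) *ℚ (p2 b *ℚ ½^ b))   ≡⟨ cong₂ (λ x y → ½ *ℚ (x *ℚ y)) (p2-½^ μ) (p2-½^ b) ⟩
  ½                                         ∎
  where
  open ℚₚ.≤-Reasoning
  H = vec (vec bit l) b
  E : (El H → ℚ) → ℚ
  E = 𝔼 H
  bad : El H → Bool
  bad A = crowded μ c A v
  mul : ∀ k {x y} → x ≤ℚ y → ½^ k *ℚ x ≤ℚ ½^ k *ℚ y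
  mul k = ℚₚ.*-monoˡ-≤-nonNeg (½^ k) {{nonNegative (0≤½^ k)}}
  four : p2 2 *ℚ fromℕ M ≤ℚ p2 μ *ℚ p2 b
  four = subst₂ _≤ℚ_ (fromℕ-* 4 M) (trans (fromℕ-* (2 ^ μ) (2 ^ b)) (cong₂ _*ℚ_ (fromℕ-2^ μ) (fromℕ-2^ b))) (fromℕ-mono 4M≤)
  pointwise : ∀ A → p2 μ *ℚ ind (bad A) ≤ℚ p2 1 *ℚ fromℕ (others c A v)
  pointwise A with 2 * others c A v ≤? 2 ^ μ
  ... | yes _ = subst (_≤ℚ p2 1 *ℚ fromℕ (others c A v)) (sym (ℚₚ.*-zeroʳ (p2 μ))) (0≤* (0≤p2 1) (0≤fromℕ (others c A v)))
  ... | no ¬h = subst₂ _≤ℚ_ (trans (fromℕ-2^ μ) (sym (ℚₚ.*-identityʳ (p2 μ)))) (fromℕ-* 2 (others c A v))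
                  (fromℕ-mono (ℕₚ.<⇒≤ (ℕₚ.≰⇒> ¬h)))
  collide : ∀ i → (E λ A → ind (not (eqV (proj₁ (Circ.label c i)) v) ∧ eqV (hash A (proj₁ (Circ.label c i))) (hash A v))) ≤ℚ ½^ b
  collide i with eqV (proj₁ (Circ.label c i)) v in eq
  ... | true  = subst (_≤ℚ ½^ b) (sym (𝔼-const H 0ℚ)) (0≤½^ b)
  ... | false = ℚₚ.≤-reflexive (hash-collision b (proj₁ (Circ.label c i)) v
                  λ { refl → false≢true (trans (sym eq) (eqV-refl (proj₁ (Circ.label c i)))) })
  markov : p2 μ *ℚ E (ind ∘ bad) ≤ℚ p2 1 *ℚ (fromℕ M *ℚ ½^ b)
  markov = begin
    p2 μ *ℚ E (ind ∘ bad)                    ≡⟨ 𝔼-* H (p2 μ) (ind ∘ bad) ⟨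
    (E λ A → p2 μ *ℚ ind (bad A))            ≤⟨ 𝔼-mono H pointwise ⟩
    (E λ A → p2 1 *ℚ fromℕ (others c A v))   ≡⟨ 𝔼-* H (p2 1) (λ A → fromℕ (others c A v)) ⟩
    p2 1 *ℚ (E λ A → fromℕ (others c A v))   ≤⟨ ℚₚ.*-monoˡ-≤-nonNeg (p2 1) (𝔼-count H _ (½^ b) collide) ⟩
    p2 1 *ℚ (fromℕ M *ℚ ½^ b)                ∎

-- A product of indicators, so that independence of the hash functions becomes `𝔼-product`.
allCrowded : ∀ {l b q M} → ℕ → Circ (Vec Bool l) M → Vec (Vec (Vec Bool l) b) q → Vec Bool l → ℚ
allCrowded μ c []       v = 1ℚ
allCrowded μ c (A ∷ As) v = ind (crowded μ c A v) *ℚ allCrowded μ c As v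

0≤allCrowded : ∀ {l b q M} μ (c : Circ (Vec Bool l) M) (As : Vec (Vec (Vec Bool l) b) q) v → 0ℚ ≤ℚ allCrowded μ c As v
0≤allCrowded μ c []       v = ℚₚ.nonNegative⁻¹ 1ℚ
0≤allCrowded μ c (A ∷ As) v = 0≤* (0≤ind (crowded μ c A v)) (0≤allCrowded μ c As v)

allCrowded-rare : ∀ {l M} b μ q (c : Circ (Vec Bool l) M) v → 4 * M ≤ 2 ^ μ * 2 ^ b →
                  (𝔼 (vec (vec (vec bit l) b) q) λ As → allCrowded μ c As v) ≤ℚ ½^ q
allCrowded-rare b μ zero    c v 4M≤ = ℚₚ.≤-refl
allCrowded-rare {l} b μ (suc q) c v 4M≤ = ℚₚ.≤-trans
  (ℚₚ.≤-reflexive (𝔼-product H (vec H q) (λ A → ind (crowded μ c A v)) (λ As → allCrowded μ c As v)))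
  (*-mono-≤ℚ (𝔼-bounded-below H λ A → 0≤ind (crowded μ c A v)) (0≤½^ q)
    (crowded-rare b μ c v 4M≤) (allCrowded-rare b μ q c v 4M≤))
  where H = vec (vec bit l) b

sumList : ∀ {A : Set} → (A → ℚ) → List A → ℚ
sumList f []       = 0ℚ
sumList f (x ∷ xs) = f x +ℚ sumList f xs

0≤sumList : ∀ {A : Set} {f : A → ℚ} → (∀ x → 0ℚ ≤ℚ f x) → ∀ xs → 0ℚ ≤ℚ sumList f xs
0≤sumList f≥0 []       = ℚₚ.≤-refl
0≤sumList f≥0 (x ∷ xs) = ℚₚ.+-mono-≤ {0ℚ} {_} {0ℚ} (f≥0 x) (0≤sumList f≥0 xs)

everyVec : ∀ l → List (Vec Bool l)
everyVec zero    = [] ∷ []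
everyVec (suc l) = Data.List.map (false ∷_) (everyVec l) ++ Data.List.map (true ∷_) (everyVec l)

∈-everyVec : ∀ {l} (v : Vec Bool l) → v ∈ everyVec l
∈-everyVec []          = here refl
∈-everyVec (false ∷ v) = ∈-++⁺ˡ (∈-map⁺ (false ∷_) (∈-everyVec v))
∈-everyVec (true ∷ v)  = ∈-++⁺ʳ _ (∈-map⁺ (true ∷_) (∈-everyVec v))

length-everyVec : ∀ l → fromℕ (length (everyVec l)) ≡ p2 l
length-everyVec zero    = refl
length-everyVec (suc l) = trans (cong fromℕ (Listₚ.length-++ (Data.List.map (false ∷_) (everyVec l))))
  (trans (fromℕ-+ (length (Data.List.map (false ∷_) (everyVec l))) _) (cong₂ _+ℚ_
    (trans (cong fromℕ (Listₚ.length-map (false ∷_) (everyVec l))) (length-everyVec l))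
    (trans (cong fromℕ (Listₚ.length-map (true ∷_) (everyVec l))) (length-everyVec l))))

𝔼-sumList : ∀ u {A : Set} (f : El u → A → ℚ) δ → (∀ a → (𝔼 u λ x → f x a) ≤ℚ δ) → ∀ as →
            (𝔼 u λ x → sumList (f x) as) ≤ℚ fromℕ (length as) *ℚ δ
𝔼-sumList u f δ h []       = ℚₚ.≤-reflexive (trans (𝔼-const u 0ℚ) (sym (ℚₚ.*-zeroˡ δ)))
𝔼-sumList u f δ h (a ∷ as) = ℚₚ.≤-trans (ℚₚ.≤-reflexive (𝔼-+ u (λ x → f x a) (λ x → sumList (f x) as)))
  (ℚₚ.≤-trans (ℚₚ.+-mono-≤ (h a) (𝔼-sumList u f δ h as))
    (ℚₚ.≤-reflexive (solve 2 (λ δ m → δ :+ m :* δ := (con 1ℚ :+ m) :* δ) refl δ (fromℕ (length as)))))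

-- Pointwise form of the union bound: where some variable is crowded everywhere, the sum reaches 1
-- and so covers any difference of probabilities. It can serve as an error term for every choice of
-- hash functions.
uncrowded⊎1≤ : ∀ {l b q M} μ (c : Circ (Vec Bool l) M) (As : Vec (Vec (Vec Bool l) b) q) vs →
               (∀ {v} → v ∈ vs → Σ (Fin q) λ k → 2 * others c (lookup As k) v ≤ 2 ^ μ) ⊎
               (1ℚ ≤ℚ sumList (allCrowded μ c As) vs)
uncrowded⊎1≤ μ c As [] = inj₁ λ ()
uncrowded⊎1≤ {l} {b} {q} μ c As (v ∷ vs) with single As | uncrowded⊎1≤ μ c As vs
  where
  single : ∀ {q} (As : Vec (Vec (Vec Bool l) b) q) →
           (Σ (Fin q) λ k → 2 * others c (lookup As k) v ≤ 2 ^ μ) ⊎ (allCrowded μ c As v ≡ 1ℚ)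
  single []       = inj₂ refl
  single (A ∷ As) with 2 * others c A v ≤? 2 ^ μ
  ... | yes h = inj₁ (zero , h)
  ... | no _ with single As
  ... | inj₁ (k , h) = inj₁ (suc k , h)
  ... | inj₂ e       = inj₂ (trans (ℚₚ.*-identityˡ _) e)
... | inj₁ k | inj₁ ks = inj₁ λ { (here refl) → k ; (there v∈) → ks v∈ }
... | inj₂ e | _ = inj₂ (subst (_≤ℚ allCrowded μ c As v +ℚ sumList (allCrowded μ c As) vs)
      (trans (ℚₚ.+-identityʳ _) e) (ℚₚ.+-monoʳ-≤ (allCrowded μ c As v) (0≤sumList (0≤allCrowded μ c As) vs)))
... | inj₁ _ | inj₂ 1≤ = inj₂ (ℚₚ.≤-trans 1≤ (subst (_≤ℚ allCrowded μ c As v +ℚ sumList (allCrowded μ c As) vs)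
      (ℚₚ.+-identityˡ _) (ℚₚ.+-monoˡ-≤ (sumList (allCrowded μ c As) vs) (0≤allCrowded μ c As v))))

-- The hybrid argument

FoolsClass : ∀ l μ (I : U) → (El I → Vec Bool l → Bool) → ℚ → Set
FoolsClass l μ I s ε = ∀ d → Close ε (𝔼 I λ y → ind (evalCode l μ d (s y)))
                                     (𝔼 (table bit l) λ a → ind (evalCode l μ d (get bit a)))

-- The extra bit makes each single output bit exactly uniform, whatever s does; this serves a
-- variable that labels too many wires for the gadget.
flip : ∀ {l} I → (El I → Vec Bool l → Bool) → El (I ⊗ bit) → Vec Bool l → Bool
flip I s (y , t) v = s y v xor t

layers : ∀ {l b q} J → (El J → Vec Bool l → Bool) → Vec (Vec (Vec Bool l) b) q → Vec (El (table J b)) q → Vec Bool l → Bool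
layers J s []       []       v = false
layers J s (A ∷ As) (t ∷ ts) v = s (get J t (hash A v)) v xor layers J s As ts v

-- A hybrid assignment: R holds the variables whose values are still pseudorandom.
mix : ∀ {l} → (Vec Bool l → Bool) → (Vec Bool l → Bool) → El (table bit l) → Vec Bool l → Bool
mix R x u v = if R v then x v else get bit u v

mixTable : ∀ l → (Vec Bool l → Bool) → (Vec Bool l → Bool) → El (table bit l) → El (table bit l) → El (table bit l)
mixTable zero    B x a u = if B [] then x [] xor a else u
mixTable (suc l) B x (a , a′) (u , u′) =
  mixTable l (B ∘ (false ∷_)) (x ∘ (false ∷_)) a u , mixTable l (B ∘ (true ∷_)) (x ∘ (true ∷_)) a′ u′

get-mixTable : ∀ {l} B x a u (v : Vec Bool l) →
               get bit (mixTable l B x a u) v ≡ (if B v then x v xor get bit a v else get bit u v)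
get-mixTable B x a u []          = refl
get-mixTable B x (a , _) (u , _) (false ∷ v) = get-mixTable (B ∘ (false ∷_)) (x ∘ (false ∷_)) a u v
get-mixTable B x (_ , a) (_ , u) (true ∷ v)  = get-mixTable (B ∘ (true ∷_)) (x ∘ (true ∷_)) a u v

-- Leaf by leaf: an entry is either a translated fresh bit or an entry of u, hence uniform in both
-- cases.
𝔼-mixTable : ∀ l B x (f : El (table bit l) → ℚ) →
             (𝔼 (table bit l) λ u → 𝔼 (table bit l) λ a → f (mixTable l B x a u)) ≡ 𝔼 (table bit l) f
𝔼-mixTable zero B x f with B []
... | false = 𝔼-cong bit λ u → 𝔼-const bit (f u)
... | true  = trans (𝔼-const bit (𝔼 bit λ a → f (x [] xor a)))
                    (trans (𝔼-cong bit λ a → cong f (𝔹ₚ.xor-comm (x []) a)) (𝔼-shift bit (x []) f))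
𝔼-mixTable (suc l) B x f = begin
  (𝔼 T λ u → 𝔼 T λ u′ → 𝔼 T λ a → 𝔼 T λ a′ → f (m a u , m′ a′ u′))
    ≡⟨ 𝔼-cong T (λ u → 𝔼-swap T T (λ u′ a → 𝔼 T λ a′ → f (m a u , m′ a′ u′))) ⟩
  (𝔼 T λ u → 𝔼 T λ a → 𝔼 T λ u′ → 𝔼 T λ a′ → f (m a u , m′ a′ u′))
    ≡⟨ 𝔼-cong T (λ u → 𝔼-cong T λ a → 𝔼-mixTable l (B ∘ (true ∷_)) (x ∘ (true ∷_)) (λ w → f (m a u , w))) ⟩
  (𝔼 T λ u → 𝔼 T λ a → 𝔼 T λ w → f (m a u , w))
    ≡⟨ 𝔼-mixTable l (B ∘ (false ∷_)) (x ∘ (false ∷_)) (λ w → 𝔼 T λ w′ → f (w , w′)) ⟩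
  𝔼 (T ⊗ T) f ∎
  where
  open ≡-Reasoning
  T = table bit l
  m  = mixTable l (B ∘ (false ∷_)) (x ∘ (false ∷_))
  m′ = mixTable l (B ∘ (true ∷_)) (x ∘ (true ∷_))

constTable : ∀ l → Bool → El (table bit l)
constTable zero    t = t
constTable (suc l) t = constTable l t , constTable l t

get-shift : ∀ {l} (a : El (table bit l)) t (v : Vec Bool l) →
            get bit (_⊞_ {table bit l} a (constTable l t)) v ≡ get bit a v xor t
get-shift a       t []          = refl
get-shift (a , _) t (false ∷ v) = get-shift a t v
get-shift (_ , a) t (true ∷ v)  = get-shift a t v

𝔼-get : ∀ u {b} (v : Vec Bool b) (f : El u → ℚ) → (𝔼 (table u b) λ t → f (get u t v)) ≡ 𝔼 u f
𝔼-get u {b} v f = trans (𝔼-resample u v (λ t → f (get u t v)))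
  (trans (𝔼-cong (table u b) λ t → 𝔼-cong u λ y → cong f (get-set u t v y)) (𝔼-const (table u b) (𝔼 u f)))

redraw : ∀ {b q} J → Vec (El (table J b)) q → Fin q → Vec Bool b → El J → Vec (El (table J b)) q
redraw J ts k w y = ts [ k ]≔ set J (lookup ts k) w y

𝔼-redraw : ∀ {b q} J (k : Fin q) (w : Vec Bool b) (f : Vec (El (table J b)) q → ℚ) →
           𝔼 (vec (table J b) q) f ≡ 𝔼 (vec (table J b) q) λ ts → 𝔼 J λ y → f (redraw J ts k w y)
𝔼-redraw {b} {q} J k w f = begin
  𝔼 (vec T q) f
    ≡⟨ 𝔼-resample-vec T k f ⟩
  (𝔼 (vec T q) λ ts → 𝔼 T λ t → f (ts [ k ]≔ t))
    ≡⟨ 𝔼-cong (vec T q) (λ ts → 𝔼-resample J w (λ t → f (ts [ k ]≔ t))) ⟩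
  (𝔼 (vec T q) λ ts → 𝔼 T λ t → 𝔼 J λ y → f (ts [ k ]≔ set J t w y))
    ≡⟨ 𝔼-cong (vec T q) (λ ts → 𝔼-cong T λ t → 𝔼-cong J λ y → cong f (sym
         (trans (Vecₚ.[]≔-idempotent ts k) (cong (λ t → ts [ k ]≔ set J t w y) (Vecₚ.lookup∘update k ts t))))) ⟩
  (𝔼 (vec T q) λ ts → 𝔼 T λ t → 𝔼 J λ y → f (redraw J (ts [ k ]≔ t) k w y))
    ≡⟨ 𝔼-resample-vec T k (λ ts → 𝔼 J λ y → f (redraw J ts k w y)) ⟨
  (𝔼 (vec T q) λ ts → 𝔼 J λ y → f (redraw J ts k w y)) ∎
  where
  open ≡-Reasoning
  T = table J b

layers-redraw-≢ : ∀ {l b q} J (s : El J → Vec Bool l → Bool) (As : Vec (Vec (Vec Bool l) b) q) ts k w y v →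
                  eqV (hash (lookup As k) v) w ≡ false → layers J s As (redraw J ts k w y) v ≡ layers J s As ts v
layers-redraw-≢ J s (A ∷ As) (t ∷ ts) zero w y v e =
  cong (λ z → s z v xor layers J s As ts v) (get-set-≢ J t {w} {hash A v} y
    λ { refl → false≢true (trans (sym e) (eqV-refl w)) })
layers-redraw-≢ J s (A ∷ As) (t ∷ ts) (suc k) w y v e =
  cong (s (get J t (hash A v)) v xor_) (layers-redraw-≢ J s As ts k w y v e)

-- The old entry enters twice on the right and cancels.
layers-redraw-≡ : ∀ {l b q} J (s : El J → Vec Bool l → Bool) (As : Vec (Vec (Vec Bool l) b) q) ts k w y v →
                  eqV (hash (lookup As k) v) w ≡ true →
                  layers J s As (redraw J ts k w y) v ≡ (layers J s As ts v xor s (get J (lookup ts k) w) v) xor s y v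
layers-redraw-≡ J s (A ∷ As) (t ∷ ts) zero w y v e with eqV⇒≡ (hash A v) w e
... | refl = trans (cong (λ z → s z v xor layers J s As ts v) (get-set J t (hash A v) y))
                   (cancel (s y v) (layers J s As ts v) (s (get J t (hash A v)) v))
  where
  cancel : ∀ x r o → x xor r ≡ ((o xor r) xor o) xor x
  cancel true  true  true  = refl
  cancel true  true  false = refl
  cancel true  false true  = refl
  cancel true  false false = refl
  cancel false true  true  = refl
  cancel false true  false = refl
  cancel false false true  = refl
  cancel false false false = refl
layers-redraw-≡ J s (A ∷ As) (t ∷ ts) (suc k) w y v e =
  trans (cong (z xor_) (layers-redraw-≡ J s As ts k w y v e))
        (trans (sym (𝔹ₚ.xor-assoc z _ (s y v))) (cong (_xor s y v) (sym (𝔹ₚ.xor-assoc z _ _))))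
  where z = s (get J t (hash A v)) v

hybrid : ∀ {l b q M} J (s : El J → Vec Bool l → Bool) → Circ (Vec Bool l) M → Vec (Vec (Vec Bool l) b) q →
         (Vec Bool l → Bool) → ℚ
hybrid {l} {b} {q} J s c As R =
  𝔼 (vec (table J b) q) λ ts → 𝔼 (table bit l) λ u → ind (eval c (mix R (layers J s As ts) u))

-- Redraw the index of bucket w in layer k with all else fixed. Inside the bucket the circuit sees a
-- translate of s y, outside nothing depends on y; replacing s y by uniform bits takes the bucket
-- out of R.
hybrid-step : ∀ {l b q M} J (s : El J → Vec Bool l → Bool) (c : Circ (Vec Bool l) M) (As : Vec (Vec (Vec Bool l) b) q)
              (R : Vec Bool l → Bool) (k : Fin q) (w : Vec Bool b) ε →
              let B : Vec Bool l → Bool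
                  B v = R v ∧ eqV (hash (lookup As k) v) w in
              (∀ (x f : Vec Bool l → Bool) → Close ε (𝔼 J λ y → ind (eval c (overlay B x (s y) f)))
                               (𝔼 (table bit l) λ a → ind (eval c (overlay B x (get bit a) f)))) →
              Close ε (hybrid J s c As R) (hybrid J s c As λ v → R v ∧ not (eqV (hash (lookup As k) v) w))
hybrid-step {l} {b} {q} J s c As R k w ε fooled =
  Close-resp (sym left) refl (Close-𝔼-const TS λ ts → Close-resp refl (right ts)
    (Close-𝔼-const A λ u → fooled (base ts) (mix R′ (layers J s As ts) u)))
  where
  open ≡-Reasoning
  TS = vec (table J b) q
  A = table bit l
  in-bucket : Vec Bool l → Bool
  in-bucket v = eqV (hash (lookup As k) v) w
  B R′ : Vec Bool l → Bool
  B v  = R v ∧ in-bucket v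
  R′ v = R v ∧ not (in-bucket v)
  -- The XOR of the other layers inside the bucket, obtained by cancelling the old entry.
  base : El TS → Vec Bool l → Bool
  base ts v = layers J s As ts v xor s (get J (lookup ts k) w) v
  redrawn : ∀ ts y u v → mix R (layers J s As (redraw J ts k w y)) u v ≡
            overlay B (base ts) (s y) (mix R′ (layers J s As ts) u) v
  redrawn ts y u v with R v | in-bucket v in e
  ... | false | _     = refl
  ... | true  | true  = layers-redraw-≡ J s As ts k w y v e
  ... | true  | false = layers-redraw-≢ J s As ts k w y v e
  left : hybrid J s c As R ≡
         𝔼 TS λ ts → 𝔼 A λ u → 𝔼 J λ y → ind (eval c (overlay B (base ts) (s y) (mix R′ (layers J s As ts) u)))
  left = begin
    hybrid J s c As R
      ≡⟨ 𝔼-redraw J k w _ ⟩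
    (𝔼 TS λ ts → 𝔼 J λ y → 𝔼 A λ u → ind (eval c (mix R (layers J s As (redraw J ts k w y)) u)))
      ≡⟨ 𝔼-cong TS (λ ts → trans (𝔼-swap J A _) (𝔼-cong A λ u → 𝔼-cong J λ y → cong ind (eval-ext c (redrawn ts y u)))) ⟩
    (𝔼 TS λ ts → 𝔼 A λ u → 𝔼 J λ y → ind (eval c (overlay B (base ts) (s y) (mix R′ (layers J s As ts) u)))) ∎
  remixed : ∀ ts u a v → overlay B (base ts) (get bit a) (mix R′ (layers J s As ts) u) v ≡
            mix R′ (layers J s As ts) (mixTable l B (base ts) a u) v
  remixed ts u a v = sym (trans (cong (λ z → if R′ v then layers J s As ts v else z) (get-mixTable B (base ts) a u v)) (cases (R v) (in-bucket v)))
    where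
    cases : ∀ r i {x y z : Bool} →
            (if r ∧ not i then x else (if r ∧ i then y else z)) ≡ (if r ∧ i then y else (if r ∧ not i then x else z))
    cases false _     = refl
    cases true  true  = refl
    cases true  false = refl
  right : ∀ ts → (𝔼 A λ u → 𝔼 A λ a → ind (eval c (overlay B (base ts) (get bit a) (mix R′ (layers J s As ts) u)))) ≡
                 𝔼 A λ u → ind (eval c (mix R′ (layers J s As ts) u))
  right ts = trans (𝔼-cong A λ u → 𝔼-cong A λ a → cong ind (eval-ext c (remixed ts u a)))
                   (𝔼-mixTable l B (base ts) (λ u → ind (eval c (mix R′ (layers J s As ts) u))))

-- For each value t of the extra bit, `restrict` with the translation x xor t yields one test of the
-- class; on the uniform side `𝔼-shift` undoes t.
fools-light : ∀ {l μ M} I s ε (c : Circ (Vec Bool l) M) → FoolsClass l μ I s ε → (B : Vec Bool l → Bool) →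
              count (λ i → B (proj₁ (Circ.label c i))) ≤ 2 ^ μ → ∀ (x f : Vec Bool l → Bool) →
              Close ε (𝔼 (I ⊗ bit) λ y → ind (eval c (overlay B x (flip I s y) f)))
                      (𝔼 (table bit l) λ a → ind (eval c (overlay B x (get bit a) f)))
fools-light {l} {μ} I s ε c fools B few x f =
  Close-resp (𝔼-swap bit I λ t y → ind (eval c (overlay B x (flip I s (y , t)) f))) (𝔼-const bit E)
    (Close-𝔼-const bit λ t → Close-resp
      (𝔼-cong I λ y → cong ind (trans (sym (proj₂ (d t) (s y))) (eval-ext c λ v → cong (λ z → if B v then z else f v) (moved (x v) t (s y v)))))
      (trans (𝔼-cong A λ a → cong ind (trans (sym (proj₂ (d t) (get bit a))) (eval-ext c λ v → cong (λ z → if B v then z else f v)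
                (trans (moved (x v) t (get bit a v)) (cong (x v xor_) (sym (get-shift a t v)))))))
             (𝔼-shift A (constTable l t) λ a → ind (eval c (overlay B x (get bit a) f))))
      (fools (proj₁ (d t))))
  where
  A = table bit l
  E = 𝔼 A λ a → ind (eval c (overlay B x (get bit a) f))
  d : ∀ t → Σ (El (code l μ)) λ d → ∀ σ → eval c (overlay B (λ v → x v xor t) σ f) ≡ evalCode l μ d σ
  d t = restrict μ c B (λ v → x v xor t) f few
  moved : ∀ x t z → (x xor t) xor z ≡ x xor (z xor t)
  moved x t z = trans (𝔹ₚ.xor-assoc x t z) (cong (x xor_) (𝔹ₚ.xor-comm t z))

-- Only the bit at v₀ varies, and the extra bit makes it uniform for every y. The number of wires
-- carrying v₀ does not matter, and there is no error.
fools-single : ∀ {l M} I s (c : Circ (Vec Bool l) M) (B : Vec Bool l → Bool) v₀ → (∀ v → B v ≡ true → v ≡ v₀) → ∀ (x f : Vec Bool l → Bool) →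
               (𝔼 (I ⊗ bit) λ y → ind (eval c (overlay B x (flip I s y) f))) ≡
               (𝔼 (table bit l) λ a → ind (eval c (overlay B x (get bit a) f)))
fools-single {l} I s c B v₀ only x f = begin
  (𝔼 I λ y → 𝔼 bit λ t → ind (eval c (overlay B x (flip I s (y , t)) f)))
    ≡⟨ 𝔼-cong I (λ y → trans (𝔼-cong bit λ t → cong ind (at-v₀ (flip I s (y , t))))
         (trans (𝔼-cong bit λ t → cong g (𝔹ₚ.xor-comm (s y v₀) t)) (𝔼-shift bit (s y v₀) g))) ⟩
  (𝔼 I λ y → 𝔼 bit g)        ≡⟨ 𝔼-const I (𝔼 bit g) ⟩
  𝔼 bit g                    ≡⟨ 𝔼-get bit v₀ g ⟨
  (𝔼 (table bit l) λ a → g (get bit a v₀)) ≡⟨ 𝔼-cong (table bit l) (λ a → cong ind (at-v₀ (get bit a))) ⟨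
  (𝔼 (table bit l) λ a → ind (eval c (overlay B x (get bit a) f))) ∎
  where
  open ≡-Reasoning
  g : Bool → ℚ
  g t = ind (eval c (overlay B x (λ _ → t) f))
  at-v₀ : ∀ (σ : Vec Bool l → Bool) → eval c (overlay B x σ f) ≡ eval c (overlay B x (λ _ → σ v₀) f)
  at-v₀ σ = eval-ext c pointwise
    where
    pointwise : ∀ v → overlay B x σ f v ≡ overlay B x (λ _ → σ v₀) f v
    pointwise v with B v in e
    ... | false = refl
    ... | true  = cong (λ z → x v xor σ z) (only v e)

∧-trueˡ : ∀ x y → x ∧ y ≡ true → x ≡ true
∧-trueˡ true y _ = refl

∧-trueʳ : ∀ x y → x ∧ y ≡ true → y ≡ true
∧-trueʳ true y e = e

module _ {l b q : ℕ} (As : Vec (Vec (Vec Bool l) b) q) (layer : Vec Bool l → Fin q) where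

  bucket : Vec Bool l → Vec Bool l → Bool
  bucket v x = eqV (hash (lookup As (layer v)) x) (hash (lookup As (layer v)) v)

  remove : Vec Bool l → (Vec Bool l → Bool) → Vec Bool l → Bool
  remove v R x = R x ∧ not (bucket v x)

  -- Buckets are addressed through their members: the number of steps is the number of names, and a
  -- selected variable surely leaves R, being in its own bucket.
  sweep : (Vec Bool l → Bool) → List (Vec Bool l) → (Vec Bool l → Bool) → Vec Bool l → Bool
  sweep sel []       R = R
  sweep sel (v ∷ vs) R = sweep sel vs (if sel v then remove v R else R)

  remove-⊆ : ∀ b v R x → (if b then remove v R else R) x ≡ true → R x ≡ true
  remove-⊆ true  v R x e = ∧-trueˡ (R x) _ e
  remove-⊆ false v R x e = e

  sweep-⊆ : ∀ sel vs R x → sweep sel vs R x ≡ true → R x ≡ true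
  sweep-⊆ sel []       R x e = e
  sweep-⊆ sel (v ∷ vs) R x e = remove-⊆ (sel v) v R x (sweep-⊆ sel vs (if sel v then remove v R else R) x e)

  sweep-removes : ∀ sel vs R v → v ∈ vs → sel v ≡ true → sweep sel vs R v ≡ true → ⊥
  sweep-removes sel (v ∷ vs) R .v (here refl) sel-v e
    with sel v | sweep-⊆ sel vs (if sel v then remove v R else R) v e
  sweep-removes sel (v ∷ vs) R .v (here refl) refl e | true | e′ =
    false≢true (trans (sym (cong not (eqV-refl (hash (lookup As (layer v)) v)))) (∧-trueʳ (R v) _ e′))
  sweep-removes sel (v′ ∷ vs) R v (there v∈) sel-v e = sweep-removes sel vs (if sel v′ then remove v′ R else R) v v∈ sel-v e

module _ {l b q M : ℕ} (I : U) (s : El I → Vec Bool l → Bool) (c : Circ (Vec Bool l) M)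
         (As : Vec (Vec (Vec Bool l) b) q) (layer : Vec Bool l → Fin q) where

  Fooled : ℚ → (Vec Bool l → Bool) → Set
  Fooled ε B = ∀ (x f : Vec Bool l → Bool) →
    Close ε (𝔼 (I ⊗ bit) λ y → ind (eval c (overlay B x (flip I s y) f)))
            (𝔼 (table bit l) λ a → ind (eval c (overlay B x (get bit a) f)))

  -- R₀ keeps what an earlier sweep has achieved: heavy buckets are fooled only once no light
  -- variable is left in R.
  sweep-close : ∀ ε sel (R₀ : Vec Bool l → Bool) → 0ℚ ≤ℚ ε →
                (∀ v (R : Vec Bool l → Bool) → sel v ≡ true → (∀ x → R x ≡ true → R₀ x ≡ true) → Fooled ε (λ x → R x ∧ bucket As layer v x)) →
                ∀ vs (R : Vec Bool l → Bool) → (∀ x → R x ≡ true → R₀ x ≡ true) →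
                Close (fromℕ (length vs) *ℚ ε) (hybrid (I ⊗ bit) (flip I s) c As R)
                                              (hybrid (I ⊗ bit) (flip I s) c As (sweep As layer sel vs R))
  sweep-close ε sel R₀ 0≤ε fooled []       R R⊆ = Close-refl (ℚₚ.≤-reflexive (sym (ℚₚ.*-zeroˡ ε)))
  sweep-close ε sel R₀ 0≤ε fooled (v ∷ vs) R R⊆ =
    subst (λ δ → Close δ (hyb R) (hyb (sweep As layer sel (v ∷ vs) R)))
      (solve 2 (λ ε n → ε :+ n :* ε := (con 1ℚ :+ n) :* ε) refl ε (fromℕ (length vs)))
      (Close-trans (first (sel v) refl)
        (sweep-close ε sel R₀ 0≤ε fooled vs (if sel v then remove As layer v R else R)
          λ x e → R⊆ x (remove-⊆ As layer (sel v) v R x e)))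
    where
    hyb = hybrid (I ⊗ bit) (flip I s) c As
    first : ∀ b → sel v ≡ b → Close ε (hyb R) (hyb (if b then remove As layer v R else R))
    first false e = Close-refl 0≤ε
    first true  e = hybrid-step (I ⊗ bit) (flip I s) c As R (layer v) (hash (lookup As (layer v)) v) ε (fooled v R e R⊆)

module _ {l b q M μ : ℕ} (I : U) (s : El I → Vec Bool l → Bool) (c : Circ (Vec Bool l) M)
         (As : Vec (Vec (Vec Bool l) b) q) (ε : ℚ) (0≤ε : 0ℚ ≤ℚ ε) (fools : FoolsClass l μ I s ε)
         (uncrowded : ∀ v → Σ (Fin q) λ k → 2 * others c (lookup As k) v ≤ 2 ^ μ) where
  private
    layer : Vec Bool l → Fin q
    layer v = proj₁ (uncrowded v)

    var : Fin M → Vec Bool l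
    var i = proj₁ (Circ.label c i)

    light heavy : Vec Bool l → Bool
    light v = ⌊ 2 * occurrences c v ≤? 2 ^ μ ⌋
    heavy v = not (light v)

    light⇒ : ∀ v → light v ≡ true → 2 * occurrences c v ≤ 2 ^ μ
    light⇒ v e with 2 * occurrences c v ≤? 2 ^ μ
    ... | yes h = h

    -- The wires of v and the foreign wires of its bucket each fill at most half of the 2^μ wires.
    fooled-light : ∀ v (R : Vec Bool l → Bool) → light v ≡ true → Fooled I s c As layer ε (λ x → R x ∧ bucket As layer v x)
    fooled-light v R light-v = fools-light {μ = μ} I s ε c fools _ (begin
      count (λ i → R (var i) ∧ bucket As layer v (var i))
        ≤⟨ count-mono (λ i e → ∧-trueʳ (R (var i)) _ e) ⟩
      count (λ i → bucket As layer v (var i))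
        ≤⟨ count-split (λ i → bucket As layer v (var i)) (λ i → eqV (var i) v) ⟩
      o + occurrences c v
        ≤⟨ ℕₚ.*-cancelˡ-≤ 2 (begin
             2 * (o + occurrences c v)     ≡⟨ ℕₚ.*-distribˡ-+ 2 o (occurrences c v) ⟩
             2 * o + 2 * occurrences c v   ≤⟨ ℕₚ.+-mono-≤ (proj₂ (uncrowded v)) (light⇒ v light-v) ⟩
             2 ^ μ + 2 ^ μ                 ≡⟨ cong (λ k → 2 ^ μ + k) (ℕₚ.+-identityʳ (2 ^ μ)) ⟨
             2 * 2 ^ μ                     ∎) ⟩
      2 ^ μ ∎)
      where
      open ℕₚ.≤-Reasoning
      o = others c (lookup As (layer v)) v

    everything nothing : Vec Bool l → Bool
    everything _ = true
    nothing    _ = false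

    -- The order matters: once the light variables are gone, what R still has in the bucket of a
    -- heavy variable is at most that variable.
    R₁ R₂ : Vec Bool l → Bool
    R₁ = sweep As layer light (everyVec l) everything
    R₂ = sweep As layer heavy (everyVec l) R₁

    -- Two heavy variables in a bucket would crowd each other.
    only-heavy : ∀ v (R : Vec Bool l → Bool) → (∀ x → R x ≡ true → R₁ x ≡ true) →
                 ∀ x → R x ∧ bucket As layer v x ≡ true → x ≡ v
    only-heavy v R R⊆ x e with eqV x v in x≟v
    ... | true  = eqV⇒≡ x v x≟v
    ... | false = ⊥-elim (sweep-removes As layer light (everyVec l) everything x (∈-everyVec x) light-x
                    (R⊆ x (∧-trueˡ (R x) _ e)))
      where
      in-others : ∀ i → eqV (var i) x ≡ true →
                  not (eqV (var i) v) ∧ eqV (hash (lookup As (layer v)) (var i)) (hash (lookup As (layer v)) v) ≡ true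
      in-others i e′ with eqV⇒≡ (var i) x e′
      ... | eq = trans (cong (λ y → not (eqV y v) ∧ bucket As layer v y) eq)
                   (trans (cong (λ z → not z ∧ bucket As layer v x) x≟v) (∧-trueʳ (R x) _ e))
      light-x : light x ≡ true
      light-x with 2 * occurrences c x ≤? 2 ^ μ
      ... | yes _ = refl
      ... | no ¬h = ⊥-elim (¬h (ℕₚ.≤-trans (ℕₚ.*-monoʳ-≤ 2 (count-mono in-others)) (proj₂ (uncrowded v))))

    fooled-heavy : ∀ v (R : Vec Bool l → Bool) → (∀ x → R x ≡ true → R₁ x ≡ true) →
                   Fooled I s c As layer 0ℚ (λ x → R x ∧ bucket As layer v x)
    fooled-heavy v R R⊆ x f =
      Close-resp (sym (fools-single I s c _ v (only-heavy v R R⊆) x f)) refl (Close-refl ℚₚ.≤-refl)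

    hyb : (Vec Bool l → Bool) → ℚ
    hyb = hybrid (I ⊗ bit) (flip I s) c As

    R₂-empty : ∀ x → R₂ x ≡ false
    R₂-empty x with R₂ x in e
    ... | false = refl
    ... | true with light x in light-x
    ... | true  = ⊥-elim (sweep-removes As layer light (everyVec l) everything x (∈-everyVec x) light-x
                    (sweep-⊆ As layer heavy (everyVec l) R₁ x e))
    ... | false = ⊥-elim (sweep-removes As layer heavy (everyVec l) R₁ x (∈-everyVec x) (cong not light-x) e)

    TS = vec (table (I ⊗ bit) b) q
    uniform = 𝔼 (table bit l) λ u → ind (eval c (get bit u))

  -- The light sweep is charged ε for each of the 2^l names; the heavy sweep is exact.
  layers-fool : Close (p2 l *ℚ ε) (𝔼 TS λ ts → ind (eval c (layers (I ⊗ bit) (flip I s) As ts))) uniform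
  layers-fool = subst (λ δ → Close δ (𝔼 TS λ ts → ind (eval c (layers (I ⊗ bit) (flip I s) As ts))) uniform)
    (trans (cong₂ _+ℚ_ (cong (_*ℚ ε) (length-everyVec l)) (ℚₚ.*-zeroʳ (fromℕ (length (everyVec l))))) (ℚₚ.+-identityʳ _))
    (Close-resp start finish (Close-trans
      (sweep-close I s c As layer ε light everything 0≤ε (λ v R e _ → fooled-light v R e) (everyVec l) everything (λ _ e → e))
      (sweep-close I s c As layer 0ℚ heavy R₁ ℚₚ.≤-refl (λ v R _ R⊆ → fooled-heavy v R R⊆) (everyVec l) R₁ (λ _ e → e))))
    where
    start : hyb everything ≡ 𝔼 TS λ ts → ind (eval c (layers (I ⊗ bit) (flip I s) As ts))
    start = 𝔼-cong TS λ ts → 𝔼-const (table bit l) (ind (eval c (layers (I ⊗ bit) (flip I s) As ts)))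
    finish : hyb R₂ ≡ uniform
    finish = trans (𝔼-cong TS λ ts → 𝔼-cong (table bit l) λ u → cong ind (eval-ext c λ v →
      cong (λ z → if z then layers (I ⊗ bit) (flip I s) As ts v else get bit u v) (R₂-empty v))) (𝔼-const TS uniform)

Seed : (l b q : ℕ) → U → U
Seed l b q I = vec (vec (vec bit l) b) q ⊗ vec (table (I ⊗ bit) b) q

generate : ∀ {l b q} I → (El I → Vec Bool l → Bool) → El (Seed l b q I) → Vec Bool l → Bool
generate I s (As , ts) = layers (I ⊗ bit) (flip I s) As ts

-- The second error term is the union bound for the event that some name is crowded under all q hash
-- functions.
generate-fools : ∀ {l M} μ b q I (s : El I → Vec Bool l → Bool) (c : Circ (Vec Bool l) M) ε → 0ℚ ≤ℚ ε →
                 FoolsClass l μ I s ε → 4 * M ≤ 2 ^ μ * 2 ^ b →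
                 Close (p2 l *ℚ ε +ℚ p2 l *ℚ ½^ q)
                       (𝔼 (Seed l b q I) λ z → ind (eval c (generate {b = b} {q} I s z)))
                       (𝔼 (table bit l) λ a → ind (eval c (get bit a)))
generate-fools {l} μ b q I s c ε 0≤ε fools 4M≤ = Close-mono total
  (Close-resp refl (𝔼-const HS uniform) (Close-𝔼 HS per-hash))
  where
  open ℚₚ.≤-Reasoning
  HS = vec (vec (vec bit l) b) q
  TS = vec (table (I ⊗ bit) b) q
  uniform = 𝔼 (table bit l) λ a → ind (eval c (get bit a))
  failure : El HS → ℚ
  failure As = sumList (allCrowded μ c As) (everyVec l)
  0≤pε : 0ℚ ≤ℚ p2 l *ℚ ε
  0≤pε = 0≤* (0≤p2 l) 0≤ε
  1≤δ⇒Close : ∀ {δ x y} → 1ℚ ≤ℚ δ → 0ℚ ≤ℚ x → x ≤ℚ 1ℚ → 0ℚ ≤ℚ y → y ≤ℚ 1ℚ → Close δ x y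
  1≤δ⇒Close 1≤δ 0≤x x≤1 0≤y y≤1 = ℚₚ.≤-trans x≤1 (ℚₚ.≤-trans 1≤δ (ℚₚ.≤-trans (ℚₚ.≤-reflexive (sym (ℚₚ.+-identityˡ _))) (ℚₚ.+-monoˡ-≤ _ 0≤y)))
                                , ℚₚ.≤-trans y≤1 (ℚₚ.≤-trans 1≤δ (ℚₚ.≤-trans (ℚₚ.≤-reflexive (sym (ℚₚ.+-identityˡ _))) (ℚₚ.+-monoˡ-≤ _ 0≤x)))
  per-hash : ∀ As → Close (p2 l *ℚ ε +ℚ failure As) (𝔼 TS λ ts → ind (eval c (generate {b = b} {q} I s (As , ts)))) uniform
  per-hash As with uncrowded⊎1≤ μ c As (everyVec l)
  ... | inj₁ unc = Close-mono (ℚₚ.≤-trans (ℚₚ.≤-reflexive (sym (ℚₚ.+-identityʳ _))) (ℚₚ.+-monoʳ-≤ (p2 l *ℚ ε) (0≤sumList (0≤allCrowded μ c As) (everyVec l))))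
                     (layers-fool {μ = μ} I s c As ε 0≤ε fools λ v → unc (∈-everyVec v))
  ... | inj₂ 1≤  = 1≤δ⇒Close (ℚₚ.≤-trans 1≤ (ℚₚ.≤-trans (ℚₚ.≤-reflexive (sym (ℚₚ.+-identityˡ _))) (ℚₚ.+-monoˡ-≤ (failure As) 0≤pε)))
                     (𝔼-bounded-below TS λ ts → 0≤ind (test ts)) (𝔼-bounded TS λ ts → ind≤1 (test ts))
                     (𝔼-bounded-below (table bit l) λ a → 0≤ind (eval c (get bit a))) (𝔼-bounded (table bit l) λ a → ind≤1 (eval c (get bit a)))
    where
    test : El TS → Bool
    test ts = eval c (generate {b = b} {q} I s (As , ts))
  total : 𝔼 HS (λ As → p2 l *ℚ ε +ℚ failure As) ≤ℚ p2 l *ℚ ε +ℚ p2 l *ℚ ½^ q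
  total = begin
    𝔼 HS (λ As → p2 l *ℚ ε +ℚ failure As)            ≡⟨ 𝔼-+ HS (λ _ → p2 l *ℚ ε) failure ⟩
    𝔼 HS (λ _ → p2 l *ℚ ε) +ℚ 𝔼 HS failure           ≡⟨ cong (_+ℚ 𝔼 HS failure) (𝔼-const HS (p2 l *ℚ ε)) ⟩
    p2 l *ℚ ε +ℚ 𝔼 HS failure
      ≤⟨ ℚₚ.+-monoʳ-≤ (p2 l *ℚ ε) (𝔼-sumList HS (allCrowded μ c) (½^ q) (λ v → allCrowded-rare b μ q c v 4M≤) (everyVec l)) ⟩
    p2 l *ℚ ε +ℚ fromℕ (length (everyVec l)) *ℚ ½^ q ≡⟨ cong (λ z → p2 l *ℚ ε +ℚ z *ℚ ½^ q) (length-everyVec l) ⟩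
    p2 l *ℚ ε +ℚ p2 l *ℚ ½^ q                        ∎

-- Boolean circuits

infixl 5 _▷▷_
_▷▷_ : ∀ {m k l} → BoolCirc m k → BoolCirc k l → BoolCirc m l
c ▷▷ inputs  = c
c ▷▷ (d ▷ g) = (c ▷▷ d) ▷ g

size-▷▷ : ∀ {m k l} (c : BoolCirc m k) (d : BoolCirc k l) → size (c ▷▷ d) ≡ size c + size d
size-▷▷ c inputs  = sym (ℕₚ.+-identityʳ (size c))
size-▷▷ c (d ▷ g) = trans (cong suc (size-▷▷ c d)) (sym (ℕₚ.+-suc (size c) (size d)))

evalNodes-▷▷ : ∀ {m k l} (c : BoolCirc m k) (d : BoolCirc k l) x → evalNodes (c ▷▷ d) x ≡ evalNodes d (evalNodes c x)
evalNodes-▷▷ c inputs  x = refl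
evalNodes-▷▷ c (d ▷ g) x = cong (λ v → v ∷ʳ evalBGate g v) (evalNodes-▷▷ c d x)

lookup-∷ʳ-inject₁ : ∀ {k} (v : Vec Bool k) b i → lookup (v ∷ʳ b) (Data.Fin.inject₁ i) ≡ lookup v i
lookup-∷ʳ-inject₁ (x ∷ v) b zero    = refl
lookup-∷ʳ-inject₁ (x ∷ v) b (suc i) = lookup-∷ʳ-inject₁ v b i

lookup-∷ʳ-last : ∀ {k} (v : Vec Bool k) b → lookup (v ∷ʳ b) (Data.Fin.fromℕ k) ≡ b
lookup-∷ʳ-last []      b = refl
lookup-∷ʳ-last (x ∷ v) b = lookup-∷ʳ-last v b

embed : ∀ {k l} → BoolCirc k l → Fin k → Fin l
embed inputs  i = i
embed (d ▷ g) i = Data.Fin.inject₁ (embed d i)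

lookup-embed : ∀ {k l} (d : BoolCirc k l) x i → lookup (evalNodes d x) (embed d i) ≡ lookup x i
lookup-embed inputs  x i = refl
lookup-embed (d ▷ g) x i = trans (lookup-∷ʳ-inject₁ (evalNodes d x) _ (embed d i)) (lookup-embed d x i)

mapS : ∀ {A B : Set} → (A → B) → ∀ u → Str A u → Str B u
mapS f bit             x        = f x
mapS f (u ⊗ v)         (x , y)  = mapS f u x , mapS f v y
mapS f (vec u zero)    []       = []
mapS f (vec u (suc n)) (x ∷ xs) = mapS f u x ∷ mapS f (vec u n) xs

mapS-fusion : ∀ {A B C : Set} {f : B → C} {g : A → B} {h : A → C} → (∀ a → f (g a) ≡ h a) →
              ∀ u (x : Str A u) → mapS f u (mapS g u x) ≡ mapS h u x
mapS-fusion e bit             x        = e x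
mapS-fusion e (u ⊗ v)         (x , y)  = cong₂ _,_ (mapS-fusion e u x) (mapS-fusion e v y)
mapS-fusion e (vec u zero)    []       = refl
mapS-fusion e (vec u (suc n)) (x ∷ xs) = cong₂ _∷_ (mapS-fusion e u x) (mapS-fusion e (vec u n) xs)

read : ∀ {k} → Vec Bool k → ∀ u → Str (Fin k) u → El u
read x = mapS (lookup x)

-- The extra node, of arbitrary value, makes constants available.
record Comp (u v : U) (n : ℕ) (f : El u → El v) : Set where
  field
    build : ∀ {k} → Fin k → (ins : Str (Fin k) u) →
      Σ ℕ λ k′ → Σ (BoolCirc k k′) λ c → Σ (Str (Fin k′) v) λ outs →
        size c ≤ n × (∀ x → read (evalNodes c x) v outs ≡ f (read x u ins))
open Comp

≤-Comp : ∀ {u v m n f} → m ≤ n → Comp u v m f → Comp u v n f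
build (≤-Comp m≤n C) d ins = let (k , c , outs , s , e) = build C d ins in k , c , outs , ℕₚ.≤-trans s m≤n , e

≗-Comp : ∀ {u v n f g} → (∀ x → f x ≡ g x) → Comp u v n f → Comp u v n g
build (≗-Comp {u} h C) d ins = let (k , c , outs , s , e) = build C d ins in
  k , c , outs , s , λ x → trans (e x) (h (read x u ins))

idC : ∀ {u} → Comp u u 0 (λ x → x)
build idC d ins = _ , inputs , ins , z≤n , λ x → refl

infixl 4 _▸_
_▸_ : ∀ {u v w m n f g} → Comp u v m f → Comp v w n g → Comp u w (m + n) (λ x → g (f x))
build (_▸_ {w = w} {g = g} F G) d ins with build F d ins
... | k , c , outs , s , e with build G (embed c d) outs
... | k′ , c′ , outs′ , s′ , e′ =
  k′ , c ▷▷ c′ , outs′ , subst (_≤ _) (sym (size-▷▷ c c′)) (ℕₚ.+-mono-≤ s s′) ,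
  λ x → trans (cong (λ y → read y w outs′) (evalNodes-▷▷ c c′ x)) (trans (e′ (evalNodes c x)) (cong g (e x)))

⟨_,_⟩ : ∀ {u v w m n f g} → Comp u v m f → Comp u w n g → Comp u (v ⊗ w) (m + n) (λ x → f x , g x)
build (⟨_,_⟩ {u} {v} {w} {g = g} F G) d ins with build F d ins
... | k , c , outs , s , e with build G (embed c d) (mapS (embed c) u ins)
... | k′ , c′ , outs′ , s′ , e′ =
  k′ , c ▷▷ c′ , (mapS (embed c′) v outs , outs′) , subst (_≤ _) (sym (size-▷▷ c c′)) (ℕₚ.+-mono-≤ s s′) ,
  λ x → trans (cong (λ y → read y (v ⊗ w) (mapS (embed c′) v outs , outs′)) (evalNodes-▷▷ c c′ x)) (cong₂ _,_
    (trans (mapS-fusion (lookup-embed c′ (evalNodes c x)) v outs) (e x))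
    (trans (e′ (evalNodes c x)) (cong g (mapS-fusion (lookup-embed c x) u ins))))

fstC : ∀ {u v} → Comp (u ⊗ v) u 0 proj₁
build fstC d (i , j) = _ , inputs , i , z≤n , λ x → refl

sndC : ∀ {u v} → Comp (u ⊗ v) v 0 proj₂
build sndC d (i , j) = _ , inputs , j , z≤n , λ x → refl

headC : ∀ {u n} → Comp (vec u (suc n)) u 0 Data.Vec.head
build headC d (i ∷ is) = _ , inputs , i , z≤n , λ x → refl

tailC : ∀ {u n} → Comp (vec u (suc n)) (vec u n) 0 Data.Vec.tail
build tailC d (i ∷ is) = _ , inputs , is , z≤n , λ x → refl

nilC : ∀ {u v} → Comp u (vec v 0) 0 (λ _ → [])
build nilC d ins = _ , inputs , [] , z≤n , λ x → refl

consC : ∀ {u n} → Comp (u ⊗ vec u n) (vec u (suc n)) 0 (λ x → proj₁ x ∷ proj₂ x)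
build consC d (i , is) = _ , inputs , (i ∷ is) , z≤n , λ x → refl

andC : Comp (bit ⊗ bit) bit 1 (λ x → proj₁ x ∧ proj₂ x)
build andC d (i , j) = _ , (inputs ▷ AND i j) , Data.Fin.fromℕ _ , s≤s z≤n , λ x → lookup-∷ʳ-last x _

orC : Comp (bit ⊗ bit) bit 1 (λ x → proj₁ x ∨ proj₂ x)
build orC d (i , j) = _ , (inputs ▷ OR i j) , Data.Fin.fromℕ _ , s≤s z≤n , λ x → lookup-∷ʳ-last x _

notC : Comp bit bit 1 not
build notC d i = _ , (inputs ▷ NOT i) , Data.Fin.fromℕ _ , s≤s z≤n , λ x → lookup-∷ʳ-last x _

bitC : ∀ {u} b → Comp u bit 2 (λ _ → b)
build (bitC true) d ins = _ , ((inputs ▷ NOT d) ▷ OR (Data.Fin.inject₁ d) (Data.Fin.fromℕ _)) , Data.Fin.fromℕ _ , s≤s (s≤s z≤n) ,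
  λ x → trans (lookup-∷ʳ-last (x ∷ʳ not (lookup x d)) _)
          (trans (cong₂ _∨_ (lookup-∷ʳ-inject₁ x _ d) (lookup-∷ʳ-last x _)) (𝔹ₚ.∨-inverseʳ (lookup x d)))
build (bitC false) d ins = _ , ((inputs ▷ NOT d) ▷ AND (Data.Fin.inject₁ d) (Data.Fin.fromℕ _)) , Data.Fin.fromℕ _ , s≤s (s≤s z≤n) ,
  λ x → trans (lookup-∷ʳ-last (x ∷ʳ not (lookup x d)) _)
          (trans (cong₂ _∧_ (lookup-∷ʳ-inject₁ x _ d) (lookup-∷ʳ-last x _)) (𝔹ₚ.∧-inverseʳ (lookup x d)))

-- Hard-wiring at two gates per bit; the lists of sampled seeds enter the circuit size here.
constC : ∀ {u} v (a : El v) → Comp u v (2 * bits v) (λ _ → a)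
constC bit a = bitC a
constC (v ⊗ w) (a , b) = ≤-Comp (ℕₚ.≤-reflexive (sym (ℕₚ.*-distribˡ-+ 2 (bits v) (bits w)))) ⟨ constC v a , constC w b ⟩
constC (vec v zero) [] = nilC
constC (vec v (suc n)) (a ∷ as) = ≤-Comp
  (ℕₚ.≤-reflexive (trans (ℕₚ.+-identityʳ _) (sym (ℕₚ.*-distribˡ-+ 2 (bits v) (n * bits v)))))
  (⟨ constC v a , constC (vec v n) as ⟩ ▸ consC)

xorC : Comp (bit ⊗ bit) bit 4 (λ x → proj₁ x xor proj₂ x)
xorC = ≗-Comp (λ { (a , b) → xor-∧ a b }) (⟨ orC , andC ▸ notC ⟩ ▸ andC)
  where
  xor-∧ : ∀ a b → (a ∨ b) ∧ not (a ∧ b) ≡ a xor b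
  xor-∧ true  b = refl
  xor-∧ false b = 𝔹ₚ.∧-identityʳ b

select : ∀ {A : Set} → Bool → A → A → A
select s l r = if s then r else l

muxC : ∀ u → Comp (bit ⊗ u ⊗ u) u (4 * bits u) (λ { (s , l , r) → select s l r })
muxC bit = ≗-Comp (λ { (s , l , r) → mux-∨ s l r })
  (⟨ ⟨ fstC , sndC ▸ sndC ⟩ ▸ andC , ⟨ fstC ▸ notC , sndC ▸ fstC ⟩ ▸ andC ⟩ ▸ orC)
  where
  mux-∨ : ∀ s l r → (s ∧ r) ∨ (not s ∧ l) ≡ select s l r
  mux-∨ true  l r = 𝔹ₚ.∨-identityʳ r
  mux-∨ false l r = refl
muxC (u ⊗ v) = ≤-Comp (ℕₚ.≤-reflexive (sym (ℕₚ.*-distribˡ-+ 4 (bits u) (bits v))))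
  (≗-Comp (λ { (true , l , r) → refl ; (false , l , r) → refl })
    ⟨ ⟨ fstC , ⟨ sndC ▸ fstC ▸ fstC , sndC ▸ sndC ▸ fstC ⟩ ⟩ ▸ muxC u
    , ⟨ fstC , ⟨ sndC ▸ fstC ▸ sndC , sndC ▸ sndC ▸ sndC ⟩ ⟩ ▸ muxC v ⟩)
muxC (vec u zero) = ≗-Comp (λ { (true , [] , []) → refl ; (false , [] , []) → refl }) nilC
muxC (vec u (suc n)) = ≤-Comp (ℕₚ.≤-reflexive (trans (ℕₚ.+-identityʳ _) (sym (ℕₚ.*-distribˡ-+ 4 (bits u) (n * bits u)))))
  (≗-Comp (λ { (true , _ ∷ _ , _ ∷ _) → refl ; (false , _ ∷ _ , _ ∷ _) → refl })
    (⟨ ⟨ fstC , ⟨ sndC ▸ fstC ▸ headC , sndC ▸ sndC ▸ headC ⟩ ⟩ ▸ muxC u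
     , ⟨ fstC , ⟨ sndC ▸ fstC ▸ tailC , sndC ▸ sndC ▸ tailC ⟩ ⟩ ▸ muxC (vec u n) ⟩ ▸ consC))

bits-table : ∀ u b → bits (table u b) ≡ 2 ^ b * bits u
bits-table u zero    = sym (ℕₚ.+-identityʳ (bits u))
bits-table u (suc b) = trans (cong₂ _+_ (bits-table u b) (bits-table u b)) (lem (2 ^ b) (bits u))
  where
  lem : ∀ x y → x * y + x * y ≡ 2 * x * y
  lem = solve-∀

-- Each index bit halves the table, so the selections cost a geometric sum, linear in the table
-- without a factor b.
getC : ∀ u b → Comp (table u b ⊗ vec bit b) u (4 * (2 ^ b * bits u)) (λ { (t , i) → get u t i })
getC u zero    = ≤-Comp z≤n (≗-Comp (λ { (t , []) → refl }) fstC)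
getC u (suc b) = ≤-Comp (ℕₚ.≤-reflexive (trans (cong (λ z → 4 * z + 0 + 4 * (2 ^ b * bits u)) (bits-table u b)) (lem (2 ^ b) (bits u))))
  (≗-Comp (λ { ((l , r) , (true ∷ i)) → refl ; ((l , r) , (false ∷ i)) → refl })
    (⟨ ⟨ sndC ▸ headC , fstC ⟩ ▸ muxC (table u b) , sndC ▸ tailC ⟩ ▸ getC u b))
  where
  lem : ∀ x y → 4 * (x * y) + 0 + 4 * (x * y) ≡ 4 * (2 * x * y)
  lem = solve-∀

⊞C : ∀ u → Comp (u ⊗ u) u (4 * bits u) (λ { (x , y) → _⊞_ {u} x y })
⊞C bit = xorC
⊞C (u ⊗ v) = ≤-Comp (ℕₚ.≤-reflexive (sym (ℕₚ.*-distribˡ-+ 4 (bits u) (bits v))))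
  (≗-Comp (λ { ((x , x′) , (y , y′)) → refl })
    ⟨ ⟨ fstC ▸ fstC , sndC ▸ fstC ⟩ ▸ ⊞C u , ⟨ fstC ▸ sndC , sndC ▸ sndC ⟩ ▸ ⊞C v ⟩)
⊞C (vec u zero) = ≗-Comp (λ { ([] , []) → refl }) nilC
⊞C (vec u (suc n)) = ≤-Comp (ℕₚ.≤-reflexive (trans (ℕₚ.+-identityʳ _) (sym (ℕₚ.*-distribˡ-+ 4 (bits u) (n * bits u)))))
  (≗-Comp (λ { ((_ ∷ _) , (_ ∷ _)) → refl })
    (⟨ ⟨ fstC ▸ headC , sndC ▸ headC ⟩ ▸ ⊞C u , ⟨ fstC ▸ tailC , sndC ▸ tailC ⟩ ▸ ⊞C (vec u n) ⟩ ▸ consC))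

dotC : ∀ l → Comp (vec bit l ⊗ vec bit l) bit (2 + 5 * l) (λ { (a , x) → dot a x })
dotC zero    = ≗-Comp (λ { ([] , []) → refl }) (bitC false)
dotC (suc l) = ≤-Comp (ℕₚ.≤-reflexive (lem l)) (≗-Comp (λ { ((_ ∷ _) , (_ ∷ _)) → refl })
  (⟨ ⟨ fstC ▸ headC , sndC ▸ headC ⟩ ▸ andC , ⟨ fstC ▸ tailC , sndC ▸ tailC ⟩ ▸ dotC l ⟩ ▸ xorC))
  where
  lem : ∀ l → 1 + (2 + 5 * l) + 4 ≡ 2 + 5 * suc l
  lem = solve-∀

hashC : ∀ l b → Comp (vec (vec bit l) b ⊗ vec bit l) (vec bit b) (b * (2 + 5 * l)) (λ { (A , x) → hash A x })
hashC l zero    = ≗-Comp (λ { ([] , x) → refl }) nilC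
hashC l (suc b) = ≤-Comp (ℕₚ.≤-reflexive (ℕₚ.+-identityʳ _)) (≗-Comp (λ { ((_ ∷ _) , x) → refl })
  (⟨ ⟨ fstC ▸ headC , sndC ⟩ ▸ dotC l , ⟨ fstC ▸ tailC , sndC ⟩ ▸ hashC l b ⟩ ▸ consC))

layerCost : (l b n i : ℕ) → ℕ
layerCost l b n i = b * (2 + 5 * l) + 4 * (2 ^ b * (i + 1)) + n + 8

-- The index is looked up before the gadget is applied, so a layer contains one copy of the gadget
-- and not one per bucket.
generateC : ∀ {l n} b q I {s : El I → Vec Bool l → Bool} →
            Comp (I ⊗ vec bit l) bit n (λ { (y , v) → s y v }) →
            Comp (Seed l b q I ⊗ vec bit l) bit (2 + q * layerCost l b n (bits I)) (λ { (z , v) → generate {b = b} {q} I s z v })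
generateC b zero I S = ≗-Comp (λ { (([] , []) , v) → refl }) (bitC false)
generateC {l} {n} b (suc q) I S = ≤-Comp (ℕₚ.≤-reflexive (lem (b * (2 + 5 * l)) (4 * (2 ^ b * (bits I + 1))) n (q * layerCost l b n (bits I))))
  (≗-Comp (λ { (((_ ∷ _) , (_ ∷ _)) , v) → refl })
    (⟨ ⟨ ⟨ fstC ▸ sndC ▸ headC , ⟨ fstC ▸ fstC ▸ headC , sndC ⟩ ▸ hashC l b ⟩ ▸ getC (I ⊗ bit) b , sndC ⟩
         ▸ ⟨ ⟨ fstC ▸ fstC , sndC ⟩ ▸ S , fstC ▸ sndC ⟩ ▸ xorC
     , ⟨ ⟨ fstC ▸ fstC ▸ tailC , fstC ▸ sndC ▸ tailC ⟩ , sndC ⟩ ▸ generateC b q I S ⟩ ▸ xorC))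
  where
  lem : ∀ h g n r → h + g + 0 + (n + 0) + 4 + (2 + r) + 4 ≡ 2 + (h + g + n + 8 + r)
  lem = solve-∀

combineC : ∀ Z b q → Comp (vec (table Z b) q ⊗ vec (vec bit b) q) Z (2 * bits Z + q * (4 * (2 ^ b * bits Z) + 4 * bits Z))
                       (λ { (ts , is) → combine Z ts is })
combineC Z b zero    = ≤-Comp (ℕₚ.≤-reflexive (sym (ℕₚ.+-identityʳ _))) (≗-Comp (λ { ([] , []) → refl }) (constC Z (⊞-0 Z)))
combineC Z b (suc q) = ≤-Comp (ℕₚ.≤-reflexive (lem (4 * (2 ^ b * bits Z)) (bits Z) (q * (4 * (2 ^ b * bits Z) + 4 * bits Z))))
  (≗-Comp (λ { ((_ ∷ _) , (_ ∷ _)) → refl })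
    (⟨ ⟨ fstC ▸ headC , sndC ▸ headC ⟩ ▸ getC Z b , ⟨ fstC ▸ tailC , sndC ▸ tailC ⟩ ▸ combineC Z b q ⟩ ▸ ⊞C Z))
  where
  lem : ∀ g z r → g + (2 * z + r) + 4 * z ≡ 2 * z + (g + 4 * z + r)
  lem = solve-∀

toCircuit : ∀ {l n} {f : Vec Bool l → Bool} → Fin l → Comp (vec bit l) bit n f →
            Σ (Circuit l) λ D → circuitSize D ≤ n × (∀ x → evalCircuit D x ≡ f x)
toCircuit {l} {f = f} d C with build C d (Data.Vec.allFin l)
... | k , c , o , s , e = circuit c o , s , λ x → trans (e x) (cong f (trans (read-tabulate x id) (Vecₚ.tabulate∘lookup x)))
  where
  read-tabulate : ∀ {k m} (x : Vec Bool k) (g : Fin m → Fin k) →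
                  read x (vec bit m) (Data.Vec.tabulate g) ≡ Data.Vec.tabulate (lookup x ∘ g)
  read-tabulate {m = zero}  x g = refl
  read-tabulate {m = suc m} x g = cong (lookup x (g zero) ∷_) (read-tabulate x (g ∘ suc))

-- The recursion

-- In applications 2^σ exceeds all polylogarithmic parameters, so that every such factor costs σ in the exponent.
record Bound (σ E j a : ℕ) : Set where
  constructor bound
  field
    bounded : a ≤ 2 ^ (E + j * σ)
open Bound

2^-mono : ∀ {x y} → x ≤ y → 2 ^ x ≤ 2 ^ y
2^-mono = ℕₚ.^-monoʳ-≤ 2

module _ {σ : ℕ} where

  bound-≤ : ∀ {E j a b} → a ≤ b → Bound σ E j b → Bound σ E j a
  bound-≤ a≤b (bound h) = bound (ℕₚ.≤-trans a≤b h)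

  bound-weaken : ∀ {E F i j a} → E + i * σ ≤ F + j * σ → Bound σ E i a → Bound σ F j a
  bound-weaken le (bound h) = bound (ℕₚ.≤-trans h (2^-mono le))

  bound-up : ∀ {E F i j a} → E ≤ F → i ≤ j → Bound σ E i a → Bound σ F j a
  bound-up E≤F i≤j = bound-weaken (ℕₚ.+-mono-≤ E≤F (ℕₚ.*-monoˡ-≤ σ i≤j))

  bound-2^ : ∀ E → Bound σ E 0 (2 ^ E)
  bound-2^ E = bound (ℕₚ.≤-reflexive (cong (2 ^_) (sym (ℕₚ.+-identityʳ E))))

  bound-1 : Bound σ 0 0 1
  bound-1 = bound ℕₚ.≤-refl

  bound-* : ∀ {E F i j a b} → Bound σ E i a → Bound σ F j b → Bound σ (E + F) (i + j) (a * b)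
  bound-* {E} {F} {i} {j} (bound h) (bound h′) = bound (ℕₚ.≤-trans (ℕₚ.*-mono-≤ h h′) (ℕₚ.≤-reflexive
    (trans (sym (ℕₚ.^-distribˡ-+-* 2 (E + i * σ) (F + j * σ))) (cong (2 ^_) (lem E F i j σ)))))
    where
    lem : ∀ E F i j σ → (E + i * σ) + (F + j * σ) ≡ (E + F) + (i + j) * σ
    lem = solve-∀

  bound-scale : ∀ {F i j a b} → Bound σ 0 i a → Bound σ F j b → Bound σ F (i + j) (a * b)
  bound-scale = bound-*

  module _ (6≤σ : 6 ≤ σ) where

    -- Addition at most doubles the common bound, and the 2 is absorbed by one more factor 2^σ.
    bound-+ : ∀ {E i a b} → Bound σ E i a → Bound σ E i b → Bound σ E (suc i) (a + b)
    bound-+ {E} {i} {a} {b} (bound h) (bound h′) = bound (begin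
      a + b                                  ≤⟨ ℕₚ.+-mono-≤ h h′ ⟩
      2 ^ (E + i * σ) + 2 ^ (E + i * σ)      ≡⟨ cong (λ z → 2 ^ (E + i * σ) + z) (ℕₚ.+-identityʳ _) ⟨
      2 ^ (1 + (E + i * σ))                  ≤⟨ 2^-mono (ℕₚ.+-monoˡ-≤ (E + i * σ) (ℕₚ.≤-trans (s≤s z≤n) 6≤σ)) ⟩
      2 ^ (σ + (E + i * σ))                  ≡⟨ cong (2 ^_) (lem E i σ) ⟩
      2 ^ (E + suc i * σ)                    ∎)
      where
      open ℕₚ.≤-Reasoning
      lem : ∀ E i σ → σ + (E + i * σ) ≡ E + (σ + i * σ)
      lem = solve-∀

    bound-num : ∀ c {_ : True (c ≤? 64)} → Bound σ 0 1 c
    bound-num c {h} = bound (ℕₚ.≤-trans (toWitness h) (ℕₚ.≤-trans (2^-mono 6≤σ) (ℕₚ.≤-reflexive (cong (2 ^_) (sym (ℕₚ.+-identityʳ σ))))))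

    bound-shift : ∀ {E j a} c {_ : True (c ≤? 6)} → Bound σ (c + E) j a → Bound σ E (suc j) a
    bound-shift {E} {j} c {h} = bound-weaken (begin
      c + E + j * σ   ≤⟨ ℕₚ.+-monoˡ-≤ (j * σ) (ℕₚ.+-monoˡ-≤ E (ℕₚ.≤-trans (toWitness h) 6≤σ)) ⟩
      σ + E + j * σ   ≡⟨ lem E j σ ⟩
      E + suc j * σ   ∎)
      where
      open ℕₚ.≤-Reasoning
      lem : ∀ E j σ → σ + E + j * σ ≡ E + (σ + j * σ)
      lem = solve-∀

bound-small : ∀ {σ a} → a ≤ 2 ^ σ → Bound σ 0 1 a
bound-small {σ} h = bound (subst (λ z → _ ≤ 2 ^ z) (sym (ℕₚ.+-identityʳ σ)) h)

raise : ∀ {i j} {_ : True (i ≤? j)} → i ≤ j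
raise {_} {_} {h} = toWitness h

module _ {σ} (6≤σ : 6 ≤ σ) where

  -- The 4^μ gates dominate; they are the source of the m² in the length of the lists.
  bound-code : ∀ l μ → l ≤ 2 ^ σ → μ ≤ 2 ^ σ → Bound σ (2 * μ) 6 (bits (code l μ))
  bound-code l μ l≤ μ≤ = add one (add one (add gates (add labels out)))
    where
    add : ∀ {E i a b} → Bound σ E i a → Bound σ E i b → Bound σ E (suc i) (a + b)
    add = bound-+ 6≤σ
    eq : μ + μ ≡ 2 * μ
    eq = cong (λ z → μ + z) (sym (ℕₚ.+-identityʳ μ))
    one : ∀ {j} → Bound σ (2 * μ) j 1
    one = bound-up z≤n z≤n bound-1
    wires : Bound σ 0 1 (μ * 1)
    wires = bound-scale (bound-small μ≤) bound-1
    gates : Bound σ (2 * μ) 3 (2 ^ μ * 2 ^ μ * (μ * 1 + μ * 1))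
    gates = bound-up (ℕₚ.≤-reflexive (trans (ℕₚ.+-identityʳ _) eq)) raise (bound-* (bound-* (bound-2^ μ) (bound-2^ μ)) (add wires wires))
    labels : Bound σ (2 * μ) 2 (2 ^ μ * (l * 1 + 1))
    labels = bound-up (ℕₚ.≤-trans (ℕₚ.≤-reflexive (ℕₚ.+-identityʳ μ)) (ℕₚ.m≤m+n μ (μ + 0))) ℕₚ.≤-refl
      (bound-* (bound-2^ μ) (add (bound-scale (bound-small l≤) bound-1) (bound-up z≤n raise bound-1)))
    out : Bound σ (2 * μ) 2 (μ * 1)
    out = bound-up z≤n raise wires

  bound-seed : ∀ l b q I {G} → l ≤ 2 ^ σ → b ≤ 2 ^ σ → q ≤ 2 ^ σ → Bound σ 0 2 (bits I) → Bound σ G 1 (2 ^ b) →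
               Bound σ G 6 (bits (Seed l b q I))
  bound-seed l b q I {G} l≤ b≤ q≤ I≤ 2^b≤ = bound-+ 6≤σ
    (bound-up z≤n raise (bound-* (bound-small q≤) (bound-* (bound-small b≤) (bound-* (bound-small l≤) bound-1))))
    (bound-scale (bound-small q≤) (bound-≤ (ℕₚ.≤-reflexive (bits-table (I ⊗ bit) b))
      (bound-weaken (ℕₚ.≤-reflexive (cong (_+ 4 * σ) (ℕₚ.+-identityʳ G)))
        (bound-* 2^b≤ (bound-+ 6≤σ I≤ (bound-up z≤n raise bound-1))))))

  bound-generate : ∀ l b q I n {G F J} → l ≤ 2 ^ σ → b ≤ 2 ^ σ → q ≤ 2 ^ σ → Bound σ 0 2 (bits I) → Bound σ G 1 (2 ^ b) →
                   G ≤ F → 6 ≤ J → Bound σ F J n →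
                   Bound σ F (4 + J) (2 + q * layerCost l b n (bits I))
  bound-generate l b q I n {G} {F} {J} l≤ b≤ q≤ I≤ 2^b≤ G≤F 6≤J n≤ =
    add (up z≤n (ℕₚ.≤-trans raise (ℕₚ.+-monoʳ-≤ 3 6≤J)) (num 2)) (bound-scale (bound-small q≤)
      (add (add (bound-up G≤F 6≤J tables) n≤) (up z≤n (ℕₚ.≤-trans raise (ℕₚ.+-monoʳ-≤ 1 6≤J)) (num 8))))
    where
    add : ∀ {E i a b} → Bound σ E i a → Bound σ E i b → Bound σ E (suc i) (a + b)
    add = bound-+ 6≤σ
    up : ∀ {E F i j a} → E ≤ F → i ≤ j → Bound σ E i a → Bound σ F j a
    up = bound-up
    num : ∀ c {_ : True (c ≤? 64)} → Bound σ 0 1 c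
    num c {h} = bound-num 6≤σ c {h}
    tables : Bound σ G 6 (b * (2 + 5 * l) + 4 * (2 ^ b * (bits I + 1)))
    tables = add
      (up z≤n raise (bound-scale (bound-small b≤) (add (up z≤n raise (num 2)) (bound-scale (num 5) (bound-small l≤)))))
      (bound-scale (num 4) (bound-weaken (ℕₚ.≤-reflexive (cong (_+ 4 * σ) (ℕₚ.+-identityʳ G)))
        (bound-* 2^b≤ (add I≤ (up z≤n raise bound-1)))))

  bound-combine : ∀ Z B q {E} → q ≤ 2 ^ σ → Bound σ E 15 (2 ^ B * bits Z) → Bound σ E 6 (bits Z) →
                  Bound σ E 20 (2 * bits (vec (table Z B) q) + (2 * bits Z + q * (4 * (2 ^ B * bits Z) + 4 * bits Z)))
  bound-combine Z B q q≤ X≤ Z≤ = add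
    (bound-up ℕₚ.≤-refl raise (bound-scale (num 2) (bound-scale (bound-small q≤) (bound-≤ (ℕₚ.≤-reflexive (bits-table Z B)) X≤))))
    (add (bound-up ℕₚ.≤-refl raise (bound-scale (num 2) Z≤))
         (bound-scale (bound-small q≤) (add (bound-scale (num 4) X≤) (bound-up ℕₚ.≤-refl raise (bound-scale (num 4) Z≤)))))
    where
    add : ∀ {E i a b} → Bound σ E i a → Bound σ E i b → Bound σ E (suc i) (a + b)
    add = bound-+ 6≤σ
    num : ∀ c {_ : True (c ≤? 64)} → Bound σ 0 1 c
    num c {h} = bound-num 6≤σ c {h}

generate-foolsClass : ∀ {l} μ′ μ b q I (s : El I → Vec Bool l → Bool) ε → 0ℚ ≤ℚ ε → FoolsClass l μ I s ε →
                      4 * 2 ^ μ′ ≤ 2 ^ μ * 2 ^ b →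
                      FoolsClass l μ′ (Seed l b q I) (generate {b = b} {q} I s) (p2 l *ℚ ε +ℚ p2 l *ℚ ½^ q)
generate-foolsClass {l} μ′ μ b q I s ε 0≤ε fools h (false , c , gs , ls , o) =
  generate-fools μ b q I s (codeCirc μ′ gs ls o) ε 0≤ε fools h
generate-foolsClass {l} μ′ μ b q I s ε 0≤ε fools h (true , c , gs , ls , o) =
  Close-resp (sym (𝔼-const (Seed l b q I) (ind c))) (sym (𝔼-const (table bit l) (ind c)))
    (Close-refl (ℚₚ.+-mono-≤ {0ℚ} {_} {0ℚ} (0≤* (0≤p2 l) 0≤ε) (0≤* (0≤p2 l) (0≤½^ q))))

½^-antimono : ∀ {m n} → m ≤ n → ½^ n ≤ℚ ½^ m
½^-antimono {m} m≤n with ℕₚ.m≤n⇒∃[o]m+o≡n m≤n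
... | k , refl = subst₂ _≤ℚ_ (sym (½^-+ m k)) (ℚₚ.*-identityʳ (½^ m))
      (ℚₚ.*-monoˡ-≤-nonNeg (½^ m) {{nonNegative (0≤½^ m)}} (½^≤1 k))

p2*½^ : ∀ l t → p2 l *ℚ ½^ (l + t) ≡ ½^ t
p2*½^ l t = begin
  p2 l *ℚ ½^ (l + t)         ≡⟨ cong (p2 l *ℚ_) (½^-+ l t) ⟩
  p2 l *ℚ (½^ l *ℚ ½^ t)     ≡⟨ ℚₚ.*-assoc (p2 l) (½^ l) (½^ t) ⟨
  (p2 l *ℚ ½^ l) *ℚ ½^ t     ≡⟨ cong (_*ℚ ½^ t) (p2-½^ l) ⟩
  1ℚ *ℚ ½^ t                 ≡⟨ ℚₚ.*-identityˡ (½^ t) ⟩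
  ½^ t                       ∎
  where open ≡-Reasoning

½^-double : ∀ t → ½^ (suc t) +ℚ ½^ (suc t) ≡ ½^ t
½^-double t = solve 1 (λ x → con ½ :* x :+ con ½ :* x := x) refl (½^ t)

-- The union over 2^l names is paid for with l bits of accuracy, and the sum of the two terms with
-- one more.
stage-error : ∀ l t q → l + suc t ≤ q → p2 l *ℚ ½^ (l + suc t) +ℚ p2 l *ℚ ½^ q ≤ℚ ½^ t
stage-error l t q h = ℚₚ.≤-trans (ℚₚ.+-monoʳ-≤ (p2 l *ℚ ½^ (l + suc t))
    (ℚₚ.*-monoˡ-≤-nonNeg (p2 l) {{nonNegative (0≤p2 l)}} (½^-antimono h)))
  (ℚₚ.≤-reflexive (trans (cong₂ _+ℚ_ (p2*½^ l (suc t)) (p2*½^ l (suc t))) (½^-double t)))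

-- The index only points into the lists and stays polylogarithmic, while the circuit carries the
-- lists. In all uses E is 2μ + e.
record Gadget (l μ t σ E : ℕ) : Set where
  field
    I     : U
    s     : El I → Vec Bool l → Bool
    short : Bound σ 0 2 (bits I)
    n     : ℕ
    comp  : Comp (I ⊗ vec bit l) bit n (λ { (y , v) → s y v })
    cheap : Bound σ E 24 n
    fools : FoolsClass l μ I s (½^ t)

module _ (l e q L σ : ℕ) (6≤σ : 6 ≤ σ) (l≤ : l ≤ 2 ^ σ) (q≤ : q ≤ 2 ^ σ)
         (room : 5 + (2 * (L * e) + 8 * σ) ≤ 2 ^ σ) (4σ≤e : 4 * σ ≤ e) where

  -- A circuit on one wire reads a single variable, so one bit shared by all variables is perfect.
  coin : ∀ t → Gadget l 0 t σ (2 * 0 + e)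
  coin t = record
    { I = bit ; s = λ y v → y
    ; short = bound-up z≤n z≤n bound-1
    ; n = 0 ; comp = fstC ; cheap = bound z≤n
    ; fools = coin-fools }
    where
    coin-fools : FoolsClass l 0 bit (λ y v → y) (½^ t)
    coin-fools (true , c , gs , ls , o) =
      Close-resp (sym (𝔼-const bit (ind c))) (sym (𝔼-const (table bit l) (ind c))) (Close-refl (0≤½^ t))
    coin-fools (false , c , gs , ls , o) = Close-resp
      refl (trans (sym (𝔼-get bit v₀ g)) (𝔼-cong (table bit l) λ a → cong ind (eval-only a))) (Close-refl (0≤½^ t))
      where
      circ = codeCirc 0 gs ls o
      v₀ : Vec Bool l
      v₀ = proj₁ (lookup ls zero)
      g : Bool → ℚ
      g y = ind (eval circ (λ _ → y))
      eval-only : ∀ a → eval circ (λ _ → get bit a v₀) ≡ eval circ (get bit a)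
      eval-only a = trans (eval-unfold circ (λ _ → get bit a v₀)) (trans
        (cong (λ w → lookup (run w (Circ.gates circ)) (Circ.out circ)) (Vecₚ.tabulate-cong {n = 1} {f = literal (λ _ → get bit a v₀) ∘ Circ.label circ} {g = literal (get bit a) ∘ Circ.label circ} λ { zero → refl }))
        (sym (eval-unfold circ (get bit a))))

  advance : ∀ i t → suc i ≤ L → l + suc (suc t) ≤ q → Gadget l (i * e) (l + suc (suc t)) σ (2 * (i * e) + e) →
            Gadget l (suc i * e) t σ (2 * (suc i * e) + e)
  advance i t i<L t≤ g = record
    { I = I′ ; s = s′ ; short = short′
    ; n = _ ; comp = comp′ ; cheap = cheap′ ; fools = fools′ }
    where
    open Gadget g
    open ℕₚ.≤-Reasoning
    μ′ b β B : ℕ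
    μ′ = suc i * e
    -- The 2 provides the factor 4 of the Markov bound: 4 · 2^μ′ = 2^(i * e) · 2^b.
    b  = 2 + e
    -- `bits A` and `bits Z` are both at most 2^(2 * μ′ + 6 * σ), and the two additions in `size≤`
    -- cost one σ each.
    β  = 2 * μ′ + 8 * σ
    B  = 5 + β
    Z A I′ : U
    Z  = Seed l b q I
    A  = code l μ′
    I′ = vec (vec bit B) q
    e≤μ′ : e ≤ μ′
    e≤μ′ = ℕₚ.m≤m+n e (i * e)
    μ′≤2μ′ : μ′ ≤ 2 * μ′
    μ′≤2μ′ = ℕₚ.m≤m+n μ′ (μ′ + 0)
    μ′≤Le : μ′ ≤ L * e
    μ′≤Le = ℕₚ.*-monoˡ-≤ e i<L
    B≤ : B ≤ 2 ^ σ
    B≤ = ℕₚ.≤-trans (ℕₚ.+-monoʳ-≤ 5 (ℕₚ.+-monoˡ-≤ (8 * σ) (ℕₚ.*-monoʳ-≤ 2 μ′≤Le))) room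
    2μ′≤B : 2 * μ′ ≤ B
    2μ′≤B = ℕₚ.≤-trans (ℕₚ.m≤m+n (2 * μ′) (8 * σ)) (ℕₚ.m≤n+m β 5)
    μ′≤ : μ′ ≤ 2 ^ σ
    μ′≤ = ℕₚ.≤-trans μ′≤2μ′ (ℕₚ.≤-trans 2μ′≤B B≤)
    b≤ : b ≤ 2 ^ σ
    b≤ = ℕₚ.≤-trans (ℕₚ.+-mono-≤ {2} {5} raise
           (ℕₚ.≤-trans e≤μ′ (ℕₚ.≤-trans μ′≤2μ′ (ℕₚ.m≤m+n (2 * μ′) (8 * σ))))) B≤
    2^b≤ : Bound σ e 1 (2 ^ b)
    2^b≤ = bound-shift 6≤σ 2 (bound-2^ b)
    Z≤ : Bound σ e 6 (bits Z)
    Z≤ = bound-seed 6≤σ l b q I l≤ b≤ q≤ short 2^b≤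
    size≤ : bits A + bits Z + 2 ≤ 2 ^ β
    size≤ = Bound.bounded (bound-+ 6≤σ (bound-+ 6≤σ (bound-code 6≤σ l μ′ l≤ μ′≤)
              (bound-up (ℕₚ.≤-trans e≤μ′ μ′≤2μ′) ℕₚ.≤-refl Z≤)) (bound-up z≤n raise (bound-num 6≤σ 2)))
    gen : El Z → Vec Bool l → Bool
    gen = generate {b = b} {q} I s
    φ : El A → El Z → ℚ
    φ d z = ind (evalCode l μ′ d (gen z))
    sampled = samples A Z β q φ (λ d z → 0≤ind (evalCode l μ′ d (gen z)) , ind≤1 (evalCode l μ′ d (gen z))) size≤
    ts : Vec (El (table Z B)) q
    ts = proj₁ sampled
    s′ : El I′ → Vec Bool l → Bool
    s′ is = gen (combine Z ts is)
    short′ : Bound σ 0 2 (bits I′)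
    short′ = bound-scale (bound-small q≤) (bound-scale (bound-small B≤) bound-1)
    comp′ : Comp (I′ ⊗ vec bit l) bit
              (((2 * bits (vec (table Z B) q) + 0) + (2 * bits Z + q * (4 * (2 ^ B * bits Z) + 4 * bits Z)) + 0)
                + (2 + q * layerCost l b n (bits I)))
              (λ { (y , v) → s′ y v })
    comp′ = ⟨ ⟨ constC (vec (table Z B) q) ts , fstC ⟩ ▸ combineC Z B q , sndC ⟩ ▸ generateC b q I comp
    E = 2 * μ′ + e
    cheap′ : Bound σ E 24 _
    cheap′ = bound-up ℕₚ.≤-refl raise (bound-+ 6≤σ
      (bound-≤ (ℕₚ.≤-reflexive (trans (ℕₚ.+-identityʳ _)
         (cong (_+ (2 * bits Z + q * (4 * (2 ^ B * bits Z) + 4 * bits Z))) (ℕₚ.+-identityʳ (2 * bits (vec (table Z B) q))))))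
        (bound-combine 6≤σ Z B q q≤
          (bound-* {i = 9} (bound-weaken (ℕₚ.≤-reflexive (lem₁ (2 * μ′) σ)) (bound-shift 6≤σ 5 {_} (bound-2^ B))) Z≤)
          (bound-up (ℕₚ.m≤n+m e (2 * μ′)) ℕₚ.≤-refl Z≤)))
      (bound-weaken shrink
        (bound-generate 6≤σ l b q I n l≤ b≤ q≤ short 2^b≤ (ℕₚ.m≤n+m e (2 * (i * e))) raise cheap)))
      where
      lem₁ : ∀ m σ → (m + 8 * σ) + 1 * σ ≡ m + 9 * σ
      lem₁ = solve-∀
      lem₂ : ∀ i e σ → (2 * (i * e) + e) + 28 * σ ≡ (2 * (i * e) + e) + 20 * σ + 2 * (4 * σ)
      lem₂ = solve-∀
      lem₃ : ∀ i e σ → (2 * (i * e) + e) + 20 * σ + 2 * e ≡ (2 * (e + i * e) + e) + 20 * σ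
      lem₃ = solve-∀
      -- The circuit around the old gadget has 24 + 4 factors 2^σ. The new exponent is larger by 2e,
      -- which is at least 8σ and brings them down to the 20 of the lists; so 24 reproduces itself.
      shrink : (2 * (i * e) + e) + 28 * σ ≤ E + 20 * σ
      shrink = begin
        (2 * (i * e) + e) + 28 * σ                     ≡⟨ lem₂ i e σ ⟩
        (2 * (i * e) + e) + 20 * σ + 2 * (4 * σ)       ≤⟨ ℕₚ.+-monoʳ-≤ ((2 * (i * e) + e) + 20 * σ) (ℕₚ.*-monoʳ-≤ 2 4σ≤e) ⟩
        (2 * (i * e) + e) + 20 * σ + 2 * e             ≡⟨ lem₃ i e σ ⟩
        E + 20 * σ                                     ∎
    4m′≤ : 4 * 2 ^ μ′ ≤ 2 ^ (i * e) * 2 ^ b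
    4m′≤ = ℕₚ.≤-reflexive (trans (cong (4 *_) (ℕₚ.^-distribˡ-+-* 2 e (i * e))) (lem (2 ^ e) (2 ^ (i * e))))
      where
      lem : ∀ x y → 4 * (x * y) ≡ y * (2 * (2 * x))
      lem = solve-∀
    fools′ : FoolsClass l μ′ I′ s′ (½^ t)
    fools′ d = Close-mono total (Close-trans (proj₂ sampled d)
      (generate-foolsClass μ′ (i * e) b q I s (½^ (l + suc (suc t))) (0≤½^ (l + suc (suc t))) fools 4m′≤ d))
      where
      -- The sampling error and the error of the generator get half of the allowance each.
      total : ½^ q +ℚ (p2 l *ℚ ½^ (l + suc (suc t)) +ℚ p2 l *ℚ ½^ q) ≤ℚ ½^ t
      total = ℚₚ.≤-trans
        (ℚₚ.+-mono-≤ (½^-antimono (ℕₚ.≤-trans (ℕₚ.≤-trans (ℕₚ.n≤1+n (suc t)) (ℕₚ.m≤n+m (suc (suc t)) l)) t≤)) (stage-error l (suc t) q t≤))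
        (ℚₚ.≤-reflexive (½^-double t))

  gadget : ∀ i t → i ≤ L → t + i * (l + 2) ≤ q → Gadget l (i * e) t σ (2 * (i * e) + e)
  gadget zero    t _   _  = coin t
  gadget (suc i) t i<L t≤ = advance i t i<L (ℕₚ.≤-trans (ℕₚ.m≤m+n _ (i * (l + 2))) (ℕₚ.≤-trans (ℕₚ.≤-reflexive (lem l t i)) t≤))
      (gadget i (l + suc (suc t)) (ℕₚ.<⇒≤ i<L) (ℕₚ.≤-trans (ℕₚ.≤-reflexive (lem l t i)) t≤))
    where
    lem : ∀ l t i → l + suc (suc t) + i * (l + 2) ≡ t + (l + 2 + i * (l + 2))
    lem = solve-∀

-- Probabilities and powers of two

fraction : ∀ c d .{{_ : NonZero d}} → (+ c / d) *ℚ fromℕ d ≡ fromℕ c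
fraction c (suc d) = ℚₚ.toℚᵘ-injective (begin
  toℚᵘ ((+ c / suc d) *ℚ fromℕ (suc d))         ≈⟨ ℚₚ.toℚᵘ-homo-* (+ c / suc d) (fromℕ (suc d)) ⟩
  toℚᵘ (+ c / suc d) ℚᵘ.* toℚᵘ (fromℕ (suc d))  ≈⟨ ℚᵘₚ.*-cong (ℚₚ.toℚᵘ-fromℚᵘ (mkℚᵘ (+ c) d)) (toℚᵘ-fromℕ (suc d)) ⟩
  mkℚᵘ (+ c) d ℚᵘ.* mkℚᵘ (+ suc d) 0            ≈⟨ *≡* (cancel (+ c) (+ suc d)) ⟩
  mkℚᵘ (+ c) 0                                  ≈⟨ toℚᵘ-fromℕ c ⟨
  toℚᵘ (fromℕ c)                                ∎)
  where
  open ℚᵘₚ.≃-Reasoning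
  cancel : ∀ x y → (x ℤ.* y) ℤ.* + 1 ≡ x ℤ.* (y ℤ.* + 1)
  cancel = ℤ-Solver.solve-∀
  unit : ∀ x → (+ 1 ℤ.* + 1 ℤ.+ x ℤ.* + 1) ℤ.* + 1 ≡ (+ 1 ℤ.+ x) ℤ.* (+ 1 ℤ.* + 1)
  unit = ℤ-Solver.solve-∀
  toℚᵘ-fromℕ : ∀ n → toℚᵘ (fromℕ n) ℚᵘ.≃ mkℚᵘ (+ n) 0
  toℚᵘ-fromℕ zero    = *≡* refl
  toℚᵘ-fromℕ (suc n) = begin
    toℚᵘ (1ℚ +ℚ fromℕ n)          ≈⟨ ℚₚ.toℚᵘ-homo-+ 1ℚ (fromℕ n) ⟩
    toℚᵘ 1ℚ ℚᵘ.+ toℚᵘ (fromℕ n)   ≈⟨ ℚᵘₚ.+-congʳ (toℚᵘ 1ℚ) (toℚᵘ-fromℕ n) ⟩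
    mkℚᵘ (+ 1) 0 ℚᵘ.+ mkℚᵘ (+ n) 0 ≈⟨ *≡* (unit (+ n)) ⟩
    mkℚᵘ (+ suc n) 0              ∎

countTrue-∷ : ∀ {m} (f : Vec Bool m → Bool) x xs → countTrue f (x ∷ xs) ≡ toℕᵇ (f x) + countTrue f xs
countTrue-∷ f x xs with f x
... | true  = refl
... | false = refl

countTrue-suc : ∀ {m} (f : Vec Bool (suc m) → Bool) xs →
                countTrue f (Data.List.concatMap (λ v → (false ∷ v) ∷ (true ∷ v) ∷ []) xs) ≡
                countTrue (f ∘ (false ∷_)) xs + countTrue (f ∘ (true ∷_)) xs
countTrue-suc f []       = refl
countTrue-suc f (x ∷ xs) = begin
  countTrue f ((false ∷ x) ∷ (true ∷ x) ∷ rest)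
    ≡⟨ trans (countTrue-∷ f (false ∷ x) ((true ∷ x) ∷ rest)) (cong (λ z → f₀ x + z) (countTrue-∷ f (true ∷ x) rest)) ⟩
  f₀ x + (f₁ x + countTrue f rest)
    ≡⟨ cong (λ z → f₀ x + (f₁ x + z)) (countTrue-suc f xs) ⟩
  f₀ x + (f₁ x + (countTrue (f ∘ (false ∷_)) xs + countTrue (f ∘ (true ∷_)) xs))
    ≡⟨ lem (f₀ x) (f₁ x) _ _ ⟩
  (f₀ x + countTrue (f ∘ (false ∷_)) xs) + (f₁ x + countTrue (f ∘ (true ∷_)) xs)
    ≡⟨ cong₂ _+_ (countTrue-∷ (f ∘ (false ∷_)) x xs) (countTrue-∷ (f ∘ (true ∷_)) x xs) ⟨
  countTrue (f ∘ (false ∷_)) (x ∷ xs) + countTrue (f ∘ (true ∷_)) (x ∷ xs) ∎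
  where
  open ≡-Reasoning
  f₀ f₁ : _ → ℕ
  f₀ x = toℕᵇ (f (false ∷ x))
  f₁ x = toℕᵇ (f (true ∷ x))
  rest = Data.List.concatMap (λ v → (false ∷ v) ∷ (true ∷ v) ∷ []) xs
  lem : ∀ a b c d → a + (b + (c + d)) ≡ (a + c) + (b + d)
  lem = solve-∀

countTrue-𝔼 : ∀ m (f : Vec Bool m → Bool) → fromℕ (countTrue f (allVecs m)) ≡ p2 m *ℚ 𝔼 (vec bit m) (ind ∘ f)
countTrue-𝔼 zero f with f []
... | true  = refl
... | false = refl
countTrue-𝔼 (suc m) f = begin
  fromℕ (countTrue f (allVecs (suc m)))
    ≡⟨ trans (cong fromℕ (countTrue-suc f (allVecs m))) (fromℕ-+ (countTrue (f ∘ (false ∷_)) (allVecs m)) _) ⟩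
  fromℕ (countTrue (f ∘ (false ∷_)) (allVecs m)) +ℚ fromℕ (countTrue (f ∘ (true ∷_)) (allVecs m))
    ≡⟨ cong₂ _+ℚ_ (countTrue-𝔼 m (f ∘ (false ∷_))) (countTrue-𝔼 m (f ∘ (true ∷_))) ⟩
  p2 m *ℚ x +ℚ p2 m *ℚ y
    ≡⟨ solve 3 (λ p x y → p :* x :+ p :* y := (p :+ p) :* (con ½ :* (x :+ y))) refl (p2 m) x y ⟩
  p2 (suc m) *ℚ 𝔼 (vec bit (suc m)) (ind ∘ f) ∎
  where
  open ≡-Reasoning
  x = 𝔼 (vec bit m) (ind ∘ f ∘ (false ∷_))
  y = 𝔼 (vec bit m) (ind ∘ f ∘ (true ∷_))

Pr≡𝔼 : ∀ m (f : Vec Bool m → Bool) → Pr m f ≡ 𝔼 (vec bit m) (ind ∘ f)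
Pr≡𝔼 m f = begin
  Pr m f                              ≡⟨ ℚₚ.*-identityʳ (Pr m f) ⟨
  Pr m f *ℚ 1ℚ                        ≡⟨ cong (Pr m f *ℚ_) (p2-½^ m) ⟨
  Pr m f *ℚ (p2 m *ℚ ½^ m)            ≡⟨ ℚₚ.*-assoc (Pr m f) (p2 m) (½^ m) ⟨
  (Pr m f *ℚ p2 m) *ℚ ½^ m            ≡⟨ cong (_*ℚ ½^ m) (begin
    Pr m f *ℚ p2 m                    ≡⟨ cong (Pr m f *ℚ_) (fromℕ-2^ m) ⟨
    Pr m f *ℚ fromℕ (2 ^ m)           ≡⟨ fraction (countTrue f (allVecs m)) (2 ^ m) {{ℕₚ.m^n≢0 2 m}} ⟩
    fromℕ (countTrue f (allVecs m))   ≡⟨ countTrue-𝔼 m f ⟩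
    p2 m *ℚ e                         ∎) ⟩
  (p2 m *ℚ e) *ℚ ½^ m                 ≡⟨ solve 3 (λ p e h → (p :* e) :* h := (p :* h) :* e) refl (p2 m) e (½^ m) ⟩
  (p2 m *ℚ ½^ m) *ℚ e                 ≡⟨ cong (_*ℚ e) (p2-½^ m) ⟩
  1ℚ *ℚ e                             ≡⟨ ℚₚ.*-identityˡ e ⟩
  e                                   ∎
  where
  open ≡-Reasoning
  e = 𝔼 (vec bit m) (ind ∘ f)

Close⇒∣-∣≤ : ∀ {ε a b} → Close ε a b → ∣ a -ℚ b ∣ℚ ≤ℚ ε
Close⇒∣-∣≤ {ε} {a} {b} (a≤ , b≤) with ℚₚ.∣p∣≡p∨∣p∣≡-p (a -ℚ b)
... | inj₁ e = subst (_≤ℚ ε) (sym e) (0≤b-a⇒a≤b (subst (0ℚ ≤ℚ_)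
      (solve 3 (λ a b ε → (b :+ ε) :- a := ε :- (a :- b)) refl a b ε) (a≤b⇒0≤b-a a≤)))
... | inj₂ e = subst (_≤ℚ ε) (sym e) (0≤b-a⇒a≤b (subst (0ℚ ≤ℚ_)
      (solve 3 (λ a b ε → (a :+ ε) :- b := ε :- (:- (a :- b))) refl a b ε) (a≤b⇒0≤b-a b≤)))

-- Relates a uniform assignment to all 2^l names to a uniform input of n bits: resampling the entry
-- of the first name leaves those of the other names alone.
𝔼-gets : ∀ {l} n (name : Fin n → Vec Bool l) → (∀ i j → name i ≡ name j → i ≡ j) → (f : Vec Bool n → ℚ) →
         (𝔼 (table bit l) λ a → f (Data.Vec.tabulate (get bit a ∘ name))) ≡ 𝔼 (vec bit n) f
𝔼-gets {l} zero    name inj f = 𝔼-const (table bit l) (f [])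
𝔼-gets {l} (suc n) name inj f = begin
  (𝔼 T λ a → f (Data.Vec.tabulate (get bit a ∘ name)))
    ≡⟨ 𝔼-resample bit (name zero) _ ⟩
  (𝔼 T λ a → 𝔼 bit λ y → f (Data.Vec.tabulate (get bit (set bit a (name zero) y) ∘ name)))
    ≡⟨ 𝔼-cong T (λ a → 𝔼-cong bit λ y → cong f (cong₂ _∷_ (get-set bit a (name zero) y)
         (Vecₚ.tabulate-cong λ i → get-set-≢ bit a y λ e → zero≢suc (inj zero (suc i) e)))) ⟩
  (𝔼 T λ a → 𝔼 bit λ y → f (y ∷ Data.Vec.tabulate (get bit a ∘ name ∘ suc)))
    ≡⟨ 𝔼-swap T bit (λ a y → f (y ∷ Data.Vec.tabulate (get bit a ∘ name ∘ suc))) ⟩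
  (𝔼 bit λ y → 𝔼 T λ a → f (y ∷ Data.Vec.tabulate (get bit a ∘ name ∘ suc)))
    ≡⟨ 𝔼-cong bit (λ y → 𝔼-gets n (name ∘ suc) (λ i j e → Finₚ.suc-injective (inj (suc i) (suc j) e)) (λ v → f (y ∷ v))) ⟩
  𝔼 (vec bit (suc n)) f ∎
  where
  open ≡-Reasoning
  T = table bit l
  zero≢suc : ∀ {i : Fin n} → _≢_ {A = Fin (suc n)} zero (suc i)
  zero≢suc ()

fromComp : ∀ {n ℓ} l → CompCircuit n ℓ → Circ (Vec Bool l) ℓ
fromComp l C = record
  { label = λ i → toBits l (toℕ (Literal.var (labels i))) , not (Literal.positive (labels i))
  ; gates = Data.List.map (λ g → CompGate.w₁ g , CompGate.w₂ g) gates
  ; out   = output }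
  where open CompCircuit C

eval-fromComp : ∀ {n ℓ} l (C : CompCircuit n ℓ) (a : Vec Bool l → Bool) →
                evalComp C (Data.Vec.tabulate (a ∘ toBits l ∘ toℕ)) ≡ eval (fromComp l C) a
eval-fromComp {n} l C a = sym (trans (eval-unfold (fromComp l C) a) (cong (λ w → lookup w output)
  (trans (cong (λ w → run w (Circ.gates (fromComp l C))) (init labels)) (run-map _ gates))))
  where
  open CompCircuit C
  x : Vec Bool n
  x = Data.Vec.tabulate (a ∘ toBits l ∘ toℕ)
  init : ∀ {ℓ} (lab : Fin ℓ → Literal n) →
         Data.Vec.tabulate (λ i → a (toBits l (toℕ (Literal.var (lab i)))) xor not (Literal.positive (lab i))) ≡ initWires lab x
  init {zero}  lab = refl
  init {suc ℓ} lab = cong₂ _∷_ (first (lab zero)) (init (lab ∘ suc))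
    where
    first : ∀ t → a (toBits l (toℕ (Literal.var t))) xor not (Literal.positive t) ≡ evalLit t x
    first (lit i true)  = trans (𝔹ₚ.xor-identityʳ _) (sym (Vecₚ.lookup∘tabulate (a ∘ toBits l ∘ toℕ) i))
    first (lit i false) = trans (𝔹ₚ.xor-comm _ true) (cong not (sym (Vecₚ.lookup∘tabulate (a ∘ toBits l ∘ toℕ) i)))
  run-map : ∀ {ℓ} (w : Vec Bool ℓ) gs → run w (Data.List.map (λ g → CompGate.w₁ g , CompGate.w₂ g) gs) ≡ foldl applyGate w gs
  run-map w []                = refl
  run-map w (gate i j _ ∷ gs) = run-map (step w (i , j)) gs

toBits-injective : ∀ l {n} → n ≤ 2 ^ l → (i j : Fin n) → toBits l (toℕ i) ≡ toBits l (toℕ j) → i ≡ j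
toBits-injective l n≤ i j e = Finₚ.toℕ-injective (trans (sym (fromBits-toBits l (toℕ i) (ℕₚ.<-≤-trans (Finₚ.toℕ<n i) n≤)))
  (trans (cong fromBits e) (fromBits-toBits l (toℕ j) (ℕₚ.<-≤-trans (Finₚ.toℕ<n j) n≤))))

foolsComparator : ∀ {n ℓ} l Z (gen : El Z → Vec Bool l → Bool) ε → n ≤ 2 ^ l →
                  (∀ (c : Circ (Vec Bool l) ℓ) → Close ε (𝔼 Z λ z → ind (eval c (gen z)))
                                                         (𝔼 (table bit l) λ a → ind (eval c (get bit a)))) →
                  FoolsComparator {bits Z} {n} (λ z → Data.Vec.tabulate (gen (decode Z z) ∘ toBits l ∘ toℕ)) ℓ ε
foolsComparator {n} {ℓ} l Z gen ε n≤ close C = Close⇒∣-∣≤ (Close-resp (sym left) (sym right) (close c))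
  where
  open ≡-Reasoning
  c = fromComp l C
  left : Pr (bits Z) (λ z → evalComp C (Data.Vec.tabulate (gen (decode Z z) ∘ toBits l ∘ toℕ))) ≡ 𝔼 Z λ z → ind (eval c (gen z))
  left = trans (Pr≡𝔼 (bits Z) _) (trans
    (𝔼-cong (vec bit (bits Z)) λ z → cong ind (eval-fromComp l C (gen (decode Z z))))
    (𝔼-decode Z λ z → ind (eval c (gen z))))
  right : Pr n (evalComp C) ≡ 𝔼 (table bit l) λ a → ind (eval c (get bit a))
  right = trans (Pr≡𝔼 n (evalComp C)) (trans
    (sym (𝔼-gets n (toBits l ∘ toℕ) (toBits-injective l n≤) (ind ∘ evalComp C)))
    (𝔼-cong (table bit l) λ a → cong ind (eval-fromComp l C (get bit a))))

-- The hypothesis gives ε ≥ n^-d, which is at least 2^-(l * d); a nonpositive ε contradicts it.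
½^≤ε : ∀ n l d ε → n ≤ 2 ^ l → 1ℚ ≤ℚ ε *ℚ (+ (n ^ d) / 1) → ½^ (l * d) ≤ℚ ε
½^≤ε n l d ε n≤ h with ℚₚ.≤-total ε 0ℚ
... | inj₁ ε≤0 = ⊥-elim (ℚₚ.<-irrefl refl (ℚₚ.<-≤-trans (toWitness {a? = 0ℚ ℚₚ.<? 1ℚ} _) (ℚₚ.≤-trans h′
      (ℚₚ.≤-trans (ℚₚ.*-monoʳ-≤-nonNeg (fromℕ (n ^ d)) {{nonNegative (0≤fromℕ (n ^ d))}} ε≤0) (ℚₚ.≤-reflexive (ℚₚ.*-zeroˡ (fromℕ (n ^ d))))))))
  where
  h′ : 1ℚ ≤ℚ ε *ℚ fromℕ (n ^ d)
  h′ = subst (λ c → 1ℚ ≤ℚ ε *ℚ c) (trans (sym (ℚₚ.*-identityʳ _)) (fraction (n ^ d) 1)) h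
... | inj₂ 0≤ε = begin
  ½^ (l * d)                                   ≡⟨ ℚₚ.*-identityˡ _ ⟨
  1ℚ *ℚ ½^ (l * d)                             ≤⟨ ℚₚ.*-monoʳ-≤-nonNeg (½^ (l * d)) {{nonNegative (0≤½^ (l * d))}} (begin
    1ℚ                                         ≤⟨ h ⟩
    ε *ℚ (+ (n ^ d) / 1)                       ≡⟨ cong (ε *ℚ_) (trans (sym (ℚₚ.*-identityʳ _)) (fraction (n ^ d) 1)) ⟩
    ε *ℚ fromℕ (n ^ d)
      ≤⟨ ℚₚ.*-monoˡ-≤-nonNeg ε {{nonNegative 0≤ε}} (ℚₚ.≤-trans (fromℕ-mono n^d≤) (ℚₚ.≤-reflexive (fromℕ-2^ (l * d)))) ⟩
    ε *ℚ p2 (l * d)                            ∎) ⟩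
  (ε *ℚ p2 (l * d)) *ℚ ½^ (l * d)              ≡⟨ ℚₚ.*-assoc ε (p2 (l * d)) (½^ (l * d)) ⟩
  ε *ℚ (p2 (l * d) *ℚ ½^ (l * d))              ≡⟨ cong (ε *ℚ_) (p2-½^ (l * d)) ⟩
  ε *ℚ 1ℚ                                      ≡⟨ ℚₚ.*-identityʳ ε ⟩
  ε                                            ∎
  where
  open ℚₚ.≤-Reasoning
  n^d≤ : n ^ d ≤ 2 ^ (l * d)
  n^d≤ = ℕₚ.≤-trans (ℕₚ.^-monoˡ-≤ d n≤) (ℕₚ.≤-reflexive (ℕₚ.^-*-assoc 2 l d))

-- Logarithms and the choice of parameters

n≤2^⌈log₂n⌉ : ∀ n → n ≤ 2 ^ ⌈log₂ n ⌉
n≤2^⌈log₂n⌉ = <-rec (λ n → n ≤ 2 ^ ⌈log₂ n ⌉) go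
  where
  open ℕₚ.≤-Reasoning
  go : ∀ n → (∀ {m} → m < n → m ≤ 2 ^ ⌈log₂ m ⌉) → n ≤ 2 ^ ⌈log₂ n ⌉
  go zero          _  = z≤n
  go (suc zero)    _  = s≤s z≤n
  go n@(suc (suc k)) ih = begin
    n                                ≡⟨ ℕₚ.⌊n/2⌋+⌈n/2⌉≡n n ⟨
    ⌊ n /2⌋ + ⌈ n /2⌉                ≤⟨ ℕₚ.+-monoˡ-≤ ⌈ n /2⌉ (ℕₚ.⌊n/2⌋≤⌈n/2⌉ n) ⟩
    ⌈ n /2⌉ + ⌈ n /2⌉                ≤⟨ ℕₚ.+-mono-≤ half half ⟩
    2 ^ ⌈log₂ ⌈ n /2⌉ ⌉ + 2 ^ ⌈log₂ ⌈ n /2⌉ ⌉ ≡⟨ cong (λ z → 2 ^ ⌈log₂ ⌈ n /2⌉ ⌉ + z) (ℕₚ.+-identityʳ _) ⟨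
    2 ^ suc ⌈log₂ ⌈ n /2⌉ ⌉          ≡⟨ cong (λ z → 2 ^ suc z) (⌈log₂⌈n/2⌉⌉≡⌈log₂n⌉∸1 n) ⟩
    2 ^ (1 + (⌈log₂ n ⌉ ∸ 1))        ≡⟨ cong (2 ^_) (ℕₚ.m+[n∸m]≡n (⌈log₂⌉-mono-≤ {2} {n} (s≤s (s≤s z≤n)))) ⟩
    2 ^ ⌈log₂ n ⌉                    ∎
    where
    half : ⌈ n /2⌉ ≤ 2 ^ ⌈log₂ ⌈ n /2⌉ ⌉
    half = ih (ℕₚ.⌈n/2⌉<n k)

power-bracket : ∀ B ℓ → 1 ≤ B → 1 ≤ ℓ → Σ ℕ λ e → 2 ^ (B * e) ≤ ℓ × ℓ ≤ 2 ^ (B * suc e)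
power-bracket B ℓ 1≤B 1≤ℓ = search ℓ (ℕₚ.<⇒≤ (ℕₚ.<-≤-trans (n<2^n ℓ) (2^-mono (ℕₚ.≤-trans (ℕₚ.≤-reflexive (sym (ℕₚ.*-identityˡ ℓ))) (ℕₚ.*-monoˡ-≤ ℓ 1≤B)))))
  where
  n<2^n : ∀ n → n < 2 ^ n
  n<2^n zero    = s≤s z≤n
  n<2^n (suc n) = ℕₚ.≤-trans (ℕₚ.+-mono-≤ (ℕₚ.≤-trans (s≤s z≤n) (n<2^n n)) (n<2^n n))
    (ℕₚ.≤-reflexive (cong (λ z → 2 ^ n + z) (sym (ℕₚ.+-identityʳ (2 ^ n)))))
  search : ∀ k → ℓ ≤ 2 ^ (B * k) → Σ ℕ λ e → 2 ^ (B * e) ≤ ℓ × ℓ ≤ 2 ^ (B * suc e)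
  search zero    h = 0 , subst (λ z → 2 ^ z ≤ ℓ) (sym (ℕₚ.*-zeroʳ B)) 1≤ℓ ,
                     ℕₚ.≤-trans h (2^-mono (ℕₚ.*-monoʳ-≤ B z≤n))
  search (suc k) h with 2 ^ (B * k) ≤? ℓ
  ... | yes p = k , p , h
  ... | no ¬p = search k (ℕₚ.<⇒≤ (ℕₚ.≰⇒> ¬p))

n²≤2^n : ∀ n → 4 ≤ n → n * n ≤ 2 ^ n
n²≤2^n n 4≤n with ℕₚ.m≤n⇒∃[o]m+o≡n 4≤n
... | o , refl = go o
  where
  open ℕₚ.≤-Reasoning
  go : ∀ o → (4 + o) * (4 + o) ≤ 2 ^ (4 + o)
  go zero    = ℕₚ.≤-refl
  go (suc o) = begin
    (4 + suc o) * (4 + suc o)              ≤⟨ ℕₚ.m≤m+n _ (o * o + 6 * o + 7) ⟩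
    (4 + suc o) * (4 + suc o) + (o * o + 6 * o + 7) ≡⟨ lem o ⟩
    2 * ((4 + o) * (4 + o))                ≤⟨ ℕₚ.*-monoʳ-≤ 2 (go o) ⟩
    2 * 2 ^ (4 + o)                        ∎
    where
    lem : ∀ o → (4 + suc o) * (4 + suc o) + (o * o + 6 * o + 7) ≡ 2 * ((4 + o) * (4 + o))
    lem = solve-∀

-- The o(1) is spelled out as 1/(k+1): comparing the powers 3(k+1) and 2(k+1) + 3 bounds r and the
-- circuit size by ℓ^(2/3 + 1/(k+1)).
theorem18 : (a d k : ℕ) →
    ∃[ N ] ((n ℓ : ℕ) (ε : ℚ) →
    N ≤ n →
    n ≤ ℓ ^ suc a →
    Data.Rational._≤_ 1ℚ (ε Data.Rational.* (+ (n ^ d) / 1)) →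
    Σ ℕ (λ r → Σ (Vec Bool r → Vec Bool n) (λ G →
    (r ^ (3 * suc k) ≤ ℓ ^ (2 * suc k + 3))
    × FoolsComparator G ℓ ε
    × ((z : Vec Bool r) → Σ (Circuit ⌈log₂ n ⌉) (λ D →
    (circuitSize D ^ (3 * suc k) ≤ ℓ ^ (2 * suc k + 3))
    × ((j : Fin n) → evalCircuit D (toBits ⌈log₂ n ⌉ (toℕ j)) ≡ lookup (G z) j))))))
-- Since n ≤ 2^(c₁ * e), an n this large forces e ≥ e₀.
theorem18 a d k = suc (2 ^ (c₁ * e₀)) , generator
  where
  -- ℓ is between 2^(3L(e-1)) and 2^(3Le), the gadget handles 2^(Le) wires, and 2^σ with σ = e / 16 exceeds C e.
  L c₁ C σ₀ e₀ : ℕ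
  L  = suc k
  c₁ = (3 * L) * suc a
  -- The first four summands form the coefficient of e in the bound on `q`, the last one that in the
  -- bound on `room`.
  C  = c₁ + 1 + c₁ * d + L * (c₁ + 2) + (6 + 2 * L)
  σ₀ = 31 * C
  e₀ = 16 * σ₀
  6+2L≤C : 6 + 2 * L ≤ C
  6+2L≤C = ℕₚ.m≤n+m (6 + 2 * L) (c₁ + 1 + c₁ * d + L * (c₁ + 2))
  generator : (n ℓ : ℕ) (ε : ℚ) → suc (2 ^ (c₁ * e₀)) ≤ n → n ≤ ℓ ^ suc a →
    Data.Rational._≤_ 1ℚ (ε Data.Rational.* (+ (n ^ d) / 1)) →
    Σ ℕ (λ r → Σ (Vec Bool r → Vec Bool n) (λ G →
    (r ^ (3 * suc k) ≤ ℓ ^ (2 * suc k + 3))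
    × FoolsComparator G ℓ ε
    × ((z : Vec Bool r) → Σ (Circuit ⌈log₂ n ⌉) (λ D →
    (circuitSize D ^ (3 * suc k) ≤ ℓ ^ (2 * suc k + 3))
    × ((j : Fin n) → evalCircuit D (toBits ⌈log₂ n ⌉ (toℕ j)) ≡ lookup (G z) j)))))
  generator n ℓ ε N≤n n≤ℓ^ ε≥ =
    bits Z , G , exponent-bound r≤ , fooling , λ z →
      proj₁ (D z) , exponent-bound (ℕₚ.≤-trans (proj₁ (proj₂ (D z))) size≤) , λ j →
        trans (proj₂ (proj₂ (D z)) (toBits l (toℕ j)))
              (sym (Vecₚ.lookup∘tabulate (gen (decode Z z) ∘ toBits l ∘ toℕ) j))
    where
    open ℕₚ.≤-Reasoning
    1≤n : 1 ≤ n
    1≤n = ℕₚ.≤-trans (s≤s z≤n) N≤n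
    1≤ℓ : ∀ ℓ → n ≤ ℓ ^ suc a → 1 ≤ ℓ
    1≤ℓ zero    h = ⊥-elim (ℕₚ.<⇒≱ 1≤n h)
    1≤ℓ (suc ℓ) h = s≤s z≤n
    bracket : Σ ℕ λ e → 2 ^ (3 * L * e) ≤ ℓ × ℓ ≤ 2 ^ (3 * L * suc e)
    bracket = power-bracket (3 * L) ℓ (s≤s z≤n) (1≤ℓ ℓ n≤ℓ^)
    e′ e σ l q b : ℕ
    e′ = proj₁ bracket
    e  = suc e′
    -- The final count of exponents has 32σ and can afford 2e.
    σ  = e Data.Nat./ 16
    l  = ⌈log₂ n ⌉
    -- The final error 2^-(l * d) takes l + 1 further bits in the last generator, and each of the L
    -- gadget steps takes l + 2.
    q  = l + suc (l * d) + L * (l + 2)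
    -- About ℓ^(2/3) buckets: 2^(L * e) wires in each suffice for ℓ ≤ 2^(3 * L * e), up to the
    -- factor 4.
    b  = 2 + 2 * (L * e)
    n≤ : n ≤ 2 ^ (c₁ * e)
    n≤ = begin
      n                            ≤⟨ n≤ℓ^ ⟩
      ℓ ^ suc a                    ≤⟨ ℕₚ.^-monoˡ-≤ (suc a) (proj₂ (proj₂ bracket)) ⟩
      (2 ^ (3 * L * e)) ^ suc a    ≡⟨ ℕₚ.^-*-assoc 2 (3 * L * e) (suc a) ⟩
      2 ^ (3 * L * e * suc a)      ≡⟨ cong (2 ^_) (lem (3 * L) e (suc a)) ⟩
      2 ^ (c₁ * e)                 ∎
      where
      lem : ∀ x y z → x * y * z ≡ x * z * y
      lem = solve-∀
    e₀≤e : e₀ ≤ e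
    e₀≤e with e₀ ≤? e
    ... | yes h = h
    ... | no ¬h = ⊥-elim (ℕₚ.<⇒≱ N≤n (ℕₚ.≤-trans n≤ (2^-mono (ℕₚ.*-monoʳ-≤ c₁ (ℕₚ.<⇒≤ (ℕₚ.≰⇒> ¬h))))))
    16σ≤e : 16 * σ ≤ e
    16σ≤e = ℕₚ.≤-trans (ℕₚ.≤-reflexive (ℕₚ.*-comm 16 σ)) (m/n*n≤m e 16)
    σ₀≤σ : σ₀ ≤ σ
    σ₀≤σ = ℕₚ.≤-trans (ℕₚ.≤-reflexive (sym (trans (cong (Data.Nat._/ 16) (ℕₚ.*-comm 16 σ₀)) (m*n/n≡m σ₀ 16)))) (/-monoˡ-≤ 16 e₀≤e)
    C≤σ : C ≤ σ
    C≤σ = ℕₚ.≤-trans (ℕₚ.m≤m+n C (30 * C)) σ₀≤σ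
    6≤σ : 6 ≤ σ
    6≤σ = ℕₚ.≤-trans (ℕₚ.≤-trans (ℕₚ.m≤m+n 6 (2 * L)) 6+2L≤C) C≤σ
    e≤31σ : e ≤ 31 * σ
    e≤31σ = begin
      e                       ≡⟨ m≡m%n+[m/n]*n e 16 ⟩
      e % 16 + σ * 16         ≤⟨ ℕₚ.+-monoˡ-≤ (σ * 16) (ℕₚ.≤-trans (ℕₚ.≤-pred (m%n<n e 16)) (ℕₚ.*-monoʳ-≤ 15 (ℕₚ.≤-trans (s≤s z≤n) 6≤σ))) ⟩
      15 * σ + σ * 16         ≡⟨ lem σ ⟩
      31 * σ                  ∎
      where
      lem : ∀ σ → 15 * σ + σ * 16 ≡ 31 * σ
      lem = solve-∀
    -- Polylogarithmic quantities are linear in e, hence in σ as e ≤ 16σ + 15. For σ ≥ σ₀ = 31 * C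
    -- they are at most σ², thus at most 2^σ.
    Ce≤2^σ : C * e ≤ 2 ^ σ
    Ce≤2^σ = begin
      C * e            ≤⟨ ℕₚ.*-monoʳ-≤ C e≤31σ ⟩
      C * (31 * σ)     ≡⟨ lem C σ ⟩
      σ₀ * σ           ≤⟨ ℕₚ.*-monoˡ-≤ σ σ₀≤σ ⟩
      σ * σ            ≤⟨ n²≤2^n σ (ℕₚ.≤-trans (s≤s (s≤s (s≤s (s≤s z≤n)))) 6≤σ) ⟩
      2 ^ σ            ∎
      where
      lem : ∀ x y → x * (31 * y) ≡ 31 * x * y
      lem = solve-∀
    l≤c₁e : l ≤ c₁ * e
    l≤c₁e = ℕₚ.≤-trans (⌈log₂⌉-mono-≤ n≤) (ℕₚ.≤-reflexive (⌈log₂2^n⌉≡n (c₁ * e)))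
    1≤e : 1 ≤ e
    1≤e = s≤s z≤n
    q≤C′e : q ≤ (c₁ + 1 + c₁ * d + L * (c₁ + 2)) * e
    q≤C′e = begin
      l + suc (l * d) + L * (l + 2)
        ≤⟨ ℕₚ.+-mono-≤ (ℕₚ.+-mono-≤ l≤c₁e (ℕₚ.+-mono-≤ 1≤e (ℕₚ.*-monoˡ-≤ d l≤c₁e)))
             (ℕₚ.*-monoʳ-≤ L (ℕₚ.+-mono-≤ l≤c₁e (ℕₚ.*-monoʳ-≤ 2 1≤e))) ⟩
      c₁ * e + (e + c₁ * e * d) + L * (c₁ * e + 2 * e)
        ≡⟨ lem c₁ e d L ⟩
      (c₁ + 1 + c₁ * d + L * (c₁ + 2)) * e ∎
      where
      lem : ∀ c e d L → c * e + (e + c * e * d) + L * (c * e + 2 * e) ≡ (c + 1 + c * d + L * (c + 2)) * e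
      lem = solve-∀
    room′ : 5 + (2 * (L * e) + 8 * σ) ≤ (6 + 2 * L) * e
    room′ = begin
      5 + (2 * (L * e) + 8 * σ)
        ≤⟨ ℕₚ.+-mono-≤ (ℕₚ.*-monoʳ-≤ 5 1≤e) (ℕₚ.+-monoʳ-≤ (2 * (L * e)) (ℕₚ.≤-trans (ℕₚ.*-monoˡ-≤ σ {8} {16} (ℕₚ.m≤m+n 8 8)) 16σ≤e)) ⟩
      5 * e + (2 * (L * e) + e) ≡⟨ lem L e ⟩
      (6 + 2 * L) * e ∎
      where
      lem : ∀ L e → 5 * e + (2 * (L * e) + e) ≡ (6 + 2 * L) * e
      lem = solve-∀
    q≤ : q ≤ 2 ^ σ
    q≤ = ℕₚ.≤-trans q≤C′e (ℕₚ.≤-trans (ℕₚ.*-monoˡ-≤ e (ℕₚ.m≤m+n (c₁ + 1 + c₁ * d + L * (c₁ + 2)) (6 + 2 * L))) Ce≤2^σ)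
    l≤ : l ≤ 2 ^ σ
    l≤ = ℕₚ.≤-trans (ℕₚ.≤-trans (ℕₚ.m≤m+n l (suc (l * d))) (ℕₚ.m≤m+n _ (L * (l + 2)))) q≤
    room : 5 + (2 * (L * e) + 8 * σ) ≤ 2 ^ σ
    room = ℕₚ.≤-trans room′ (ℕₚ.≤-trans (ℕₚ.*-monoˡ-≤ e 6+2L≤C) Ce≤2^σ)
    b≤ : b ≤ 2 ^ σ
    b≤ = ℕₚ.≤-trans (ℕₚ.+-mono-≤ {2} {5} raise (ℕₚ.m≤m+n (2 * (L * e)) (8 * σ))) room
    4σ≤e : 4 * σ ≤ e
    4σ≤e = ℕₚ.≤-trans (ℕₚ.*-monoˡ-≤ σ {4} {16} (ℕₚ.m≤m+n 4 12)) 16σ≤e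
    base : Gadget l (L * e) (l + suc (l * d)) σ (2 * (L * e) + e)
    base = gadget l e q L σ 6≤σ l≤ q≤ room 4σ≤e L (l + suc (l * d)) ℕₚ.≤-refl ℕₚ.≤-refl
    open Gadget base renaming (n to cost)
    Z : U
    Z = Seed l b q I
    gen : El Z → Vec Bool l → Bool
    gen = generate {b = b} {q} I s
    G : Vec Bool (bits Z) → Vec Bool n
    G z = Data.Vec.tabulate (gen (decode Z z) ∘ toBits l ∘ toℕ)
    enough-buckets : 4 * ℓ ≤ 2 ^ (L * e) * 2 ^ b
    enough-buckets = begin
      4 * ℓ                                        ≤⟨ ℕₚ.*-monoʳ-≤ 4 (proj₂ (proj₂ bracket)) ⟩
      4 * 2 ^ (3 * L * e)                          ≡⟨ cong (λ x → 4 * 2 ^ x) (lem₁ L e) ⟩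
      4 * 2 ^ (L * e + 2 * (L * e))                ≡⟨ cong (4 *_) (ℕₚ.^-distribˡ-+-* 2 (L * e) (2 * (L * e))) ⟩
      4 * (2 ^ (L * e) * 2 ^ (2 * (L * e)))        ≡⟨ lem₂ (2 ^ (L * e)) (2 ^ (2 * (L * e))) ⟩
      2 ^ (L * e) * 2 ^ b                          ∎
      where
      lem₁ : ∀ L e → 3 * L * e ≡ L * e + 2 * (L * e)
      lem₁ = solve-∀
      lem₂ : ∀ x y → 4 * (x * y) ≡ x * (2 * (2 * y))
      lem₂ = solve-∀
    fooling : FoolsComparator G ℓ ε
    fooling = foolsComparator l Z gen ε (n≤2^⌈log₂n⌉ n) λ c →
      Close-mono (ℚₚ.≤-trans (stage-error l (l * d) q (ℕₚ.m≤m+n _ (L * (l + 2)))) (½^≤ε n l d ε (n≤2^⌈log₂n⌉ n) ε≥))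
        (generate-fools (L * e) b q I s c (½^ (l + suc (l * d))) (0≤½^ (l + suc (l * d))) fools enough-buckets)
    -- Constants are made from some existing node, so at least one input is needed: n ≥ 2 gives l ≥
    -- 1.
    node : Fin l
    node = Data.Fin.fromℕ< {0} (ℕₚ.≤-trans (ℕₚ.≤-reflexive (sym (⌈log₂2^n⌉≡n 1)))
      (⌈log₂⌉-mono-≤ (ℕₚ.≤-trans (s≤s (ℕₚ.m^n>0 2 (c₁ * e₀))) N≤n)))
    D : ∀ z → Σ (Circuit l) λ D → circuitSize D ≤ 2 * bits Z + 0 + (2 + q * layerCost l b cost (bits I)) ×
                                  (∀ x → evalCircuit D x ≡ gen (decode Z z) x)
    D z = toCircuit node (⟨ constC Z (decode Z z) , idC ⟩ ▸ generateC b q I comp)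
    F : ℕ
    F = 2 * (L * e) + e
    2^b≤ : Bound σ (2 * (L * e)) 1 (2 ^ b)
    2^b≤ = bound-shift 6≤σ 2 (bound-2^ b)
    Z≤ : Bound σ F 6 (bits Z)
    Z≤ = bound-up (ℕₚ.m≤m+n (2 * (L * e)) e) ℕₚ.≤-refl (bound-seed 6≤σ l b q I l≤ b≤ q≤ short 2^b≤)
    r≤ : bits Z ≤ 2 ^ (F + 29 * σ)
    r≤ = Bound.bounded (bound-up ℕₚ.≤-refl (raise {6} {29}) Z≤)
    size≤ : 2 * bits Z + 0 + (2 + q * layerCost l b cost (bits I)) ≤ 2 ^ (F + 29 * σ)
    size≤ = Bound.bounded (bound-+ 6≤σ
      (bound-≤ (ℕₚ.≤-reflexive (ℕₚ.+-identityʳ _)) (bound-up ℕₚ.≤-refl (raise {7} {28}) (bound-scale (bound-num 6≤σ 2) Z≤)))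
      (bound-generate 6≤σ l b q I cost l≤ b≤ q≤ short 2^b≤ (ℕₚ.m≤m+n (2 * (L * e)) e) (raise {6} {24}) cheap))
    exponent-bound : ∀ {x} → x ≤ 2 ^ (F + 29 * σ) → x ^ (3 * suc k) ≤ ℓ ^ (2 * suc k + 3)
    exponent-bound {x} h = begin
      x ^ (3 * L)                              ≤⟨ ℕₚ.^-monoˡ-≤ (3 * L) h ⟩
      (2 ^ (F + 29 * σ)) ^ (3 * L)             ≡⟨ ℕₚ.^-*-assoc 2 (F + 29 * σ) (3 * L) ⟩
      2 ^ ((F + 29 * σ) * (3 * L))             ≤⟨ 2^-mono (ℕₚ.*-monoˡ-≤ (3 * L) linear) ⟩
      2 ^ (e′ * (2 * L + 3) * (3 * L))         ≡⟨ cong (2 ^_) (lem₁ e′ (2 * L + 3) (3 * L)) ⟩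
      2 ^ (3 * L * e′ * (2 * L + 3))           ≡⟨ ℕₚ.^-*-assoc 2 (3 * L * e′) (2 * L + 3) ⟨
      (2 ^ (3 * L * e′)) ^ (2 * L + 3)         ≤⟨ ℕₚ.^-monoˡ-≤ (2 * L + 3) (proj₁ (proj₂ bracket)) ⟩
      ℓ ^ (2 * L + 3)                          ∎
      where
      lem₁ : ∀ x y z → x * y * z ≡ z * x * y
      lem₁ = solve-∀
      lem₂ : ∀ L e′ σ → 2 * (L * (1 + e′)) + (1 + e′) + 29 * σ + 2 ≡ 2 * (L * e′) + e′ + (2 * L + 3 + 29 * σ)
      lem₂ = solve-∀
      lem₃ : ∀ σ → 3 * σ + 29 * σ ≡ 2 * (16 * σ)
      lem₃ = solve-∀
      lem₄ : ∀ L e′ → 2 * (L * e′) + e′ + 2 * (1 + e′) ≡ e′ * (2 * L + 3) + 2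
      lem₄ = solve-∀
      -- Multiplied out with e = e′ + 1, this says 2 * L + 3 + 29 * σ ≤ 2 * e. The left side is at
      -- most 32 * σ.
      linear : F + 29 * σ ≤ e′ * (2 * L + 3)
      linear = ℕₚ.+-cancelʳ-≤ 2 _ _ (begin
        F + 29 * σ + 2                               ≡⟨ lem₂ L e′ σ ⟩
        2 * (L * e′) + e′ + (2 * L + 3 + 29 * σ)
          ≤⟨ ℕₚ.+-monoʳ-≤ (2 * (L * e′) + e′) (ℕₚ.+-monoˡ-≤ (29 * σ) (begin
               2 * L + 3   ≤⟨ ℕₚ.+-monoʳ-≤ (2 * L) (ℕₚ.m≤m+n 3 3) ⟩
               2 * L + 6   ≡⟨ ℕₚ.+-comm (2 * L) 6 ⟩
               6 + 2 * L   ≤⟨ ℕₚ.≤-trans 6+2L≤C C≤σ ⟩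
               σ           ≤⟨ ℕₚ.m≤m+n σ (σ + (σ + 0)) ⟩
               3 * σ       ∎)) ⟩
        2 * (L * e′) + e′ + (3 * σ + 29 * σ)         ≡⟨ cong (λ x → 2 * (L * e′) + e′ + x) (lem₃ σ) ⟩
        2 * (L * e′) + e′ + 2 * (16 * σ)             ≤⟨ ℕₚ.+-monoʳ-≤ (2 * (L * e′) + e′) (ℕₚ.*-monoʳ-≤ 2 16σ≤e) ⟩
        2 * (L * e′) + e′ + 2 * e                    ≡⟨ lem₄ L e′ ⟩
        e′ * (2 * L + 3) + 2                         ∎)
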